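{- Let $n\ge 1$ be an integer, let $m$ be an integer with $\gcd(n,m)=1$, and let $q=e^{2\pi m i/n}$. Then $$1+2\sum_{k=1}^{n-1}q^{k}\binom{2k-1}{k}_q=\begin{cases}\left(\frac{m}{3}\right) i\sqrt{3} & \text{if } 3\mid n,\\[4pt] \left(\frac{n}{3}\right) & \text{otherwise.}\end{cases}$$
   Context: The Gaussian $q$-binomial coefficient $\binom{n}{k}_q$ is the polynomial in $q$ given by $\binom{n}{k}_q=\dfrac{(q;q)_n}{(q;q)_k(q;q)_{n-k}}$ if $0\le k\le n$ and $\binom{n}{k}_q=0$ otherwise, where $(z;q)_n=\prod_{j=0}^{n-1}(1-zq^j)$; at a root of unity it denotes the value of this polynomial. $\left(\frac{\cdot}{3}\right)$ is the Legendre symbol modulo $3$ (equal to $0,1,-1$ for arguments $\equiv 0,1,2 \pmod 3$ respectively). -}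

module Defs where

open import Algebra.Bundles using (CommutativeRing)
open import Data.Integer.Base as ℤ using (ℤ; +_; -[1+_]; 0ℤ; 1ℤ; -1ℤ)
import Data.Integer.Properties as ℤ
import Data.Integer.Tactic.RingSolver as ℤ-Solver
open import Data.List.Base using (List; []; _∷_; map)
open import Data.Maybe.Base as Maybe using (Maybe; just; nothing)
open import Data.Nat.Base as ℕ using (ℕ; zero; suc; z≤n; s≤s; _!)
import Data.Nat.Properties as ℕ
import Data.Nat.Tactic.RingSolver as ℕ-Solver
open import Data.Product.Base using (∃; _,_; _×_; proj₁; proj₂)
open import Data.Rational.Base as ℚ using (ℚ)
open import Data.Sum.Base using (inj₁; inj₂)
open import Level using (0ℓ)
open import Relation.Binary.PropositionalEquality hiding (J)
open import Relation.Nullary using (yes; no; contradiction)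
open import Tactic.RingSolver using (solve-∀)
open import Tactic.RingSolver.Core.AlmostCommutativeRing using (AlmostCommutativeRing; fromCommutativeRing)

module Real where

  open import Data.Rational.Base
  open import Data.Rational.Properties
  open import Data.Rational.Literals using (fromℤ)
  import Data.Rational.Unnormalised.Base as ℚᵘ
  import Data.Rational.Unnormalised.Properties as ℚᵘ

  ℚ-ring : AlmostCommutativeRing _ _
  ℚ-ring = fromCommutativeRing +-*-commutativeRing λ { (mkℚ (+ 0) 0 _) → just refl ; _ → nothing }

  0<½ : 0ℚ < ½
  0<½ = *<* (ℤ.+<+ (s≤s z≤n))

  0<1 : 0ℚ < 1ℚ
  0<1 = *<* (ℤ.+<+ (s≤s z≤n))

  ½+½ : ∀ ε → ½ * ε + ½ * ε ≡ ε
  ½+½ ε = trans (sym (*-distribʳ-+ ε ½ ½)) (*-identityˡ ε)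

  *-pos : ∀ {p q} → 0ℚ < p → 0ℚ < q → 0ℚ < p * q
  *-pos {p} {q} 0<p 0<q =
    positive⁻¹ (p * q) {{pos*pos⇒pos p {{positive 0<p}} q {{positive 0<q}}}}

  *-nonneg : ∀ {p q} → 0ℚ ≤ p → 0ℚ ≤ q → 0ℚ ≤ p * q
  *-nonneg {p} {q} 0≤p 0≤q =
    nonNegative⁻¹ (p * q) {{nonNeg*nonNeg⇒nonNeg p {{nonNegative 0≤p}} q {{nonNegative 0≤q}}}}

  *-monoˡ : ∀ {p q} r → 0ℚ ≤ r → p ≤ q → r * p ≤ r * q
  *-monoˡ r 0≤r = *-monoˡ-≤-nonNeg r {{nonNegative 0≤r}}

  *-monoʳ : ∀ {p q} r → 0ℚ ≤ r → p ≤ q → p * r ≤ q * r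
  *-monoʳ r 0≤r = *-monoʳ-≤-nonNeg r {{nonNegative 0≤r}}

  *-mono : ∀ {p q r s} → 0ℚ ≤ r → 0ℚ ≤ q → p ≤ q → r ≤ s → p * r ≤ q * s
  *-mono {p} {q} {r} 0≤r 0≤q p≤q r≤s = ≤-trans (*-monoʳ r 0≤r p≤q) (*-monoˡ q 0≤q r≤s)

  +-nonneg : ∀ {p q} → 0ℚ ≤ p → 0ℚ ≤ q → 0ℚ ≤ p + q
  +-nonneg = +-mono-≤

  p≤p+q : ∀ p {q} → 0ℚ ≤ q → p ≤ p + q
  p≤p+q p 0≤q = ≤-trans (≤-reflexive (sym (+-identityʳ p))) (+-monoʳ-≤ p 0≤q)

  p≤q+p : ∀ p {q} → 0ℚ ≤ q → p ≤ q + p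
  p≤q+p p {q} 0≤q = ≤-trans (p≤p+q p 0≤q) (≤-reflexive (+-comm p q))

  p-q≤r : ∀ p q {r} → p ≤ r + q → p - q ≤ r
  p-q≤r p q {r} h = ≤-trans (+-monoˡ-≤ (- q) h) (≤-reflexive (lem r q))
    where
    lem : ∀ r q → (r + q) - q ≡ r
    lem = solve-∀ ℚ-ring

  p≤r+q : ∀ p q {r} → p - q ≤ r → p ≤ r + q
  p≤r+q p q {r} h = ≤-trans (≤-reflexive (lem p q)) (+-monoˡ-≤ q h)
    where
    lem : ∀ p q → p ≡ (p - q) + q
    lem = solve-∀ ℚ-ring

  ∣p-q∣≤ : ∀ p q {r} → p - q ≤ r → q - p ≤ r → ∣ p - q ∣ ≤ r
  ∣p-q∣≤ p q h h′ with ∣p∣≡p∨∣p∣≡-p (p - q)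
  ... | inj₁ e = ≤-trans (≤-reflexive e) h
  ... | inj₂ e = ≤-trans (≤-reflexive (trans e (lem p q))) h′
    where
    lem : ∀ p q → - (p - q) ≡ q - p
    lem = solve-∀ ℚ-ring

  p≤∣p∣ : ∀ p → p ≤ ∣ p ∣
  p≤∣p∣ p with ≤-total 0ℚ p
  ... | inj₁ h = ≤-reflexive (sym (0≤p⇒∣p∣≡p h))
  ... | inj₂ h = ≤-trans h (0≤∣p∣ p)

  ∣∣-tri : ∀ p q r → ∣ p - r ∣ ≤ ∣ p - q ∣ + ∣ q - r ∣
  ∣∣-tri p q r = ≤-trans (≤-reflexive (cong ∣_∣ (lem p q r))) (∣p+q∣≤∣p∣+∣q∣ (p - q) (q - r))
    where
    lem : ∀ p q r → p - r ≡ (p - q) + (q - r)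
    lem = solve-∀ ℚ-ring

  ι : ℕ → ℚ
  ι n = fromℤ (+ n)

  /-≤ : ∀ a b c d .{{_ : ℕ.NonZero b}} .{{_ : ℕ.NonZero d}} →
        a ℕ.* d ℕ.≤ c ℕ.* b → + a / b ≤ + c / d
  /-≤ a (suc b) c (suc d) h = toℚᵘ-cancel-≤
    (ℚᵘ.≤-respˡ-≃ (ℚᵘ.≃-sym (toℚᵘ-fromℚᵘ (ℚᵘ.mkℚᵘ (+ a) b)))
    (ℚᵘ.≤-respʳ-≃ (ℚᵘ.≃-sym (toℚᵘ-fromℚᵘ (ℚᵘ.mkℚᵘ (+ c) d)))
      (ℚᵘ.*≤* (subst₂ ℤ._≤_ (ℤ.pos-* a (suc d)) (ℤ.pos-* c (suc b)) (ℤ.+≤+ h)))))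

  /-≡ : ∀ a b c d .{{_ : ℕ.NonZero b}} .{{_ : ℕ.NonZero d}} →
        a ℕ.* d ≡ c ℕ.* b → + a / b ≡ + c / d
  /-≡ a b c d h = ≤-antisym (/-≤ a b c d (ℕ.≤-reflexive h)) (/-≤ c d a b (ℕ.≤-reflexive (sym h)))

  ι-≡ : ∀ n → ι n ≡ + n / 1
  ι-≡ n = sym (fromℚᵘ-toℚᵘ (ι n))

  ι-mono : ∀ {m n} → m ℕ.≤ n → ι m ≤ ι n
  ι-mono {m} {n} h = *≤* (ℤ.*-monoʳ-≤-nonNeg (+ 1) (ℤ.+≤+ h))

  ι-nonneg : ∀ n → 0ℚ ≤ ι n
  ι-nonneg n = ι-mono z≤n

  /-+ : ∀ a b c d .{{_ : ℕ.NonZero b}} .{{_ : ℕ.NonZero d}} .{{_ : ℕ.NonZero (b ℕ.* d)}} →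
        + a / b + + c / d ≡ + (a ℕ.* d ℕ.+ c ℕ.* b) / (b ℕ.* d)
  /-+ a (suc b) c (suc d) = toℚᵘ-injective (begin
    toℚᵘ (p + q)           ≈⟨ toℚᵘ-homo-+ p q ⟩
    toℚᵘ p ℚᵘ.+ toℚᵘ q     ≈⟨ ℚᵘ.+-cong (toℚᵘ-fromℚᵘ u) (toℚᵘ-fromℚᵘ v) ⟩
    u ℚᵘ.+ v               ≡⟨ cong (λ z → ℚᵘ.mkℚᵘ z _)
                                (sym (trans (ℤ.pos-+ (a ℕ.* suc d) _) (cong₂ ℤ._+_ (ℤ.pos-* a (suc d)) (ℤ.pos-* c (suc b))))) ⟩
    w                      ≈⟨ ℚᵘ.≃-sym (toℚᵘ-fromℚᵘ w) ⟩
    toℚᵘ (fromℚᵘ w) ∎)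
    where
    open ℚᵘ.≃-Reasoning
    p = + a / suc b
    q = + c / suc d
    u = ℚᵘ.mkℚᵘ (+ a) b
    v = ℚᵘ.mkℚᵘ (+ c) d
    w = ℚᵘ.mkℚᵘ (+ (a ℕ.* suc d ℕ.+ c ℕ.* suc b)) (d ℕ.+ b ℕ.* suc d)

  /-* : ∀ a b c d .{{_ : ℕ.NonZero b}} .{{_ : ℕ.NonZero d}} .{{_ : ℕ.NonZero (b ℕ.* d)}} →
        (+ a / b) * (+ c / d) ≡ + (a ℕ.* c) / (b ℕ.* d)
  /-* a (suc b) c (suc d) = toℚᵘ-injective (begin
    toℚᵘ (p * q)           ≈⟨ toℚᵘ-homo-* p q ⟩
    toℚᵘ p ℚᵘ.* toℚᵘ q     ≈⟨ ℚᵘ.*-cong (toℚᵘ-fromℚᵘ u) (toℚᵘ-fromℚᵘ v) ⟩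
    u ℚᵘ.* v               ≡⟨ cong (λ z → ℚᵘ.mkℚᵘ z _) (sym (ℤ.pos-* a c)) ⟩
    w                      ≈⟨ ℚᵘ.≃-sym (toℚᵘ-fromℚᵘ w) ⟩
    toℚᵘ (fromℚᵘ w) ∎)
    where
    open ℚᵘ.≃-Reasoning
    p = + a / suc b
    q = + c / suc d
    u = ℚᵘ.mkℚᵘ (+ a) b
    v = ℚᵘ.mkℚᵘ (+ c) d
    w = ℚᵘ.mkℚᵘ (+ (a ℕ.* c)) (d ℕ.+ b ℕ.* suc d)

  ι-+ : ∀ m n → ι (m ℕ.+ n) ≡ ι m + ι n
  ι-+ m n = trans (ι-≡ _) (sym (trans (cong₂ _+_ (ι-≡ m) (ι-≡ n))
    (trans (/-+ m 1 n 1) (cong₂ (λ x y → + (x ℕ.+ y) / 1) (ℕ.*-identityʳ m) (ℕ.*-identityʳ n)))))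

  ι-* : ∀ m n → ι (m ℕ.* n) ≡ ι m * ι n
  ι-* m n = trans (ι-≡ _) (sym (trans (cong₂ _*_ (ι-≡ m) (ι-≡ n)) (/-* m 1 n 1)))

  1/-ι : ∀ d .{{_ : ℕ.NonZero d}} → (+ 1 / d) * ι d ≡ 1ℚ
  1/-ι d@(suc _) = trans (cong ((+ 1 / d) *_) (ι-≡ d)) (trans (/-* 1 d d 1)
    (/-≡ (1 ℕ.* d) (d ℕ.* 1) 1 1 (ℕ.*-assoc 1 d 1)))

  0≤/ : ∀ a b .{{_ : ℕ.NonZero b}} → 0ℚ ≤ + a / b
  0≤/ a b = /-≤ 0 1 a b z≤n

  archimedes : ∀ p → ∃ λ n → p ≤ ι n
  archimedes (mkℚ (+ a) d c) = a , *≤* (ℤ.*-monoˡ-≤-nonNeg (+ a) (ℤ.+≤+ (s≤s z≤n)))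
  archimedes (mkℚ -[1+ a ] d c) = 0 , *≤* ℤ.-≤+

  -- d i j → 0 as i, j → ∞

  Small : (ℕ → ℕ → ℚ) → Set
  Small d = ∀ ε → 0ℚ < ε → ∃ λ N → ∀ i j → N ℕ.≤ i → N ℕ.≤ j → d i j < ε

  Small-≤ : ∀ {d e} N₀ → (∀ i j → N₀ ℕ.≤ i → N₀ ℕ.≤ j → d i j ≤ e i j) → Small e → Small d
  Small-≤ N₀ h s ε 0<ε with s ε 0<ε
  ... | N , f = N₀ ℕ.⊔ N , λ i j p q →
    ≤-<-trans (h i j (ℕ.m⊔n≤o⇒m≤o N₀ N p) (ℕ.m⊔n≤o⇒m≤o N₀ N q))
              (f i j (ℕ.m⊔n≤o⇒n≤o N₀ N p) (ℕ.m⊔n≤o⇒n≤o N₀ N q))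

  Small-+ : ∀ {d e} → Small d → Small e → Small (λ i j → d i j + e i j)
  Small-+ s t ε 0<ε with s (½ * ε) (*-pos 0<½ 0<ε) | t (½ * ε) (*-pos 0<½ 0<ε)
  ... | M , f | N , g = M ℕ.⊔ N , λ i j p q → <-≤-trans
    (+-mono-< (f i j (ℕ.m⊔n≤o⇒m≤o M N p) (ℕ.m⊔n≤o⇒m≤o M N q))
              (g i j (ℕ.m⊔n≤o⇒n≤o M N p) (ℕ.m⊔n≤o⇒n≤o M N q)))
    (≤-reflexive (½+½ ε))

  Small-* : ∀ {d} c → 0ℚ < c → Small d → Small (λ i j → c * d i j)
  Small-* {d} c 0<c s ε 0<ε = proj₁ r , λ i j p q → <-≤-trans
    (*-monoʳ-<-pos c (proj₂ r i j p q))
    (≤-reflexive (trans (sym (*-assoc c (1/ c) ε)) (trans (cong (_* ε) (*-inverseʳ c)) (*-identityˡ ε))))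
    where
    instance
      c-pos : Positive c
      c-pos = positive 0<c
      c-nz : NonZero c
      c-nz = pos⇒nonZero c
    r = s (1/ c * ε) (*-pos (positive⁻¹ (1/ c) {{1/pos⇒pos c}}) 0<ε)

  Small-recip : Small (λ i j → + 1 / suc i + + 1 / suc j)
  Small-recip ε 0<ε with archimedes (+ 2 / 1 * 1/ ε)
    where
    instance
      _ = pos⇒nonZero ε {{positive 0<ε}}
  ... | N , h = N , λ i j p q → <-≤-trans (+-mono-< (bound i p) (bound j q)) (≤-reflexive (½+½ ε))
    where
    instance
      ε-pos : Positive ε
      ε-pos = positive 0<ε
      ε-nz : NonZero ε
      ε-nz = pos⇒nonZero ε
    lem : ∀ h t e u → h * t ≡ 1ℚ → e * u ≡ 1ℚ → h * e * (t * u) ≡ 1ℚ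
    lem h t e u p q = trans (lem′ h t e u) (trans (cong₂ _*_ p q) refl)
      where
      lem′ : ∀ h t e u → h * e * (t * u) ≡ h * t * (e * u)
      lem′ = solve-∀ ℚ-ring
    big : ∀ i → N ℕ.≤ i → 1ℚ < ½ * ε * ι (suc i)
    big i p = ≤-<-trans
      (≤-trans (≤-reflexive (sym (lem ½ (+ 2 / 1) ε (1/ ε) refl (*-inverseʳ ε))))
        (*-monoˡ (½ * ε) (<⇒≤ (*-pos 0<½ 0<ε)) h))
      (*-monoʳ-<-pos (½ * ε) {{positive (*-pos 0<½ 0<ε)}}
        (≤-<-trans (ι-mono p) (*<* (ℤ.*-monoʳ-<-pos (+ 1) (ℤ.+<+ (ℕ.n<1+n i))))))
    bound : ∀ i → N ℕ.≤ i → + 1 / suc i < ½ * ε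
    bound i p = *-cancelʳ-<-nonNeg (ι (suc i)) (≤-<-trans (≤-reflexive (1/-ι (suc i))) (big i p))

  -- ℝ consists of the Cauchy sequences of rationals, identified by _≃ʳ_ when
  -- their difference tends to 0.
  Cauchy : (ℕ → ℚ) → Set
  Cauchy x = ∀ ε → 0ℚ < ε → ∃ λ N → ∀ i j → N ℕ.≤ i → N ℕ.≤ j → ∣ x i - x j ∣ < ε

  record ℝ : Set where
    constructor mkℝ
    field
      seq    : ℕ → ℚ
      cauchy : Cauchy seq
  open ℝ public

  infix 4 _≃ʳ_
  _≃ʳ_ : ℝ → ℝ → Set
  x ≃ʳ y = ∀ ε → 0ℚ < ε → ∃ λ N → ∀ i → N ℕ.≤ i → ∣ seq x i - seq y i ∣ < ε

  ∣∣-pair : ∀ a b c d → ∣ (a + b) - (c + d) ∣ ≤ ∣ a - c ∣ + ∣ b - d ∣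
  ∣∣-pair a b c d = ≤-trans (≤-reflexive (cong ∣_∣ (lem a b c d))) (∣p+q∣≤∣p∣+∣q∣ (a - c) (b - d))
    where
    lem : ∀ a b c d → (a + b) - (c + d) ≡ (a - c) + (b - d)
    lem = solve-∀ ℚ-ring

  fromℚ : ℚ → ℝ
  fromℚ p = mkℝ (λ _ → p) λ ε 0<ε → 0 , λ _ _ _ _ →
    ≤-<-trans (≤-reflexive (cong ∣_∣ (+-inverseʳ p))) 0<ε

  infixl 6 _+ʳ_
  infixl 7 _*ʳ_
  infix  8 -ʳ_

  _+ʳ_ : ℝ → ℝ → ℝ
  x +ʳ y = mkℝ (λ i → seq x i + seq y i)
    (Small-≤ 0 (λ i j _ _ → ∣∣-pair (seq x i) (seq y i) (seq x j) (seq y j))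
      (Small-+ (cauchy x) (cauchy y)))

  -ʳ_ : ℝ → ℝ
  -ʳ x = mkℝ (λ i → - seq x i)
    (Small-≤ 0 (λ i j _ _ → ≤-reflexive (trans (cong ∣_∣ (lem (seq x i) (seq x j))) (∣-p∣≡∣p∣ (seq x i - seq x j)))) (cauchy x))
    where
    lem : ∀ a b → (- a) - (- b) ≡ - (a - b)
    lem = solve-∀ ℚ-ring

  Σ< : ℕ → (ℕ → ℚ) → ℚ
  Σ< zero    f = 0ℚ
  Σ< (suc n) f = Σ< n f + f n

  Σ<-nonneg : ∀ {f} n → (∀ k → 0ℚ ≤ f k) → 0ℚ ≤ Σ< n f
  Σ<-nonneg zero    h = ≤-refl
  Σ<-nonneg (suc n) h = +-nonneg (Σ<-nonneg n h) (h n)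

  Σ<-term : ∀ {f} n → (∀ k → 0ℚ ≤ f k) → ∀ {k} → k ℕ.< n → f k ≤ Σ< n f
  Σ<-term {f} (suc n) h {k} (s≤s k≤n) with ℕ.m≤n⇒m<n∨m≡n k≤n
  ... | inj₁ k<n  = ≤-trans (Σ<-term n h k<n) (p≤p+q _ (h n))
  ... | inj₂ refl = p≤q+p (f n) (Σ<-nonneg n h)

  bounded : (x : ℝ) → ∃ λ B → 0ℚ < B × ∀ i → ∣ seq x i ∣ ≤ B
  bounded x with cauchy x 1ℚ 0<1
  ... | N , f = S + 1ℚ , <-≤-trans 0<1 (p≤q+p 1ℚ S≥0) , bd
    where
    S = Σ< (suc N) (λ k → ∣ seq x k ∣)
    S≥0 : 0ℚ ≤ S
    S≥0 = Σ<-nonneg (suc N) (λ k → 0≤∣p∣ (seq x k))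
    le : ∀ k → k ℕ.≤ N → ∣ seq x k ∣ ≤ S
    le k h = Σ<-term (suc N) (λ k → 0≤∣p∣ (seq x k)) (s≤s h)
    lem : ∀ a b → a ≡ b + (a - b)
    lem = solve-∀ ℚ-ring
    bd : ∀ i → ∣ seq x i ∣ ≤ S + 1ℚ
    bd i with ℕ.≤-total i N
    ... | inj₁ h = ≤-trans (le i h) (p≤p+q S (<⇒≤ 0<1))
    ... | inj₂ h = ≤-trans (≤-reflexive (cong ∣_∣ (lem (seq x i) (seq x N))))
      (≤-trans (∣p+q∣≤∣p∣+∣q∣ (seq x N) _) (+-mono-≤ (le N ℕ.≤-refl) (<⇒≤ (f i N h ℕ.≤-refl))))

  _*ʳ_ : ℝ → ℝ → ℝ
  x *ʳ y = mkℝ (λ i → seq x i * seq y i) c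
    where
    A = proj₁ (bounded x)
    B = proj₁ (bounded y)
    lem : ∀ a b c d → a * b - c * d ≡ a * (b - d) + d * (a - c)
    lem = solve-∀ ℚ-ring
    c : Cauchy (λ i → seq x i * seq y i)
    c = Small-≤ 0 (λ i j _ _ →
      let a = seq x i ; b = seq y i ; c = seq x j ; d = seq y j in
      ≤-trans (≤-reflexive (cong ∣_∣ (lem a b c d)))
      (≤-trans (∣p+q∣≤∣p∣+∣q∣ (a * (b - d)) (d * (a - c)))
      (+-mono-≤
        (≤-trans (≤-reflexive (∣p*q∣≡∣p∣*∣q∣ a (b - d)))
                 (*-monoʳ ∣ b - d ∣ (0≤∣p∣ (b - d)) (proj₂ (proj₂ (bounded x)) i)))
        (≤-trans (≤-reflexive (∣p*q∣≡∣p∣*∣q∣ d (a - c)))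
                 (*-monoʳ ∣ a - c ∣ (0≤∣p∣ (a - c)) (proj₂ (proj₂ (bounded y)) j))))))
      (Small-+ (Small-* A (proj₁ (proj₂ (bounded x))) (cauchy y))
               (Small-* B (proj₁ (proj₂ (bounded y))) (cauchy x)))

  regular⇒cauchy : ∀ x c .{{_ : ℕ.NonZero c}} →
    (∀ i j → x i - x j ≤ ι c * (+ 1 / suc i + + 1 / suc j)) → Cauchy x
  regular⇒cauchy x c@(suc _) h = Small-≤ 0
    (λ i j _ _ → ∣p-q∣≤ (x i) (x j) (h i j)
       (≤-trans (h j i) (≤-reflexive (cong (ι c *_) (+-comm (+ 1 / suc j) (+ 1 / suc i))))))
    (Small-* (ι c) (*<* (ℤ.+<+ (s≤s z≤n))) Small-recip)

  -- ⌊√n⌋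
  isqrt : ℕ → ℕ
  isqrt zero = 0
  isqrt (suc n) with suc (isqrt n) ℕ.* suc (isqrt n) ℕ.≤? suc n
  ... | yes _ = suc (isqrt n)
  ... | no  _ = isqrt n

  isqrt-lower : ∀ n → isqrt n ℕ.* isqrt n ℕ.≤ n
  isqrt-lower zero = z≤n
  isqrt-lower (suc n) with suc (isqrt n) ℕ.* suc (isqrt n) ℕ.≤? suc n
  ... | yes h = h
  ... | no  _ = ℕ.m≤n⇒m≤1+n (isqrt-lower n)

  isqrt-upper : ∀ n → n ℕ.< suc (isqrt n) ℕ.* suc (isqrt n)
  isqrt-upper zero = s≤s z≤n
  isqrt-upper (suc n) with suc (isqrt n) ℕ.* suc (isqrt n) ℕ.≤? suc n
  ... | yes _ = ℕ.≤-<-trans (isqrt-upper n) (ℕ.*-mono-< (ℕ.n<1+n (suc (isqrt n))) (ℕ.n<1+n (suc (isqrt n))))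
  ... | no  h = ℕ.≰⇒> h

  ²-cancel : ∀ a b → a ℕ.* a ℕ.≤ b ℕ.* b → a ℕ.≤ b
  ²-cancel a b h with a ℕ.≤? b
  ... | yes p = p
  ... | no  p = contradiction h (ℕ.<⇒≱ (ℕ.*-mono-< (ℕ.≰⇒> p) (ℕ.≰⇒> p)))

  /-suc : ∀ t d → + suc t / suc d ≡ + 1 / suc d + + t / suc d
  /-suc t d = sym (trans (/-+ 1 (suc d) t (suc d)) (/-≡ (1 ℕ.* suc d ℕ.+ t ℕ.* suc d) (suc d ℕ.* suc d) (suc t) (suc d) (lem t (suc d))))
    where
    lem : ∀ t e → (1 ℕ.* e ℕ.+ t ℕ.* e) ℕ.* e ≡ suc t ℕ.* (e ℕ.* e)
    lem = ℕ-Solver.solve-∀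

  -- ⌊√(a N²)⌋ / N with N = k + 1, which is within 1/N of √a
  √-seq : ℕ → ℕ → ℚ
  √-seq a k = + isqrt (a ℕ.* (suc k ℕ.* suc k)) / suc k

  √_ : ℕ → ℝ
  √ a = mkℝ (√-seq a) (regular⇒cauchy (√-seq a) 1 reg)
    where
    lem₁ : ∀ s i → (s ℕ.* i) ℕ.* (s ℕ.* i) ≡ (s ℕ.* s) ℕ.* (i ℕ.* i)
    lem₁ = ℕ-Solver.solve-∀
    lem₂ : ∀ a i j → a ℕ.* (i ℕ.* i) ℕ.* (j ℕ.* j) ≡ a ℕ.* (j ℕ.* j) ℕ.* (i ℕ.* i)
    lem₂ = ℕ-Solver.solve-∀
    key : ∀ i j → isqrt (a ℕ.* (suc i ℕ.* suc i)) ℕ.* suc j ℕ.≤ suc (isqrt (a ℕ.* (suc j ℕ.* suc j))) ℕ.* suc i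
    key i j = ²-cancel _ _ (begin
      (s ℕ.* J) ℕ.* (s ℕ.* J)         ≡⟨ lem₁ s J ⟩
      (s ℕ.* s) ℕ.* (J ℕ.* J)         ≤⟨ ℕ.*-monoˡ-≤ (J ℕ.* J) (isqrt-lower (a ℕ.* (I ℕ.* I))) ⟩
      a ℕ.* (I ℕ.* I) ℕ.* (J ℕ.* J)   ≡⟨ lem₂ a I J ⟩
      a ℕ.* (J ℕ.* J) ℕ.* (I ℕ.* I)   ≤⟨ ℕ.*-monoˡ-≤ (I ℕ.* I) (ℕ.<⇒≤ (isqrt-upper (a ℕ.* (J ℕ.* J)))) ⟩
      (suc t ℕ.* suc t) ℕ.* (I ℕ.* I) ≡⟨ sym (lem₁ (suc t) I) ⟩
      (suc t ℕ.* I) ℕ.* (suc t ℕ.* I) ∎)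
      where
      open ℕ.≤-Reasoning
      I = suc i
      J = suc j
      s = isqrt (a ℕ.* (suc i ℕ.* suc i))
      t = isqrt (a ℕ.* (suc j ℕ.* suc j))
    reg : ∀ i j → √-seq a i - √-seq a j ≤ ι 1 * (+ 1 / suc i + + 1 / suc j)
    reg i j = p-q≤r (√-seq a i) (√-seq a j)
      (≤-trans (/-≤ (r i) (suc i) (suc (r j)) (suc j) (key i j))
      (≤-trans (≤-reflexive (/-suc (r j) j))
        (+-monoˡ-≤ (√-seq a j) (≤-trans (p≤q+p (+ 1 / suc j) (0≤/ 1 (suc i))) (≤-reflexive (sym (*-identityˡ (+ 1 / suc i + + 1 / suc j))))))))
      where
      r = λ k → isqrt (a ℕ.* (suc k ℕ.* suc k))

  Σ<-split : ∀ a b f → Σ< (a ℕ.+ b) f ≡ Σ< a f + Σ< b (λ l → f (a ℕ.+ l))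
  Σ<-split a zero    f = trans (cong (λ z → Σ< z f) (ℕ.+-identityʳ a)) (sym (+-identityʳ _))
  Σ<-split a (suc b) f = trans (cong (λ z → Σ< z f) (ℕ.+-suc a b))
    (trans (cong (_+ f (a ℕ.+ b)) (Σ<-split a b f)) (+-assoc (Σ< a f) _ _))

  Σ<-cong : ∀ n {f g} → (∀ k → f k ≡ g k) → Σ< n f ≡ Σ< n g
  Σ<-cong zero    h = refl
  Σ<-cong (suc n) h = cong₂ _+_ (Σ<-cong n h) (h n)

  ι-suc* : ∀ n c → ι (suc n) * c ≡ ι n * c + c
  ι-suc* n c = trans (cong (λ z → ι z * c) (ℕ.+-comm 1 n))
    (trans (cong (_* c) (ι-+ n 1)) (trans (*-distribʳ-+ c (ι n) 1ℚ) (cong (_+_ (ι n * c)) (*-identityˡ c))))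

  Σ<-≤const : ∀ n {f} c → (∀ k → f k ≤ c) → Σ< n f ≤ ι n * c
  Σ<-≤const zero    c h = ≤-reflexive (sym (*-zeroˡ c))
  Σ<-≤const (suc n) c h = ≤-trans (+-mono-≤ (Σ<-≤const n c h) (h n)) (≤-reflexive (sym (ι-suc* n c)))

  Σ<-≥const : ∀ n {f} c → (∀ k → k ℕ.< n → c ≤ f k) → ι n * c ≤ Σ< n f
  Σ<-≥const zero    c h = ≤-reflexive (*-zeroˡ c)
  Σ<-≥const (suc n) c h = ≤-trans (≤-reflexive (ι-suc* n c))
    (+-mono-≤ (Σ<-≥const n c (λ k p → h k (ℕ.m≤n⇒m≤1+n p))) (h n (ℕ.n<1+n n)))

  module Riemann (f : ℕ → ℚ) (anti : ∀ {i j} → i ℕ.≤ j → f j ≤ f i) (M : ℕ) where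

    coarse : ℕ → ℚ
    coarse N = Σ< N (λ k → ι M * f (k ℕ.* M))

    split : ∀ N → Σ< (suc N ℕ.* M) f ≡ Σ< (N ℕ.* M) f + Σ< M (λ l → f (N ℕ.* M ℕ.+ l))
    split N = trans (cong (λ z → Σ< z f) (ℕ.+-comm M (N ℕ.* M))) (Σ<-split (N ℕ.* M) M f)

    upper : ∀ N → Σ< (N ℕ.* M) f ≤ coarse N
    upper zero    = ≤-refl
    upper (suc N) = ≤-trans (≤-reflexive (split N))
      (+-mono-≤ (upper N) (Σ<-≤const M _ (λ l → anti (ℕ.m≤m+n (N ℕ.* M) l))))

    lower : ∀ N → coarse N + ι M * f (N ℕ.* M) ≤ ι M * f 0 + Σ< (N ℕ.* M) f
    lower zero    = ≤-reflexive (+-comm 0ℚ (ι M * f 0))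
    lower (suc N) = ≤-trans
      (+-mono-≤ (lower N) (Σ<-≥const M (f (suc N ℕ.* M))
        (λ l l<M → anti (ℕ.≤-trans (ℕ.+-monoʳ-≤ (N ℕ.* M) (ℕ.<⇒≤ l<M)) (ℕ.≤-reflexive (ℕ.+-comm (N ℕ.* M) M))))))
      (≤-reflexive (trans (+-assoc (ι M * f 0) (Σ< (N ℕ.* M) f) (Σ< M (λ l → f (N ℕ.* M ℕ.+ l)))) (cong (_+_ (ι M * f 0)) (sym (split N)))))

  -- π = ∫₀¹ 4/(1 + x²) dx: π-seq n is the left Riemann sum with N = n + 1 equal
  -- steps, whose k-th summand is (1/N) · 4/(1 + (k/N)²) = 4N/(N² + k²).
  π-term : ℕ → ℕ → ℚ
  π-term n k = + (4 ℕ.* suc n) / (suc n ℕ.* suc n ℕ.+ k ℕ.* k)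

  π-seq : ℕ → ℚ
  π-seq n = Σ< (suc n) (π-term n)

  π-term-anti : ∀ n {i j} → i ℕ.≤ j → π-term n j ≤ π-term n i
  π-term-anti n {i} {j} h = /-≤ (4 ℕ.* suc n) (N² ℕ.+ j ℕ.* j) (4 ℕ.* suc n) (N² ℕ.+ i ℕ.* i)
    (ℕ.*-monoʳ-≤ (4 ℕ.* suc n) (ℕ.+-monoʳ-≤ N² (ℕ.*-mono-≤ h h)))
    where N² = suc n ℕ.* suc n

  module Refine (n m : ℕ) where
    d = m ℕ.+ n ℕ.* suc m
    open Riemann (π-term d) (π-term-anti d) (suc m)

    scale : ∀ k → π-term n k ≡ ι (suc m) * π-term d (k ℕ.* suc m)
    scale k = sym (trans (cong (_* π-term d (k ℕ.* suc m)) (ι-≡ (suc m)))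
      (trans (/-* (suc m) 1 (4 ℕ.* D) (D ℕ.* D ℕ.+ (k ℕ.* M) ℕ.* (k ℕ.* M)))
        (/-≡ (M ℕ.* (4 ℕ.* D)) (1 ℕ.* (D ℕ.* D ℕ.+ (k ℕ.* M) ℕ.* (k ℕ.* M))) (4 ℕ.* N) (N ℕ.* N ℕ.+ k ℕ.* k)
          (lem M N k))))
      where
      M = suc m
      N = suc n
      D = suc n ℕ.* suc m
      lem : ∀ M N k → (M ℕ.* (4 ℕ.* (N ℕ.* M))) ℕ.* (N ℕ.* N ℕ.+ k ℕ.* k)
            ≡ (4 ℕ.* N) ℕ.* (1 ℕ.* ((N ℕ.* M) ℕ.* (N ℕ.* M) ℕ.+ (k ℕ.* M) ℕ.* (k ℕ.* M)))
      lem = ℕ-Solver.solve-∀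

    coarse≡ : π-seq n ≡ coarse (suc n)
    coarse≡ = Σ<-cong (suc n) scale

    below : π-seq d ≤ π-seq n
    below = ≤-trans (upper (suc n)) (≤-reflexive (sym coarse≡))

    above : π-seq n ≤ ι 4 * (+ 1 / suc n) + π-seq d
    above = ≤-trans (≤-reflexive coarse≡)
      (≤-trans (p≤p+q _ (*-nonneg (ι-nonneg (suc m)) (0≤/ (4 ℕ.* suc d) (suc d ℕ.* suc d ℕ.+ suc d ℕ.* suc d))))
      (≤-trans (lower (suc n))
      (+-monoˡ-≤ (π-seq d) (≤-reflexive (trans (sym (scale 0)) first)))))
      where
      lem : ∀ N → (4 ℕ.* N) ℕ.* (1 ℕ.* N) ≡ (4 ℕ.* 1) ℕ.* (N ℕ.* N ℕ.+ 0)
      lem = ℕ-Solver.solve-∀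
      first : π-term n 0 ≡ ι 4 * (+ 1 / suc n)
      first = trans (/-≡ (4 ℕ.* suc n) (suc n ℕ.* suc n ℕ.+ 0) (4 ℕ.* 1) (1 ℕ.* suc n) (lem (suc n)))
        (sym (trans (cong (_* (+ 1 / suc n)) (ι-≡ 4)) (/-* 4 1 1 (suc n))))

  π : ℝ
  π = mkℝ π-seq (regular⇒cauchy π-seq 4 reg)
    where
    comm : ∀ n m → Refine.d n m ≡ Refine.d m n
    comm n m = ℕ.suc-injective (ℕ.*-comm (suc n) (suc m))
    reg : ∀ n m → π-seq n - π-seq m ≤ ι 4 * (+ 1 / suc n + + 1 / suc m)
    reg n m = p-q≤r (π-seq n) (π-seq m) (≤-trans (Refine.above n m)
      (+-mono-≤ (*-monoˡ (ι 4) (ι-nonneg 4) (p≤p+q (+ 1 / suc n) (0≤/ 1 (suc m))))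
                (≤-trans (≤-reflexive (cong π-seq (comm n m))) (Refine.below m n))))

module Complex where

  open import Data.Rational.Base
  open import Data.Rational.Properties
  open Real

  record ℚ[i] : Set where
    constructor _+i_
    field
      re im : ℚ
  open ℚ[i] public

  infix  5 _+i_
  infixl 6 _+ᵍ_ _-ᵍ_
  infixl 7 _*ᵍ_ _·ᵍ_
  infixr 8 _^ᵍ_

  0ᵍ 1ᵍ : ℚ[i]
  0ᵍ = 0ℚ +i 0ℚ
  1ᵍ = 1ℚ +i 0ℚ

  _+ᵍ_ _-ᵍ_ _*ᵍ_ : ℚ[i] → ℚ[i] → ℚ[i]
  z +ᵍ w = re z + re w +i im z + im w
  z -ᵍ w = re z - re w +i im z - im w
  z *ᵍ w = re z * re w - im z * im w +i re z * im w + im z * re w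

  _·ᵍ_ : ℚ → ℚ[i] → ℚ[i]
  c ·ᵍ z = c * re z +i c * im z

  _^ᵍ_ : ℚ[i] → ℕ → ℚ[i]
  z ^ᵍ zero  = 1ᵍ
  z ^ᵍ suc k = z *ᵍ z ^ᵍ k

  1/_! : ℕ → ℚ
  1/ k ! = (+ 1 / (k !)) {{k ℕ.!≢0}}

  -- Σ_{k<n} zᵏ/k!
  expᵍ : ℕ → ℚ[i] → ℚ[i]
  expᵍ zero    z = 0ᵍ
  expᵍ (suc n) z = expᵍ n z +ᵍ (1/ n !) ·ᵍ z ^ᵍ n

  -- the ℓ¹ norm, which is submultiplicative and stays rational
  ∥_∥ : ℚ[i] → ℚ
  ∥ z ∥ = ∣ re z ∣ + ∣ im z ∣

  ∥∥-nonneg : ∀ z → 0ℚ ≤ ∥ z ∥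
  ∥∥-nonneg z = +-nonneg (0≤∣p∣ (re z)) (0≤∣p∣ (im z))

  ∥∥-+ : ∀ z w → ∥ z +ᵍ w ∥ ≤ ∥ z ∥ + ∥ w ∥
  ∥∥-+ z w = ≤-trans (+-mono-≤ (∣p+q∣≤∣p∣+∣q∣ (re z) (re w)) (∣p+q∣≤∣p∣+∣q∣ (im z) (im w)))
    (≤-reflexive (lem (∣ re z ∣) (∣ re w ∣) (∣ im z ∣) (∣ im w ∣)))
    where
    lem : ∀ a b c d → (a + b) + (c + d) ≡ (a + c) + (b + d)
    lem = solve-∀ ℚ-ring

  ∥∥-* : ∀ z w → ∥ z *ᵍ w ∥ ≤ ∥ z ∥ * ∥ w ∥
  ∥∥-* z w = ≤-trans
    (+-mono-≤ (≤-trans (∣p-q∣≤∣p∣+∣q∣ (a * c) (b * d)) (≤-reflexive (cong₂ _+_ (∣p*q∣≡∣p∣*∣q∣ a c) (∣p*q∣≡∣p∣*∣q∣ b d))))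
              (≤-trans (∣p+q∣≤∣p∣+∣q∣ (a * d) (b * c)) (≤-reflexive (cong₂ _+_ (∣p*q∣≡∣p∣*∣q∣ a d) (∣p*q∣≡∣p∣*∣q∣ b c)))))
    (≤-reflexive (lem (∣ a ∣) (∣ b ∣) (∣ c ∣) (∣ d ∣)))
    where
    a = re z
    b = im z
    c = re w
    d = im w
    lem : ∀ a b c d → (a * c + b * d) + (a * d + b * c) ≡ (a + b) * (c + d)
    lem = solve-∀ ℚ-ring

  ∥∥-· : ∀ c z → 0ℚ ≤ c → ∥ c ·ᵍ z ∥ ≡ c * ∥ z ∥
  ∥∥-· c z 0≤c = trans (cong₂ _+_ (part (re z)) (part (im z))) (sym (*-distribˡ-+ c ∣ re z ∣ ∣ im z ∣))
    where
    part : ∀ p → ∣ c * p ∣ ≡ c * ∣ p ∣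
    part p = trans (∣p*q∣≡∣p∣*∣q∣ c p) (cong (_* ∣ p ∣) (0≤p⇒∣p∣≡p 0≤c))

  ᵍ-ext : ∀ {a b c d} → a ≡ c → b ≡ d → (a +i b) ≡ (c +i d)
  ᵍ-ext = cong₂ _+i_

  -- For ∥ z ∥ ≤ B the series Σ Bᵏ/k! dominates Σ zᵏ/k! and controls both its tails
  -- and its variation in z; this is what makes exp below well defined.

  infixr 8 _^ℚ_
  _^ℚ_ : ℚ → ℕ → ℚ
  p ^ℚ zero  = 1ℚ
  p ^ℚ suc k = p * p ^ℚ k

  1/!-nonneg : ∀ k → 0ℚ ≤ 1/ k !
  1/!-nonneg k = 0≤/ 1 (k !) {{k ℕ.!≢0}}

  1/!-suc : ∀ k → (1/ suc k !) * ι (suc k) ≡ 1/ k !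
  1/!-suc k = lem (1/ suc k !) (1/ k !) (ι (k !)) (ι (suc k))
    (trans (cong ((1/ suc k !) *_) (sym (ι-* (suc k) (k !)))) (1/-ι (suc k !) {{suc k ℕ.!≢0}}))
    (1/-ι (k !) {{k ℕ.!≢0}})
    where
    lem′ : ∀ a b f s → a * s * (b * f) ≡ a * (s * f) * b
    lem′ = solve-∀ ℚ-ring
    lem : ∀ a b f s → a * (s * f) ≡ 1ℚ → b * f ≡ 1ℚ → a * s ≡ b
    lem a b f s p q = trans (sym (*-identityʳ (a * s))) (trans (cong (a * s *_) (sym q))
      (trans (lem′ a b f s) (trans (cong (_* b) p) (*-identityˡ b))))

  module Majorant (B : ℚ) (0≤B : 0ℚ ≤ B) where

    ^-nonneg : ∀ k → 0ℚ ≤ B ^ℚ k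
    ^-nonneg zero    = <⇒≤ 0<1
    ^-nonneg (suc k) = *-nonneg 0≤B (^-nonneg k)

    b : ℕ → ℚ
    b k = (1/ k !) * B ^ℚ k

    b-nonneg : ∀ k → 0ℚ ≤ b k
    b-nonneg k = *-nonneg (1/!-nonneg k) (^-nonneg k)

    s : ℕ → ℚ
    s n = Σ< n b

    b-suc : ∀ k → ι (suc k) * b (suc k) ≡ B * b k
    b-suc k = trans (lem (ι (suc k)) (1/ suc k !) B (B ^ℚ k)) (cong (λ z → B * (z * B ^ℚ k)) (1/!-suc k))
      where
      lem : ∀ i f B p → i * (f * (B * p)) ≡ B * (f * i * p)
      lem = solve-∀ ℚ-ring

    K : ℕ
    K = proj₁ (archimedes (B + B))

    halving : ∀ k → K ℕ.≤ k → b (suc k) + b (suc k) ≤ b k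
    halving k K≤k = *-cancelˡ-≤-pos (ι (suc k)) (begin
      ι (suc k) * (b (suc k) + b (suc k))  ≡⟨ *-distribˡ-+ (ι (suc k)) (b (suc k)) (b (suc k)) ⟩
      ι (suc k) * b (suc k) + ι (suc k) * b (suc k) ≡⟨ cong₂ _+_ (b-suc k) (b-suc k) ⟩
      B * b k + B * b k ≡⟨ sym (*-distribʳ-+ (b k) B B) ⟩
      (B + B) * b k     ≤⟨ *-monoʳ (b k) (b-nonneg k) (≤-trans (proj₂ (archimedes (B + B))) (ι-mono (ℕ.m≤n⇒m≤1+n K≤k))) ⟩
      ι (suc k) * b k ∎)
      where open ≤-Reasoning

    scaled : ℕ → ℚ
    scaled k = ι (suc k) * b k

    scaled-anti : ∀ k → K ℕ.≤ k → scaled (suc k) ≤ scaled k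
    scaled-anti k K≤k = ≤-trans
      (*-monoʳ (b (suc k)) (b-nonneg (suc k)) (ι-mono (ℕ.s≤s (ℕ.≤-trans (ℕ.≤-reflexive (ℕ.+-comm 1 k)) (ℕ.+-monoʳ-≤ k (s≤s z≤n))))))
      (≤-trans (≤-reflexive (trans (cong (_* b (suc k)) (ι-+ (suc k) (suc k))) (lem (ι (suc k)) (b (suc k)))))
        (*-monoˡ (ι (suc k)) (ι-nonneg (suc k)) (halving k K≤k)))
      where
      lem : ∀ i c → (i + i) * c ≡ i * (c + c)
      lem = solve-∀ ℚ-ring

    u : ℕ → ℚ
    u n = s n + (b n + b n)

    u-anti : ∀ k → K ℕ.≤ k → u (suc k) ≤ u k
    u-anti k K≤k = ≤-trans
      (+-monoʳ-≤ (s k + b k) (halving k K≤k))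
      (≤-reflexive (+-assoc (s k) (b k) (b k)))

    from-K : ∀ (f : ℕ → ℚ) → (∀ k → K ℕ.≤ k → f (suc k) ≤ f k) →
             ∀ {i j} → K ℕ.≤ i → i ℕ.≤ j → f j ≤ f i
    from-K f h {i} K≤i i≤j = go (ℕ.≤⇒≤′ i≤j)
      where
      go : ∀ {j} → i ℕ.≤′ j → f j ≤ f i
      go (ℕ.≤′-reflexive refl) = ≤-refl
      go (ℕ.≤′-step p) = ≤-trans (h _ (ℕ.≤-trans K≤i (ℕ.≤′⇒≤ p))) (go p)

    s-mono : ∀ {i j} → i ℕ.≤ j → s i ≤ s j
    s-mono {i} i≤j = go (ℕ.≤⇒≤′ i≤j)
      where
      go : ∀ {j} → i ℕ.≤′ j → s i ≤ s j
      go (ℕ.≤′-reflexive refl) = ≤-refl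
      go (ℕ.≤′-step {j} p) = ≤-trans (go p) (p≤p+q (s j) (b-nonneg j))

    s≤u : ∀ i → s i ≤ u i
    s≤u i = p≤p+q (s i) (+-nonneg (b-nonneg i) (b-nonneg i))

    s-bound : ∀ i → s i ≤ u K
    s-bound i with ℕ.≤-total i K
    ... | inj₁ h = ≤-trans (s-mono h) (s≤u K)
    ... | inj₂ h = ≤-trans (s≤u i) (from-K u u-anti ℕ.≤-refl h)

    0<C : 0ℚ < scaled K + scaled K + 1ℚ
    0<C = <-≤-trans 0<1 (p≤q+p 1ℚ (+-nonneg c c))
      where
      c = *-nonneg (ι-nonneg (suc K)) (b-nonneg K)

    C : ℚ
    C = scaled K + scaled K + 1ℚ

    2b≤ : ∀ i → K ℕ.≤ i → b i + b i ≤ C * (+ 1 / suc i)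
    2b≤ i K≤i = *-cancelˡ-≤-pos (ι (suc i)) (begin
      ι (suc i) * (b i + b i)  ≡⟨ *-distribˡ-+ (ι (suc i)) (b i) (b i) ⟩
      scaled i + scaled i      ≤⟨ +-mono-≤ le le ⟩
      scaled K + scaled K      ≤⟨ p≤p+q _ (<⇒≤ 0<1) ⟩
      C                        ≡⟨ sym (*-identityʳ C) ⟩
      C * 1ℚ                   ≡⟨ cong (C *_) (sym (1/-ι (suc i))) ⟩
      C * ((+ 1 / suc i) * ι (suc i)) ≡⟨ lem C (+ 1 / suc i) (ι (suc i)) ⟩
      ι (suc i) * (C * (+ 1 / suc i)) ∎)
      where
      open ≤-Reasoning
      le = from-K scaled scaled-anti ℕ.≤-refl K≤i
      lem : ∀ c r i → c * (r * i) ≡ i * (c * r)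
      lem = solve-∀ ℚ-ring

    s-close : ∀ i j → K ℕ.≤ i → K ℕ.≤ j → s j - s i ≤ C * (+ 1 / suc i + + 1 / suc j)
    s-close i j K≤i K≤j = p-q≤r (s j) (s i) (≤-trans main (+-monoˡ-≤ (s i)
      (≤-trans (2b≤ i K≤i) (*-monoˡ C (<⇒≤ 0<C) (p≤p+q (+ 1 / suc i) (0≤/ 1 (suc j)))))))
      where
      main : s j ≤ (b i + b i) + s i
      main with ℕ.≤-total i j
      ... | inj₁ h = ≤-trans (s≤u j) (≤-trans (from-K u u-anti K≤i h) (≤-reflexive (+-comm (s i) _)))
      ... | inj₂ h = ≤-trans (s-mono h) (p≤q+p (s i) (+-nonneg (b-nonneg i) (b-nonneg i)))

    s-small : Small (λ i j → ∣ s i - s j ∣)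
    s-small = Small-≤ K (λ i j p q → ∣p-q∣≤ (s i) (s j)
        (≤-trans (s-close j i q p) (≤-reflexive (cong (C *_) (+-comm (+ 1 / suc j) (+ 1 / suc i)))))
        (s-close i j p q))
      (Small-* C 0<C Small-recip)

    ^-bound : ∀ z → ∥ z ∥ ≤ B → ∀ k → ∥ z ^ᵍ k ∥ ≤ B ^ℚ k
    ^-bound z h zero    = ≤-refl
    ^-bound z h (suc k) = ≤-trans (∥∥-* z (z ^ᵍ k))
      (*-mono (∥∥-nonneg (z ^ᵍ k)) 0≤B h (^-bound z h k))

    ^-lipschitz : ∀ z w → ∥ z ∥ ≤ B → ∥ w ∥ ≤ B → ∀ k →
      ∥ z ^ᵍ suc k -ᵍ w ^ᵍ suc k ∥ ≤ ι (suc k) * B ^ℚ k * ∥ z -ᵍ w ∥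
    ^-lipschitz z w hz hw zero = ≤-reflexive (trans (cong ∥_∥ (ᵍ-ext (lem₁ (re z) (im z) (re w) (im w)) (lem₂ (re z) (im z) (re w) (im w))))
      (sym (*-identityˡ ∥ z -ᵍ w ∥)))
      where
      lem₁ : ∀ a b c d → (a * 1ℚ - b * 0ℚ) - (c * 1ℚ - d * 0ℚ) ≡ a - c
      lem₁ = solve-∀ ℚ-ring
      lem₂ : ∀ a b c d → (a * 0ℚ + b * 1ℚ) - (c * 0ℚ + d * 1ℚ) ≡ b - d
      lem₂ = solve-∀ ℚ-ring
    ^-lipschitz z w hz hw (suc k) = begin
      ∥ z *ᵍ p -ᵍ w *ᵍ q ∥                      ≡⟨ cong ∥_∥ (ᵍ-ext (lem₁ (re z) (im z) (re w) (im w) (re p) (im p) (re q) (im q))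
                                                                     (lem₂ (re z) (im z) (re w) (im w) (re p) (im p) (re q) (im q))) ⟩
      ∥ z *ᵍ (p -ᵍ q) +ᵍ q *ᵍ (z -ᵍ w) ∥        ≤⟨ ∥∥-+ (z *ᵍ (p -ᵍ q)) (q *ᵍ (z -ᵍ w)) ⟩
      ∥ z *ᵍ (p -ᵍ q) ∥ + ∥ q *ᵍ (z -ᵍ w) ∥     ≤⟨ +-mono-≤ (∥∥-* z (p -ᵍ q)) (∥∥-* q (z -ᵍ w)) ⟩
      ∥ z ∥ * ∥ p -ᵍ q ∥ + ∥ q ∥ * δ            ≤⟨ +-mono-≤ (*-mono (∥∥-nonneg (p -ᵍ q)) 0≤B hz (^-lipschitz z w hz hw k))
                                                            (*-monoʳ δ (∥∥-nonneg (z -ᵍ w)) (^-bound w hw (suc k))) ⟩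
      B * (ι (suc k) * B ^ℚ k * δ) + B * B ^ℚ k * δ ≡⟨ lem₃ B (ι (suc k)) (B ^ℚ k) δ ⟩
      (ι (suc k) + 1ℚ) * (B * B ^ℚ k) * δ      ≡⟨ cong (λ t → t * (B * B ^ℚ k) * δ) (trans (sym (ι-+ (suc k) 1)) (cong ι (ℕ.+-comm (suc k) 1))) ⟩
      ι (suc (suc k)) * (B * B ^ℚ k) * δ ∎
      where
      open ≤-Reasoning
      p = z ^ᵍ suc k
      q = w ^ᵍ suc k
      δ = ∥ z -ᵍ w ∥
      lem₁ : ∀ a b c d p q r s → (a * p - b * q) - (c * r - d * s)
             ≡ (a * (p - r) - b * (q - s)) + (r * (a - c) - s * (b - d))
      lem₁ = solve-∀ ℚ-ring
      lem₂ : ∀ a b c d p q r s → (a * q + b * p) - (c * s + d * r)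
             ≡ (a * (q - s) + b * (p - r)) + (r * (b - d) + s * (a - c))
      lem₂ = solve-∀ ℚ-ring
      lem₃ : ∀ B i p δ → B * (i * p * δ) + B * p * δ ≡ (i + 1ℚ) * (B * p) * δ
      lem₃ = solve-∀ ℚ-ring

    term-lipschitz : ∀ z w → ∥ z ∥ ≤ B → ∥ w ∥ ≤ B → ∀ k →
      ∥ (1/ suc k !) ·ᵍ z ^ᵍ suc k -ᵍ (1/ suc k !) ·ᵍ w ^ᵍ suc k ∥ ≤ b k * ∥ z -ᵍ w ∥
    term-lipschitz z w hz hw k = begin
      ∥ f ·ᵍ p -ᵍ f ·ᵍ q ∥  ≡⟨ cong ∥_∥ (ᵍ-ext (lem₁ f (re p) (re q)) (lem₁ f (im p) (im q))) ⟩
      ∥ f ·ᵍ (p -ᵍ q) ∥     ≡⟨ ∥∥-· f (p -ᵍ q) (1/!-nonneg (suc k)) ⟩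
      f * ∥ p -ᵍ q ∥        ≤⟨ *-monoˡ f (1/!-nonneg (suc k)) (^-lipschitz z w hz hw k) ⟩
      f * (ι (suc k) * B ^ℚ k * δ) ≡⟨ lem₂ f (ι (suc k)) (B ^ℚ k) δ ⟩
      f * ι (suc k) * B ^ℚ k * δ   ≡⟨ cong (λ t → t * B ^ℚ k * δ) (1/!-suc k) ⟩
      b k * δ ∎
      where
      open ≤-Reasoning
      f = 1/ suc k !
      p = z ^ᵍ suc k
      q = w ^ᵍ suc k
      δ = ∥ z -ᵍ w ∥
      lem₁ : ∀ f p q → f * p - f * q ≡ f * (p - q)
      lem₁ = solve-∀ ℚ-ring
      lem₂ : ∀ f i p d → f * (i * p * d) ≡ f * i * p * d
      lem₂ = solve-∀ ℚ-ring

    exp-lipschitz′ : ∀ z w → ∥ z ∥ ≤ B → ∥ w ∥ ≤ B → ∀ n →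
      ∥ expᵍ (suc n) z -ᵍ expᵍ (suc n) w ∥ ≤ s n * ∥ z -ᵍ w ∥
    exp-lipschitz′ z w hz hw zero    = ≤-reflexive (sym (*-zeroˡ ∥ z -ᵍ w ∥))
    exp-lipschitz′ z w hz hw (suc n) = begin
      ∥ (E +ᵍ P) -ᵍ (F +ᵍ Q) ∥      ≡⟨ cong ∥_∥ (ᵍ-ext (lem (re E) (re P) (re F) (re Q)) (lem (im E) (im P) (im F) (im Q))) ⟩
      ∥ (E -ᵍ F) +ᵍ (P -ᵍ Q) ∥      ≤⟨ ∥∥-+ (E -ᵍ F) (P -ᵍ Q) ⟩
      ∥ E -ᵍ F ∥ + ∥ P -ᵍ Q ∥       ≤⟨ +-mono-≤ (exp-lipschitz′ z w hz hw n) (term-lipschitz z w hz hw n) ⟩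
      s n * δ + b n * δ             ≡⟨ sym (*-distribʳ-+ δ (s n) (b n)) ⟩
      s (suc n) * δ ∎
      where
      open ≤-Reasoning
      E = expᵍ (suc n) z
      F = expᵍ (suc n) w
      P = (1/ suc n !) ·ᵍ z ^ᵍ suc n
      Q = (1/ suc n !) ·ᵍ w ^ᵍ suc n
      δ = ∥ z -ᵍ w ∥
      lem : ∀ a b c d → (a + b) - (c + d) ≡ (a - c) + (b - d)
      lem = solve-∀ ℚ-ring

    M : ℚ
    M = u K + 1ℚ

    0≤uK : 0ℚ ≤ u K
    0≤uK = ≤-trans (Σ<-nonneg K b-nonneg) (s≤u K)

    0<M : 0ℚ < M
    0<M = <-≤-trans 0<1 (p≤q+p 1ℚ 0≤uK)

    exp-lipschitz : ∀ z w → ∥ z ∥ ≤ B → ∥ w ∥ ≤ B → ∀ n → ∥ expᵍ n z -ᵍ expᵍ n w ∥ ≤ M * ∥ z -ᵍ w ∥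
    exp-lipschitz z w hz hw zero    = *-nonneg (<⇒≤ 0<M) (∥∥-nonneg (z -ᵍ w))
    exp-lipschitz z w hz hw (suc n) = ≤-trans (exp-lipschitz′ z w hz hw n)
      (*-monoʳ ∥ z -ᵍ w ∥ (∥∥-nonneg (z -ᵍ w)) (≤-trans (s-bound n) (p≤p+q (u K) (<⇒≤ 0<1))))

    exp-tail : ∀ z → ∥ z ∥ ≤ B → ∀ {i j} → i ℕ.≤ j → ∥ expᵍ j z -ᵍ expᵍ i z ∥ ≤ s j - s i
    exp-tail z h {i} i≤j = go (ℕ.≤⇒≤′ i≤j)
      where
      go : ∀ {j} → i ℕ.≤′ j → ∥ expᵍ j z -ᵍ expᵍ i z ∥ ≤ s j - s i
      go (ℕ.≤′-reflexive refl) = ≤-reflexive (trans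
        (cong₂ (λ x y → ∣ x ∣ + ∣ y ∣) (+-inverseʳ (re (expᵍ i z))) (+-inverseʳ (im (expᵍ i z))))
        (sym (+-inverseʳ (s i))))
      go (ℕ.≤′-step {j} p) = begin
        ∥ (E +ᵍ P) -ᵍ F ∥       ≡⟨ cong ∥_∥ (ᵍ-ext (lem (re E) (re P) (re F)) (lem (im E) (im P) (im F))) ⟩
        ∥ (E -ᵍ F) +ᵍ P ∥       ≤⟨ ∥∥-+ (E -ᵍ F) P ⟩
        ∥ E -ᵍ F ∥ + ∥ P ∥      ≤⟨ +-mono-≤ (go p) (≤-trans (≤-reflexive (∥∥-· (1/ j !) (z ^ᵍ j) (1/!-nonneg j)))
                                                      (*-monoˡ (1/ j !) (1/!-nonneg j) (^-bound z h j))) ⟩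
        (s j - s i) + b j       ≡⟨ lem′ (s j) (s i) (b j) ⟩
        s (suc j) - s i ∎
        where
        open ≤-Reasoning
        E = expᵍ j z
        F = expᵍ i z
        P = (1/ j !) ·ᵍ z ^ᵍ j
        lem : ∀ a b c → (a + b) - c ≡ (a - c) + b
        lem = solve-∀ ℚ-ring
        lem′ : ∀ a b c → (a - b) + c ≡ (a + c) - b
        lem′ = solve-∀ ℚ-ring

    ∥-∥-sym : ∀ z w → ∥ z -ᵍ w ∥ ≡ ∥ w -ᵍ z ∥
    ∥-∥-sym z w = cong₂ _+_ (f (re z) (re w)) (f (im z) (im w))
      where
      lem : ∀ a b → a - b ≡ - (b - a)
      lem = solve-∀ ℚ-ring
      f : ∀ a b → ∣ a - b ∣ ≡ ∣ b - a ∣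
      f a b = trans (cong ∣_∣ (lem a b)) (∣-p∣≡∣p∣ (b - a))

    exp-tail′ : ∀ z → ∥ z ∥ ≤ B → ∀ i j → ∥ expᵍ i z -ᵍ expᵍ j z ∥ ≤ ∣ s i - s j ∣
    exp-tail′ z h i j with ℕ.≤-total j i
    ... | inj₁ j≤i = ≤-trans (exp-tail z h j≤i) (p≤∣p∣ (s i - s j))
    ... | inj₂ i≤j = ≤-trans (≤-reflexive (∥-∥-sym (expᵍ i z) (expᵍ j z)))
      (≤-trans (exp-tail z h i≤j) (≤-trans (p≤∣p∣ (s j - s i)) (≤-reflexive
        (trans (cong ∣_∣ (lem (s j) (s i))) (∣-p∣≡∣p∣ (s i - s j))))))
      where
      lem : ∀ a b → a - b ≡ - (b - a)
      lem = solve-∀ ℚ-ring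

    exp-close : ∀ z w → ∥ z ∥ ≤ B → ∥ w ∥ ≤ B → ∀ i j →
      ∥ expᵍ i z -ᵍ expᵍ j w ∥ ≤ M * ∥ z -ᵍ w ∥ + ∣ s i - s j ∣
    exp-close z w hz hw i j = ≤-trans
      (≤-reflexive (cong ∥_∥ (ᵍ-ext (lem (re E) (re F) (re G)) (lem (im E) (im F) (im G)))))
      (≤-trans (∥∥-+ (E -ᵍ F) (F -ᵍ G)) (+-mono-≤ (exp-lipschitz z w hz hw i) (exp-tail′ w hw i j)))
      where
      E = expᵍ i z
      F = expᵍ i w
      G = expᵍ j w
      lem : ∀ a b c → a - c ≡ (a - b) + (b - c)
      lem = solve-∀ ℚ-ring

  record ℂ : Set where
    constructor mkℂ
    field
      Re Im : ℝ
  open ℂ public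

  approx : ℂ → ℕ → ℚ[i]
  approx z i = seq (Re z) i +i seq (Im z) i

  -- exp z = Σ zᵏ/k!, taken along the diagonal: the i-th approximation is the partial
  -- sum with i terms evaluated at the i-th approximation of z.
  exp : ℂ → ℂ
  exp z = mkℂ
    (mkℝ (λ i → re (expᵍ i (approx z i))) (Small-≤ 0 (λ i j _ _ → ≤-trans (p≤p+q _ (0≤∣p∣ (im (d i j)))) (close i j)) small))
    (mkℝ (λ i → im (expᵍ i (approx z i))) (Small-≤ 0 (λ i j _ _ → ≤-trans (p≤q+p _ (0≤∣p∣ (re (d i j)))) (close i j)) small))
    where
    bRe = bounded (Re z)
    bIm = bounded (Im z)
    open Majorant (proj₁ bRe + proj₁ bIm) (+-nonneg (<⇒≤ (proj₁ (proj₂ bRe))) (<⇒≤ (proj₁ (proj₂ bIm))))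
    bound : ∀ i → ∥ approx z i ∥ ≤ proj₁ bRe + proj₁ bIm
    bound i = +-mono-≤ (proj₂ (proj₂ bRe) i) (proj₂ (proj₂ bIm) i)
    d : ℕ → ℕ → ℚ[i]
    d i j = expᵍ i (approx z i) -ᵍ expᵍ j (approx z j)
    close : ∀ i j → ∥ d i j ∥ ≤ M * ∥ approx z i -ᵍ approx z j ∥ + ∣ s i - s j ∣
    close i j = exp-close (approx z i) (approx z j) (bound i) (bound j) i j
    small : Small (λ i j → M * ∥ approx z i -ᵍ approx z j ∥ + ∣ s i - s j ∣)
    small = Small-+ (Small-* M 0<M (Small-+ (cauchy (Re z)) (cauchy (Im z)))) s-small

module Polynomial where

  -- integer polynomials, constant coefficient first
  Poly : Set
  Poly = List ℤ

  coeff : Poly → ℕ → ℤ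
  coeff []      i       = 0ℤ
  coeff (a ∷ p) zero    = a
  coeff (a ∷ p) (suc i) = coeff p i

  -- trailing zeros are allowed, so equality is coefficientwise
  infix 4 _≈ᵖ_
  record _≈ᵖ_ (p q : Poly) : Set where
    constructor mk≈
    field coeff≡ : ∀ i → coeff p i ≡ coeff q i
  open _≈ᵖ_ public

  infixl 6 _+ᵖ_ _-ᵖ_
  infixl 7 _*ᵖ_ _·ᵖ_
  infix  8 -ᵖ_
  infixr 8 _^ᵖ_

  0ᵖ 1ᵖ X : Poly
  0ᵖ = []
  1ᵖ = 1ℤ ∷ []
  X  = 0ℤ ∷ 1ℤ ∷ []

  _+ᵖ_ : Poly → Poly → Poly
  []      +ᵖ q       = q
  (a ∷ p) +ᵖ []      = a ∷ p
  (a ∷ p) +ᵖ (b ∷ q) = a ℤ.+ b ∷ p +ᵖ q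

  _·ᵖ_ : ℤ → Poly → Poly
  c ·ᵖ p = map (c ℤ.*_) p

  -ᵖ_ : Poly → Poly
  -ᵖ p = map (ℤ.-_) p

  _-ᵖ_ : Poly → Poly → Poly
  p -ᵖ q = p +ᵖ -ᵖ q

  _*ᵖ_ : Poly → Poly → Poly
  []      *ᵖ q = []
  (a ∷ p) *ᵖ q = a ·ᵖ q +ᵖ (0ℤ ∷ p *ᵖ q)

  _^ᵖ_ : Poly → ℕ → Poly
  p ^ᵖ zero  = 1ᵖ
  p ^ᵖ suc n = p *ᵖ p ^ᵖ n

  coeff-+ : ∀ p q i → coeff (p +ᵖ q) i ≡ coeff p i ℤ.+ coeff q i
  coeff-+ []      q       i       = sym (ℤ.+-identityˡ _)
  coeff-+ (a ∷ p) []      i       = sym (ℤ.+-identityʳ _)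
  coeff-+ (a ∷ p) (b ∷ q) zero    = refl
  coeff-+ (a ∷ p) (b ∷ q) (suc i) = coeff-+ p q i

  coeff-· : ∀ c p i → coeff (c ·ᵖ p) i ≡ c ℤ.* coeff p i
  coeff-· c []      i       = sym (ℤ.*-zeroʳ c)
  coeff-· c (a ∷ p) zero    = refl
  coeff-· c (a ∷ p) (suc i) = coeff-· c p i

  coeff-neg : ∀ p i → coeff (-ᵖ p) i ≡ ℤ.- coeff p i
  coeff-neg []      i       = refl
  coeff-neg (a ∷ p) zero    = refl
  coeff-neg (a ∷ p) (suc i) = coeff-neg p i

  ≈-refl : ∀ {p} → p ≈ᵖ p
  ≈-refl = mk≈ λ _ → refl

  ≈-sym : ∀ {p q} → p ≈ᵖ q → q ≈ᵖ p
  ≈-sym h = mk≈ λ i → sym (coeff≡ h i)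

  ≈-trans : ∀ {p q r} → p ≈ᵖ q → q ≈ᵖ r → p ≈ᵖ r
  ≈-trans h k = mk≈ λ i → trans (coeff≡ h i) (coeff≡ k i)

  ∷-cong : ∀ {a p q} → p ≈ᵖ q → a ∷ p ≈ᵖ a ∷ q
  ∷-cong h = mk≈ λ { zero → refl ; (suc i) → coeff≡ h i }

  0∷[] : 0ℤ ∷ [] ≈ᵖ []
  0∷[] = mk≈ λ { zero → refl ; (suc i) → refl }

  +-cong : ∀ {p p′ q q′} → p ≈ᵖ p′ → q ≈ᵖ q′ → p +ᵖ q ≈ᵖ p′ +ᵖ q′
  +-cong {p} {p′} {q} {q′} h k = mk≈ λ i →
    trans (coeff-+ p q i) (trans (cong₂ ℤ._+_ (coeff≡ h i) (coeff≡ k i)) (sym (coeff-+ p′ q′ i)))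

  ·-cong : ∀ {c p q} → p ≈ᵖ q → c ·ᵖ p ≈ᵖ c ·ᵖ q
  ·-cong {c} {p} {q} h = mk≈ λ i → trans (coeff-· c p i) (trans (cong (c ℤ.*_) (coeff≡ h i)) (sym (coeff-· c q i)))

  neg-cong : ∀ {p q} → p ≈ᵖ q → -ᵖ p ≈ᵖ -ᵖ q
  neg-cong {p} {q} h = mk≈ λ i → trans (coeff-neg p i) (trans (cong (ℤ.-_) (coeff≡ h i)) (sym (coeff-neg q i)))

  +-assoc : ∀ p q r → (p +ᵖ q) +ᵖ r ≈ᵖ p +ᵖ (q +ᵖ r)
  +-assoc p q r = mk≈ λ i → begin
    coeff ((p +ᵖ q) +ᵖ r) i                   ≡⟨ coeff-+ (p +ᵖ q) r i ⟩
    coeff (p +ᵖ q) i ℤ.+ coeff r i            ≡⟨ cong (ℤ._+ coeff r i) (coeff-+ p q i) ⟩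
    coeff p i ℤ.+ coeff q i ℤ.+ coeff r i     ≡⟨ ℤ.+-assoc (coeff p i) (coeff q i) (coeff r i) ⟩
    coeff p i ℤ.+ (coeff q i ℤ.+ coeff r i)   ≡⟨ cong (ℤ._+_ (coeff p i)) (sym (coeff-+ q r i)) ⟩
    coeff p i ℤ.+ coeff (q +ᵖ r) i            ≡⟨ sym (coeff-+ p (q +ᵖ r) i) ⟩
    coeff (p +ᵖ (q +ᵖ r)) i ∎
    where open ≡-Reasoning

  +-comm : ∀ p q → p +ᵖ q ≈ᵖ q +ᵖ p
  +-comm p q = mk≈ λ i → trans (coeff-+ p q i) (trans (ℤ.+-comm (coeff p i) (coeff q i)) (sym (coeff-+ q p i)))

  +-identityʳ : ∀ p → p +ᵖ [] ≈ᵖ p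
  +-identityʳ p = +-comm p []

  +-inverseʳ : ∀ p → p +ᵖ -ᵖ p ≈ᵖ []
  +-inverseʳ p = mk≈ λ i → trans (coeff-+ p (-ᵖ p) i) (trans (cong (ℤ._+_ (coeff p i)) (coeff-neg p i)) (ℤ.+-inverseʳ (coeff p i)))

  *-congˡ : ∀ p {q r} → q ≈ᵖ r → p *ᵖ q ≈ᵖ p *ᵖ r
  *-congˡ []      h = ≈-refl
  *-congˡ (a ∷ p) h = +-cong (·-cong {a} h) (∷-cong (*-congˡ p h))

  *-zeroʳ : ∀ p → p *ᵖ [] ≈ᵖ []
  *-zeroʳ []      = ≈-refl
  *-zeroʳ (a ∷ p) = ≈-trans (∷-cong (*-zeroʳ p)) 0∷[]

  *-∷ : ∀ p b q → p *ᵖ (b ∷ q) ≈ᵖ b ·ᵖ p +ᵖ (0ℤ ∷ p *ᵖ q)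
  *-∷ []      b q = ≈-sym 0∷[]
  *-∷ (a ∷ p) b q = mk≈ λ
    { zero    → cong (ℤ._+ 0ℤ) (ℤ.*-comm a b)
    ; (suc i) → begin
        coeff (a ·ᵖ q +ᵖ p *ᵖ (b ∷ q)) i                       ≡⟨ coeff-+ (a ·ᵖ q) _ i ⟩
        coeff (a ·ᵖ q) i ℤ.+ coeff (p *ᵖ (b ∷ q)) i            ≡⟨ cong (ℤ._+_ (coeff (a ·ᵖ q) i)) (trans (coeff≡ (*-∷ p b q) i) (coeff-+ (b ·ᵖ p) _ i)) ⟩
        coeff (a ·ᵖ q) i ℤ.+ (coeff (b ·ᵖ p) i ℤ.+ coeff (0ℤ ∷ p *ᵖ q) i) ≡⟨ lem (coeff (a ·ᵖ q) i) (coeff (b ·ᵖ p) i) (coeff (0ℤ ∷ p *ᵖ q) i) ⟩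
        coeff (b ·ᵖ p) i ℤ.+ (coeff (a ·ᵖ q) i ℤ.+ coeff (0ℤ ∷ p *ᵖ q) i) ≡⟨ cong (ℤ._+_ (coeff (b ·ᵖ p) i)) (sym (coeff-+ (a ·ᵖ q) _ i)) ⟩
        coeff (b ·ᵖ p) i ℤ.+ coeff (a ·ᵖ q +ᵖ (0ℤ ∷ p *ᵖ q)) i ≡⟨ sym (coeff-+ (b ·ᵖ p) _ i) ⟩
        coeff (b ·ᵖ p +ᵖ (a ·ᵖ q +ᵖ (0ℤ ∷ p *ᵖ q))) i ∎ }
    where
    open ≡-Reasoning
    lem : ∀ x y z → x ℤ.+ (y ℤ.+ z) ≡ y ℤ.+ (x ℤ.+ z)
    lem = ℤ-Solver.solve-∀

  *-comm : ∀ p q → p *ᵖ q ≈ᵖ q *ᵖ p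
  *-comm []      q = ≈-sym (*-zeroʳ q)
  *-comm (a ∷ p) q = ≈-trans (+-cong ≈-refl (∷-cong (*-comm p q))) (≈-sym (*-∷ q a p))

  *-cong : ∀ {p p′ q q′} → p ≈ᵖ p′ → q ≈ᵖ q′ → p *ᵖ q ≈ᵖ p′ *ᵖ q′
  *-cong {p} {p′} {q} {q′} h k = ≈-trans (*-congˡ p k) (≈-trans (*-comm p q′) (≈-trans (*-congˡ q′ h) (*-comm q′ p′)))

  ·-+ : ∀ c p q → c ·ᵖ (p +ᵖ q) ≈ᵖ c ·ᵖ p +ᵖ c ·ᵖ q
  ·-+ c p q = mk≈ λ i → trans (coeff-· c (p +ᵖ q) i) (trans (cong (c ℤ.*_) (coeff-+ p q i))
    (trans (ℤ.*-distribˡ-+ c (coeff p i) (coeff q i))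
    (sym (trans (coeff-+ (c ·ᵖ p) (c ·ᵖ q) i) (cong₂ ℤ._+_ (coeff-· c p i) (coeff-· c q i))))))

  ·-assoc : ∀ c d p → c ·ᵖ (d ·ᵖ p) ≈ᵖ (c ℤ.* d) ·ᵖ p
  ·-assoc c d p = mk≈ λ i → trans (coeff-· c (d ·ᵖ p) i) (trans (cong (c ℤ.*_) (coeff-· d p i))
    (trans (sym (ℤ.*-assoc c d (coeff p i))) (sym (coeff-· (c ℤ.* d) p i))))

  ·-0∷ : ∀ c p → c ·ᵖ (0ℤ ∷ p) ≈ᵖ 0ℤ ∷ c ·ᵖ p
  ·-0∷ c p = mk≈ λ { zero → ℤ.*-zeroʳ c ; (suc i) → refl }

  interchange : ∀ p q r s → (p +ᵖ q) +ᵖ (r +ᵖ s) ≈ᵖ (p +ᵖ r) +ᵖ (q +ᵖ s)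
  interchange p q r s = ≈-trans (+-assoc p q (r +ᵖ s)) (≈-trans (+-cong (≈-refl {p})
    (≈-trans (≈-sym (+-assoc q r s)) (≈-trans (+-cong (+-comm q r) (≈-refl {s})) (+-assoc r q s))))
    (≈-sym (+-assoc p r (q +ᵖ s))))

  *-distribˡ-+ : ∀ p q r → p *ᵖ (q +ᵖ r) ≈ᵖ p *ᵖ q +ᵖ p *ᵖ r
  *-distribˡ-+ []      q r = ≈-refl
  *-distribˡ-+ (a ∷ p) q r = ≈-trans
    (+-cong {q = 0ℤ ∷ p *ᵖ (q +ᵖ r)} (·-+ a q r) (∷-cong (*-distribˡ-+ p q r)))
    (interchange (a ·ᵖ q) (a ·ᵖ r) (0ℤ ∷ p *ᵖ q) (0ℤ ∷ p *ᵖ r))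

  *-distribʳ-+ : ∀ r p q → (p +ᵖ q) *ᵖ r ≈ᵖ p *ᵖ r +ᵖ q *ᵖ r
  *-distribʳ-+ r p q = ≈-trans (*-comm (p +ᵖ q) r) (≈-trans (*-distribˡ-+ r p q) (+-cong (*-comm r p) (*-comm r q)))

  ·-* : ∀ c p q → (c ·ᵖ p) *ᵖ q ≈ᵖ c ·ᵖ (p *ᵖ q)
  ·-* c []      q = ≈-refl
  ·-* c (a ∷ p) q = ≈-trans
    (+-cong (≈-sym (·-assoc c a q)) (≈-trans (∷-cong (·-* c p q)) (≈-sym (·-0∷ c (p *ᵖ q)))))
    (≈-sym (·-+ c (a ·ᵖ q) (0ℤ ∷ p *ᵖ q)))

  0·-* : ∀ q → 0ℤ ·ᵖ q ≈ᵖ []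
  0·-* q = mk≈ λ i → coeff-· 0ℤ q i

  0∷-* : ∀ p q → (0ℤ ∷ p) *ᵖ q ≈ᵖ 0ℤ ∷ p *ᵖ q
  0∷-* p q = +-cong (0·-* q) (≈-refl {0ℤ ∷ p *ᵖ q})

  *-assoc : ∀ p q r → (p *ᵖ q) *ᵖ r ≈ᵖ p *ᵖ (q *ᵖ r)
  *-assoc []      q r = ≈-refl
  *-assoc (a ∷ p) q r = ≈-trans (*-distribʳ-+ r (a ·ᵖ q) (0ℤ ∷ p *ᵖ q))
    (+-cong (·-* a q r) (≈-trans (0∷-* (p *ᵖ q) r) (∷-cong (*-assoc p q r))))

  *-identityˡ : ∀ p → 1ᵖ *ᵖ p ≈ᵖ p
  *-identityˡ p = ≈-trans (+-cong {p′ = p} (mk≈ λ i → trans (coeff-· 1ℤ p i) (ℤ.*-identityˡ (coeff p i))) 0∷[]) (+-identityʳ p)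

  Poly-ring : CommutativeRing 0ℓ 0ℓ
  Poly-ring = record
    { Carrier = Poly ; _≈_ = _≈ᵖ_ ; _+_ = _+ᵖ_ ; _*_ = _*ᵖ_ ; -_ = -ᵖ_ ; 0# = 0ᵖ ; 1# = 1ᵖ
    ; isCommutativeRing = record
      { isRing = record
        { +-isAbelianGroup = record
          { isGroup = record
            { isMonoid = record
              { isSemigroup = record
                { isMagma = record
                  { isEquivalence = record { refl = ≈-refl ; sym = ≈-sym ; trans = ≈-trans }
                  ; ∙-cong = +-cong }
                ; assoc = +-assoc }
              ; identity = (λ _ → ≈-refl) , +-identityʳ }
            ; inverse = (λ p → ≈-trans (+-comm (-ᵖ p) p) (+-inverseʳ p)) , +-inverseʳ
            ; ⁻¹-cong = neg-cong }
          ; comm = +-comm }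
        ; *-cong = *-cong
        ; *-assoc = *-assoc
        ; *-identity = *-identityˡ , λ p → ≈-trans (*-comm p 1ᵖ) (*-identityˡ p)
        ; distrib = *-distribˡ-+ , *-distribʳ-+ }
      ; *-comm = *-comm } }

  -- (z;q)ₙ = ∏_{j<n} (1 − z qʲ), with the indeterminate X for q
  ⟨_⟩ₙ_ : Poly → ℕ → Poly
  ⟨ z ⟩ₙ zero  = 1ᵖ
  ⟨ z ⟩ₙ suc n = ⟨ z ⟩ₙ n *ᵖ (1ᵖ -ᵖ z *ᵖ X ^ᵖ n)

  -- the q-Pascal recursion, giving the quotient (q;q)ₖ₊ₗ / ((q;q)ₖ (q;q)ₗ)
  pascal : ℕ → ℕ → Poly
  pascal zero    l       = 1ᵖ
  pascal (suc k) zero    = 1ᵖ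
  pascal (suc k) (suc l) = pascal k (suc l) +ᵖ X ^ᵖ suc k *ᵖ pascal (suc k) l

  Poly-acr : AlmostCommutativeRing 0ℓ 0ℓ
  Poly-acr = fromCommutativeRing Poly-ring isZero
    where
    isZero : ∀ p → Maybe (0ᵖ ≈ᵖ p)
    isZero []          = just ≈-refl
    isZero (+ 0 ∷ p)   = Maybe.map (λ h → ≈-trans (≈-sym 0∷[]) (∷-cong h)) (isZero p)
    isZero (_ ∷ p)     = nothing

  step₁ : ∀ b c x y j k → (b +ᵖ x *ᵖ c) *ᵖ ((j *ᵖ (1ᵖ +ᵖ -ᵖ x)) *ᵖ (k *ᵖ (1ᵖ +ᵖ -ᵖ y)))
        ≈ᵖ (b *ᵖ (j *ᵖ (k *ᵖ (1ᵖ +ᵖ -ᵖ y)))) *ᵖ (1ᵖ +ᵖ -ᵖ x) +ᵖ (c *ᵖ ((j *ᵖ (1ᵖ +ᵖ -ᵖ x)) *ᵖ k)) *ᵖ (x *ᵖ (1ᵖ +ᵖ -ᵖ y))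
  step₁ = solve-∀ Poly-acr

  step₂ : ∀ q x y → q *ᵖ (1ᵖ +ᵖ -ᵖ x) +ᵖ q *ᵖ (x *ᵖ (1ᵖ +ᵖ -ᵖ y)) ≈ᵖ q *ᵖ (1ᵖ +ᵖ -ᵖ (x *ᵖ y))
  step₂ = solve-∀ Poly-acr

  X-^-+ : ∀ k l → X ^ᵖ k *ᵖ X ^ᵖ l ≈ᵖ X ^ᵖ (k ℕ.+ l)
  X-^-+ zero    l = *-identityˡ (X ^ᵖ l)
  X-^-+ (suc k) l = ≈-trans (*-assoc X (X ^ᵖ k) (X ^ᵖ l)) (*-congˡ X (X-^-+ k l))

  pascal-correct : ∀ k l → pascal k l *ᵖ (⟨ X ⟩ₙ k *ᵖ ⟨ X ⟩ₙ l) ≈ᵖ ⟨ X ⟩ₙ (k ℕ.+ l)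
  pascal-correct zero l = ≈-trans (*-identityˡ _) (*-identityˡ (⟨ X ⟩ₙ l))
  pascal-correct (suc k) zero = ≈-trans (*-identityˡ _)
    (≈-trans (≈-trans (*-comm (⟨ X ⟩ₙ suc k) 1ᵖ) (*-identityˡ (⟨ X ⟩ₙ suc k)))
      (subst (λ n → ⟨ X ⟩ₙ suc k ≈ᵖ ⟨ X ⟩ₙ suc n) (sym (ℕ.+-identityʳ k)) ≈-refl))
  pascal-correct (suc k) (suc l) =
    ≈-trans (step₁ b c x y (⟨ X ⟩ₙ k) (⟨ X ⟩ₙ l))
    (≈-trans (+-cong (*-cong (pascal-correct k (suc l)) ≈-refl) (*-cong right ≈-refl))
    (≈-trans (step₂ Q x y)
      (*-congˡ Q (+-cong (≈-refl {1ᵖ}) (neg-cong (X-^-+ (suc k) (suc l)))))))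
    where
    b = pascal k (suc l)
    c = pascal (suc k) l
    x = X ^ᵖ suc k
    y = X ^ᵖ suc l
    Q = ⟨ X ⟩ₙ (k ℕ.+ suc l)
    right : c *ᵖ (⟨ X ⟩ₙ suc k *ᵖ ⟨ X ⟩ₙ l) ≈ᵖ Q
    right = subst (λ n → c *ᵖ (⟨ X ⟩ₙ suc k *ᵖ ⟨ X ⟩ₙ l) ≈ᵖ ⟨ X ⟩ₙ n) (sym (ℕ.+-suc k l)) (pascal-correct (suc k) l)

  gaussian-quotient : ∀ {n k} → k ℕ.≤ n → ∃ λ P → P *ᵖ (⟨ X ⟩ₙ k *ᵖ ⟨ X ⟩ₙ (n ℕ.∸ k)) ≈ᵖ ⟨ X ⟩ₙ n
  gaussian-quotient {n} {k} k≤n = pascal k (n ℕ.∸ k) ,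
    subst (λ m → pascal k (n ℕ.∸ k) *ᵖ (⟨ X ⟩ₙ k *ᵖ ⟨ X ⟩ₙ (n ℕ.∸ k)) ≈ᵖ ⟨ X ⟩ₙ m) (ℕ.m+[n∸m]≡n k≤n) (pascal-correct k (n ℕ.∸ k))

  -- The Gaussian coefficient: the polynomial quotient of (q;q)ₙ by (q;q)ₖ (q;q)ₙ₋ₖ
  -- in ℤ[q], which is unique since ℤ[q] is a domain.
  _choose_ : ℕ → ℕ → Poly
  n choose k with k ℕ.≤? n
  ... | yes k≤n = proj₁ (gaussian-quotient k≤n)
  ... | no  _   = 0ᵖ

open Real public using (ℝ; mkℝ; seq; cauchy; _≃ʳ_; fromℚ; _+ʳ_; -ʳ_; _*ʳ_; π; √_)
open Complex public using (ℂ; mkℂ; Re; Im; exp)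
open Polynomial public using (Poly; _choose_)

infix  4 _≃_
infixl 6 _+ᶜ_
infixl 7 _*ᶜ_
infixr 8 _^ᶜ_

_≃_ : ℂ → ℂ → Set
z ≃ w = Re z ≃ʳ Re w × Im z ≃ʳ Im w

fromℝ : ℝ → ℂ
fromℝ x = mkℂ x (fromℚ ℚ.0ℚ)

fromℚᶜ : ℚ → ℂ
fromℚᶜ p = fromℝ (fromℚ p)

fromℤᶜ : ℤ → ℂ
fromℤᶜ a = fromℚᶜ (a ℚ./ 1)

𝐢 : ℂ
𝐢 = mkℂ (fromℚ ℚ.0ℚ) (fromℚ ℚ.1ℚ)

_+ᶜ_ : ℂ → ℂ → ℂ
z +ᶜ w = mkℂ (Re z +ʳ Re w) (Im z +ʳ Im w)

_*ᶜ_ : ℂ → ℂ → ℂ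
z *ᶜ w = mkℂ (Re z *ʳ Re w +ʳ -ʳ (Im z *ʳ Im w)) (Re z *ʳ Im w +ʳ Im z *ʳ Re w)

_^ᶜ_ : ℂ → ℕ → ℂ
z ^ᶜ zero  = fromℤᶜ 1ℤ
z ^ᶜ suc k = z *ᶜ z ^ᶜ k

eval : Poly → ℂ → ℂ
eval []      z = fromℤᶜ 0ℤ
eval (a ∷ p) z = fromℤᶜ a +ᶜ z *ᶜ eval p z

-- f 1 + ⋯ + f n
Σ₁ : ℕ → (ℕ → ℂ) → ℂ
Σ₁ zero    f = fromℤᶜ 0ℤ
Σ₁ (suc n) f = Σ₁ n f +ᶜ f (suc n)

syntax Σ₁ n (λ k → e) = Σ[1≤ k ≤ n ] e

-- The Legendre symbol (a/3); %ℕ returns the residue in {0, 1, 2}, also for a < 0.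
legendre₃ : ℤ → ℤ
legendre₃ a with a ℤ.%ℕ 3
... | 0 = 0ℤ
... | 1 = 1ℤ
... | _ = -1ℤ

{-# OPTIONS --safe #-}
module Submission where

-- Put p = q⁻¹. At a primitive n-th root of unity Pascal's rule reverses, and
-- q^k [2k−1, k]_q = (−1)^k p^{k(k−1)/2} [n−k, k]_p, where [a, b]_q is the Gaussian coefficient.
-- Hence the left-hand side is 2a − 1 for the sum a = Σ_k (−1)^k p^{k(k−1)/2} [n−k, k]_p of Schur,
-- which the recursion a_{N+3} = − p^{N+1} a_N evaluates; for n = 3t it gives a = − p^t,
-- and −2p^t − 1 is ± i√3 since p^t is a primitive cube root of unity.
--
-- That q is primitive, and the choice of the square root of −3, come from analysis. The ratios
-- 1 + z of consecutive points of the polygons N, N ± i, …, N ± iN are exp z up to O(1/N²), and the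
-- imaginary parts of the z add up to ± 1/4 times the Riemann sum of π, so that
-- exp (iπ/2) = (1 + i)/(1 − i) = i. By 2 ≤ π ≤ 4 and the second-order Taylor estimate, y − 1, y + 1
-- and y + y⁻¹ are apart from 0 for y = e^{2πi/4d} with d ≥ 2, and hence so is y⁴ − 1, their product
-- with y.

open import Defs
open import Algebra.Bundles using (CommutativeRing)
open import Algebra.Definitions using (Inverse)
import Algebra.Properties.Semiring.Exp
import Algebra.Solver.Ring.NaturalCoefficients.Default
open import Algebra.Structures using (IsGroup; IsMonoid)
open import Data.Integer.Base as ℤ using (ℤ; +_; -[1+_]; 0ℤ; 1ℤ; -1ℤ)
import Data.Integer.Properties as ℤ
open import Data.List.Base using ([]; _∷_)
open import Data.Maybe.Base using (just; nothing)
open import Data.Nat.Base as ℕ using (ℕ; zero; suc; z≤n; s≤s; _!)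
open import Data.Nat.Coprimality using (Coprime; gcd≡1⇒coprime; coprime-divisor)
import Data.Nat.Divisibility as Div
import Data.Nat.DivMod as ℕ
import Data.Nat.GCD as GCD
import Data.Nat.Properties as ℕ
import Data.Nat.Tactic.RingSolver as ℕ-Solver
open import Data.Product.Base using (∃; _,_; _×_; proj₁; proj₂)
open import Data.Rational.Base as ℚ using (ℚ; 0ℚ; 1ℚ; ½)
import Data.Rational.Properties as ℚ
import Data.Rational.Unnormalised.Base as ℚᵘ
import Data.Rational.Unnormalised.Properties as ℚᵘ
open import Data.Sum.Base using (_⊎_; inj₁; inj₂)
open import Level using (0ℓ)
open import Relation.Binary.PropositionalEquality as ≡ using (_≡_)
import Relation.Binary.Reasoning.Setoid
open import Relation.Binary.Structures using (IsEquivalence)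
open import Relation.Nullary using (¬_; yes; no; contradiction)
open import Tactic.RingSolver using (solve-∀)
open import Tactic.RingSolver.Core.AlmostCommutativeRing using (AlmostCommutativeRing; fromCommutativeRing)


-- Gaussian coefficients and Schur's identity

-- Equality in this ℂ is equality of limits, which allows neither case splits on x = 0 nor division.
-- So "wⁱ ≠ 1" always takes the form of cancellability: wⁱ x = x forces x = 0. This form is enough
-- for the algebra over an arbitrary commutative ring, it passes to products of factors, and through
-- Bézout from proper divisors of n to all exponents. Analysis only has to bound a few elements away
-- from 0. These are the boundary values at which the induction starts. The fourth root y is there
-- because of the crude bound π ≤ 4: the Taylor estimate needs an angle of at most 1, and 2π/4d ≤
-- 8/4d ≤ 1 for d ≥ 2. The sign of √-3 is settled by showing that the wrong factor 2ω + 1 + i√3 has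
-- positive imaginary part. With ω = i e^{2πi/12} this again concerns a small angle only.

module FiniteSums {c ℓ} (R : CommutativeRing c ℓ) where

  open CommutativeRing R hiding (zero)
  open Algebra.Properties.Semiring.Exp semiring public
  open Algebra.Solver.Ring.NaturalCoefficients.Default commutativeSemiring public
    using (solve; _:=_; _:+_; _:*_; con)
  open Relation.Binary.Reasoning.Setoid setoid

  Σ< : ℕ → (ℕ → Carrier) → Carrier
  Σ< zero    f = 0#
  Σ< (suc n) f = Σ< n f + f n

  Σ-cong : ∀ n {f g} → (∀ k → k ℕ.< n → f k ≈ g k) → Σ< n f ≈ Σ< n g
  Σ-cong zero    h = refl
  Σ-cong (suc n) h = +-cong (Σ-cong n (λ k p → h k (ℕ.m≤n⇒m≤1+n p))) (h n ℕ.≤-refl)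

  Σ-+ : ∀ n f g → Σ< n (λ k → f k + g k) ≈ Σ< n f + Σ< n g
  Σ-+ zero    f g = sym (+-identityʳ 0#)
  Σ-+ (suc n) f g = trans (+-congʳ (Σ-+ n f g))
    (solve 4 (λ a b x y → (a :+ b) :+ (x :+ y) := (a :+ x) :+ (b :+ y)) refl (Σ< n f) (Σ< n g) (f n) (g n))

  Σ-* : ∀ n x f → Σ< n (λ k → x * f k) ≈ x * Σ< n f
  Σ-* zero    x f = sym (zeroʳ x)
  Σ-* (suc n) x f = trans (+-congʳ (Σ-* n x f)) (sym (distribˡ x _ _))

  Σ-head : ∀ n f → Σ< (suc n) f ≈ f 0 + Σ< n (λ k → f (suc k))
  Σ-head zero    f = +-comm 0# (f 0)
  Σ-head (suc n) f = trans (+-congʳ (Σ-head n f)) (+-assoc (f 0) _ (f (suc n)))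

module QBinomial {c ℓ} (R : CommutativeRing c ℓ) where

  open CommutativeRing R hiding (zero)
  open FiniteSums R
  open Relation.Binary.Reasoning.Setoid setoid

  -- -1 as an atom: the semiring solver with natural coefficients does not know negation, so ε + 1 =
  -- 0 and ε² = 1 are applied by hand between its calls.
  ε : Carrier
  ε = - 1#

  εx+x≈0 : ∀ x → ε * x + x ≈ 0#
  εx+x≈0 x = begin
    ε * x + x        ≈⟨ +-congˡ (sym (*-identityˡ x)) ⟩
    ε * x + 1# * x   ≈⟨ sym (distribʳ x ε 1#) ⟩
    (ε + 1#) * x     ≈⟨ *-congʳ (-‿inverseˡ 1#) ⟩
    0# * x           ≈⟨ zeroˡ x ⟩
    0# ∎

  x+εx≈0 : ∀ x → x + ε * x ≈ 0#
  x+εx≈0 x = trans (+-comm x _) (εx+x≈0 x)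

  +≈0⇒≈ε : ∀ {x y} → x + y ≈ 0# → y ≈ ε * x
  +≈0⇒≈ε {x} {y} h = begin
    y                  ≈⟨ sym (+-identityˡ y) ⟩
    0# + y             ≈⟨ +-congʳ (sym (εx+x≈0 x)) ⟩
    ε * x + x + y      ≈⟨ +-assoc _ x y ⟩
    ε * x + (x + y)    ≈⟨ +-congˡ h ⟩
    ε * x + 0#         ≈⟨ +-identityʳ _ ⟩
    ε * x ∎

  ε²≈1 : ε * ε ≈ 1#
  ε²≈1 = sym (+≈0⇒≈ε (-‿inverseˡ 1#))

  ε*ε* : ∀ x → ε * (ε * x) ≈ x
  ε*ε* x = trans (sym (*-assoc ε ε x)) (trans (*-congʳ ε²≈1) (*-identityˡ x))

  -- The Gaussian coefficient with upper index a and lower index i, evaluated at x.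
  B : Carrier → ℕ → ℕ → Carrier
  B x a       zero    = 1#
  B x zero    (suc i) = 0#
  B x (suc a) (suc i) = B x a i + x ^ suc i * B x a (suc i)

  -- The second Pascal rule, [a+1, i+1] = [a, i+1] + x^{a-i} [a, i], multiplied by xⁱ so that the
  -- exponent a - i does not occur.
  pascal′ : ∀ x a i → x ^ i * B x (suc a) (suc i) ≈ x ^ i * B x a (suc i) + x ^ a * B x a i
  pascal′ x zero zero = solve 1 (λ x → con 1 :* (con 1 :+ x :* con 1 :* con 0) := con 1 :* con 0 :+ con 1 :* con 1) refl x
  pascal′ x zero (suc i) =
    solve 2 (λ y z → y :* (con 0 :+ z :* con 0) := y :* con 0 :+ con 1 :* con 0) refl (x ^ suc i) (x ^ suc (suc i))
  pascal′ x (suc a) zero = begin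
    1# * (1# + x * 1# * B x (suc a) 1)                ≈⟨ solve 2 (λ x b → con 1 :* (con 1 :+ x :* con 1 :* b) := con 1 :+ x :* (con 1 :* b)) refl x (B x (suc a) 1) ⟩
    1# + x * (1# * B x (suc a) 1)                     ≈⟨ +-congˡ (*-congˡ (pascal′ x a zero)) ⟩
    1# + x * (1# * B x a 1 + x ^ a * 1#)              ≈⟨ solve 3 (λ x b y → con 1 :+ x :* (con 1 :* b :+ y :* con 1) := con 1 :* (con 1 :+ x :* con 1 :* b) :+ x :* y :* con 1) refl x (B x a 1) (x ^ a) ⟩
    1# * (1# + x * 1# * B x a 1) + x * x ^ a * 1# ∎
  pascal′ x (suc a) (suc i) = begin
    x * y * (b₁ + x * (x * y) * b₂)                             ≈⟨ solve 4 (λ x y b₁ b₂ → x :* y :* (b₁ :+ x :* (x :* y) :* b₂) := x :* (y :* b₁) :+ x :* (x :* y) :* (x :* y :* b₂)) refl x y b₁ b₂ ⟩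
    x * (y * b₁) + x * (x * y) * (x * y * b₂)                   ≈⟨ +-cong (*-congˡ (pascal′ x a i)) (*-congˡ (pascal′ x a (suc i))) ⟩
    x * (y * c₁ + z * c₀) + x * (x * y) * (x * y * c₂ + z * c₁) ≈⟨ solve 6 (λ x y z c₀ c₁ c₂ → x :* (y :* c₁ :+ z :* c₀) :+ x :* (x :* y) :* (x :* y :* c₂ :+ z :* c₁)
                                                                      := x :* y :* (c₁ :+ x :* (x :* y) :* c₂) :+ x :* z :* (c₀ :+ x :* y :* c₁)) refl x y z c₀ c₁ c₂ ⟩
    x * y * (c₁ + x * (x * y) * c₂) + x * z * (c₀ + x * y * c₁) ∎
    where
    y  = x ^ i
    z  = x ^ a
    b₁ = B x (suc a) (suc i)
    b₂ = B x (suc a) (suc (suc i))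
    c₀ = B x a i
    c₁ = B x a (suc i)
    c₂ = B x a (suc (suc i))

  -- (1 − xⁱ⁺¹) B (a+1) (i+1) = (1 − xᵃ⁺¹) B a i, with both sides moved so that no subtraction occurs.
  B-ratio : ∀ x a i → B x (suc a) (suc i) + x ^ suc a * B x a i ≈ B x a i + x ^ suc i * B x (suc a) (suc i)
  B-ratio x a i = begin
    (c₀ + x * y * c₁) + x * z * c₀        ≈⟨ solve 5 (λ x y z c₀ c₁ → (c₀ :+ x :* y :* c₁) :+ x :* z :* c₀ := c₀ :+ x :* (y :* c₁ :+ z :* c₀)) refl x y z c₀ c₁ ⟩
    c₀ + x * (y * c₁ + z * c₀)            ≈⟨ +-congˡ (*-congˡ (sym (pascal′ x a i))) ⟩
    c₀ + x * (y * B x (suc a) (suc i))    ≈⟨ +-congˡ (sym (*-assoc x y _)) ⟩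
    c₀ + x * y * B x (suc a) (suc i) ∎
    where
    y  = x ^ i
    z  = x ^ a
    c₀ = B x a i
    c₁ = B x a (suc i)

  -- τ x i = (−1)ⁱ xⁱ⁽ⁱ⁻¹⁾ᐟ²
  τ : Carrier → ℕ → Carrier
  τ x zero    = 1#
  τ x (suc i) = ε * (x ^ i * τ x i)

  -- Schur's sum; schur′ has the extra weight xʲ, with which the two Pascal rules give
  -- recursions that eliminate to schur (N+3) = − xᴺ⁺¹ schur N.
  schur schur′ : Carrier → ℕ → Carrier
  schur  x N = Σ< (suc N) λ j → τ x j * B x (N ℕ.∸ j) j
  schur′ x N = Σ< (suc N) λ j → τ x j * x ^ j * B x (N ℕ.∸ j) j

  private
    suc-∸ : ∀ {N i} → i ℕ.≤ N → suc N ℕ.∸ i ≡ suc (N ℕ.∸ i)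
    suc-∸ = ℕ.+-∸-assoc 1

  schur-step : ∀ x N → schur x (2 ℕ.+ N) ≈ schur′ x (suc N) + ε * schur′ x N
  schur-step x N = begin
    schur x (2 ℕ.+ N)                        ≈⟨ Σ-head (2 ℕ.+ N) _ ⟩
    1# * 1# + (Σ< (suc N) f + f (suc N))     ≈⟨ +-congˡ (+-cong (Σ-cong (suc N) step) last) ⟩
    1# * 1# + (Σ< (suc N) (λ i → ε * g i + h i) + 0#) ≈⟨ +-congˡ (+-congʳ (trans (Σ-+ (suc N) (λ i → ε * g i) h) (+-congʳ (Σ-* (suc N) ε g)))) ⟩
    1# * 1# + (ε * schur′ x N + Σ< (suc N) h + 0#) ≈⟨ solve 2 (λ b u → con 1 :* con 1 :+ (b :+ u :+ con 0) := con 1 :* con 1 :* con 1 :+ u :+ b) refl (ε * schur′ x N) (Σ< (suc N) h) ⟩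
    1# * 1# * 1# + Σ< (suc N) h + ε * schur′ x N  ≈⟨ +-congʳ (sym (Σ-head (suc N) _)) ⟩
    schur′ x (suc N) + ε * schur′ x N ∎
    where
    f g h : ℕ → Carrier
    f i = τ x (suc i) * B x (suc N ℕ.∸ i) (suc i)
    g i = τ x i * x ^ i * B x (N ℕ.∸ i) i
    h i = τ x (suc i) * x ^ suc i * B x (N ℕ.∸ i) (suc i)
    step : ∀ i → i ℕ.< suc N → f i ≈ ε * g i + h i
    step i (s≤s i≤N) rewrite suc-∸ i≤N =
      solve 6 (λ e y t x b c → e :* (y :* t) :* (b :+ x :* y :* c) := e :* (t :* y :* b) :+ e :* (y :* t) :* (x :* y) :* c)
        refl ε (x ^ i) (τ x i) x (B x (N ℕ.∸ i) i) (B x (N ℕ.∸ i) (suc i))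
    last : f (suc N) ≈ 0#
    last rewrite ℕ.n∸n≡0 N = zeroʳ _

  -- Here the second Pascal rule is the right one: the factor xⁱ that `pascal′` asks for comes from
  -- τ (i+1), and xⁱ · x^{N-i} = x^N no longer depends on i, which leaves the unweighted sum.
  schur′-step : ∀ x N → schur′ x (2 ℕ.+ N) ≈ schur′ x (suc N) + ε * (x ^ suc N * schur x N)
  schur′-step x N = begin
    schur′ x (2 ℕ.+ N)                               ≈⟨ Σ-head (2 ℕ.+ N) _ ⟩
    1# * 1# * 1# + (Σ< (suc N) f + f (suc N))        ≈⟨ +-congˡ (+-cong (Σ-cong (suc N) step) last) ⟩
    1# * 1# * 1# + (Σ< (suc N) (λ i → ε * x ^ suc N * g i + h i) + 0#) ≈⟨ +-congˡ (+-congʳ (trans (Σ-+ (suc N) (λ i → ε * x ^ suc N * g i) h) (+-congʳ (Σ-* (suc N) (ε * x ^ suc N) g)))) ⟩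
    1# * 1# * 1# + (ε * x ^ suc N * schur x N + Σ< (suc N) h + 0#) ≈⟨ solve 4 (λ e y b u → con 1 :* con 1 :* con 1 :+ (e :* y :* b :+ u :+ con 0) := con 1 :* con 1 :* con 1 :+ u :+ e :* (y :* b)) refl ε (x ^ suc N) (schur x N) (Σ< (suc N) h) ⟩
    1# * 1# * 1# + Σ< (suc N) h + ε * (x ^ suc N * schur x N)  ≈⟨ +-congʳ (sym (Σ-head (suc N) _)) ⟩
    schur′ x (suc N) + ε * (x ^ suc N * schur x N) ∎
    where
    f g h : ℕ → Carrier
    f i = τ x (suc i) * x ^ suc i * B x (suc N ℕ.∸ i) (suc i)
    g i = τ x i * B x (N ℕ.∸ i) i
    h i = τ x (suc i) * x ^ suc i * B x (N ℕ.∸ i) (suc i)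
    step : ∀ i → i ℕ.< suc N → f i ≈ ε * x ^ suc N * g i + h i
    step i (s≤s i≤N) rewrite suc-∸ i≤N = begin
      ε * (y * t) * (x * y) * B x (suc a) (suc i)   ≈⟨ solve 5 (λ e y t x b → e :* (y :* t) :* (x :* y) :* b := e :* t :* (x :* y) :* (y :* b)) refl ε y t x (B x (suc a) (suc i)) ⟩
      ε * t * (x * y) * (y * B x (suc a) (suc i))   ≈⟨ *-congˡ (pascal′ x a i) ⟩
      ε * t * (x * y) * (y * c₁ + x ^ a * c₀)       ≈⟨ solve 7 (λ e y t x z c₀ c₁ → e :* t :* (x :* y) :* (y :* c₁ :+ z :* c₀) := e :* (x :* (y :* z)) :* (t :* c₀) :+ e :* (y :* t) :* (x :* y) :* c₁) refl ε y t x (x ^ a) c₀ c₁ ⟩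
      ε * (x * (y * x ^ a)) * (t * c₀) + h i        ≈⟨ +-congʳ (*-congʳ (*-congˡ (*-congˡ (trans (sym (^-homo-* x i a)) (reflexive (≡.cong (x ^_) (ℕ.m+[n∸m]≡n i≤N))))))) ⟩
      ε * (x * x ^ N) * (t * c₀) + h i ∎
      where
      a  = N ℕ.∸ i
      y  = x ^ i
      t  = τ x i
      c₀ = B x a i
      c₁ = B x a (suc i)
    last : f (suc N) ≈ 0#
    last rewrite ℕ.n∸n≡0 N = zeroʳ _

  schur-3 : ∀ x N → schur x (3 ℕ.+ N) ≈ ε * (x ^ suc N * schur x N)
  schur-3 x N = begin
    schur x (3 ℕ.+ N)                                            ≈⟨ schur-step x (suc N) ⟩
    schur′ x (2 ℕ.+ N) + ε * schur′ x (suc N)                    ≈⟨ +-congʳ (trans (schur′-step x N) (+-comm _ _)) ⟩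
    ε * (x ^ suc N * schur x N) + schur′ x (suc N) + ε * schur′ x (suc N) ≈⟨ trans (+-assoc _ _ _) (+-congˡ (x+εx≈0 _)) ⟩
    ε * (x ^ suc N * schur x N) + 0#                             ≈⟨ +-identityʳ _ ⟩
    ε * (x ^ suc N * schur x N) ∎

  schur-0 : ∀ x → schur x 0 ≈ 1#
  schur-0 x = solve 0 (con 0 :+ con 1 :* con 1 := con 1) refl

  schur-1 : ∀ x → schur x 1 ≈ 1#
  schur-1 x = solve 1 (λ t → con 0 :+ con 1 :* con 1 :+ t :* con 0 := con 1) refl (τ x 1)

  schur-2 : ∀ x → schur x 2 ≈ 0#
  schur-2 x = trans (solve 3 (λ e x t → con 0 :+ con 1 :* con 1 :+ e :* (con 1 :* con 1) :* (con 1 :+ x :* con 1 :* con 0) :+ t :* con 0 := con 1 :+ e :* con 1) refl ε x (τ x 2))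
    (x+εx≈0 1#)

  schur-6 : ∀ x N → schur x (6 ℕ.+ N) ≈ x ^ (5 ℕ.+ (N ℕ.+ N)) * schur x N
  schur-6 x N = begin
    schur x (6 ℕ.+ N)                                             ≈⟨ schur-3 x (3 ℕ.+ N) ⟩
    ε * (x ^ (4 ℕ.+ N) * schur x (3 ℕ.+ N))                       ≈⟨ *-congˡ (*-congˡ (schur-3 x N)) ⟩
    ε * (x ^ (4 ℕ.+ N) * (ε * (x ^ suc N * schur x N)))           ≈⟨ solve 4 (λ e y z s → e :* (y :* (e :* (z :* s))) := e :* (e :* (y :* z :* s))) refl ε (x ^ (4 ℕ.+ N)) (x ^ suc N) (schur x N) ⟩
    ε * (ε * (x ^ (4 ℕ.+ N) * x ^ suc N * schur x N))             ≈⟨ ε*ε* _ ⟩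
    x ^ (4 ℕ.+ N) * x ^ suc N * schur x N                         ≈⟨ *-congʳ (sym (^-homo-* x (4 ℕ.+ N) (suc N))) ⟩
    x ^ (4 ℕ.+ N ℕ.+ suc N) * schur x N                           ≡⟨ ≡.cong (λ k → x ^ k * schur x N) (≡.cong (4 ℕ.+_) (ℕ.+-suc N N)) ⟩
    x ^ (5 ℕ.+ (N ℕ.+ N)) * schur x N ∎

  -- That is, schur (6s) = x^{s(6s-1)}, the exponent being the pentagonal number k(3k-1)/2 at k =
  -- 2s; `schur-6s+1` is the case k = -2s. The extra xˢ makes the exponent a multiple of the index
  -- 6s, so it disappears at a 6s-th root of unity.
  schur-6s : ∀ x s → schur x (s ℕ.* 6) * x ^ s ≈ x ^ (s ℕ.* 6 ℕ.* s)
  schur-6s x zero    = trans (*-identityʳ _) (schur-0 x)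
  schur-6s x (suc s) = begin
    schur x (6 ℕ.+ N) * x ^ suc s                       ≈⟨ *-congʳ (schur-6 x N) ⟩
    x ^ (5 ℕ.+ (N ℕ.+ N)) * schur x N * (x * x ^ s)     ≈⟨ solve 4 (λ y a x z → y :* a :* (x :* z) := x :* y :* (a :* z)) refl (x ^ (5 ℕ.+ (N ℕ.+ N))) (schur x N) x (x ^ s) ⟩
    x ^ (6 ℕ.+ (N ℕ.+ N)) * (schur x N * x ^ s)         ≈⟨ *-congˡ (schur-6s x s) ⟩
    x ^ (6 ℕ.+ (N ℕ.+ N)) * x ^ (N ℕ.* s)               ≈⟨ sym (^-homo-* x (6 ℕ.+ (N ℕ.+ N)) (N ℕ.* s)) ⟩
    x ^ (6 ℕ.+ (N ℕ.+ N) ℕ.+ N ℕ.* s)                   ≡⟨ ≡.cong (x ^_) (eq s) ⟩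
    x ^ (suc s ℕ.* 6 ℕ.* suc s) ∎
    where
    N = s ℕ.* 6
    eq : ∀ s → 6 ℕ.+ (s ℕ.* 6 ℕ.+ s ℕ.* 6) ℕ.+ s ℕ.* 6 ℕ.* s ≡ suc s ℕ.* 6 ℕ.* suc s
    eq = ℕ-Solver.solve-∀

  schur-6s+1 : ∀ x s → schur x (s ℕ.* 6 ℕ.+ 1) ≈ x ^ ((s ℕ.* 6 ℕ.+ 1) ℕ.* s)
  schur-6s+1 x zero    = schur-1 x
  schur-6s+1 x (suc s) = begin
    schur x (6 ℕ.+ N)                                   ≈⟨ schur-6 x N ⟩
    x ^ (5 ℕ.+ (N ℕ.+ N)) * schur x N                   ≈⟨ *-congˡ (schur-6s+1 x s) ⟩
    x ^ (5 ℕ.+ (N ℕ.+ N)) * x ^ (N ℕ.* s)               ≈⟨ sym (^-homo-* x (5 ℕ.+ (N ℕ.+ N)) (N ℕ.* s)) ⟩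
    x ^ (5 ℕ.+ (N ℕ.+ N) ℕ.+ N ℕ.* s)                   ≡⟨ ≡.cong (x ^_) (eq s) ⟩
    x ^ ((suc s ℕ.* 6 ℕ.+ 1) ℕ.* suc s) ∎
    where
    N = s ℕ.* 6 ℕ.+ 1
    eq : ∀ s → 5 ℕ.+ (s ℕ.* 6 ℕ.+ 1 ℕ.+ (s ℕ.* 6 ℕ.+ 1)) ℕ.+ (s ℕ.* 6 ℕ.+ 1) ℕ.* s ≡ (suc s ℕ.* 6 ℕ.+ 1) ℕ.* suc s
    eq = ℕ-Solver.solve-∀

  schur-3t+2 : ∀ x t → schur x (2 ℕ.+ t ℕ.* 3) ≈ 0#
  schur-3t+2 x zero    = schur-2 x
  schur-3t+2 x (suc t) = trans (schur-3 x (2 ℕ.+ t ℕ.* 3))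
    (trans (*-congˡ (*-congˡ (schur-3t+2 x t))) (trans (*-congˡ (zeroʳ _)) (zeroʳ ε)))

  1^≈1 : ∀ s → 1# ^ s ≈ 1#
  1^≈1 zero    = refl
  1^≈1 (suc s) = trans (*-identityˡ _) (1^≈1 s)

  -- The value of `pascal k l` at q, hence [k+l, k]_q.
  E : Carrier → ℕ → ℕ → Carrier
  E q zero    l       = 1#
  E q (suc k) zero    = 1#
  E q (suc k) (suc l) = E q k (suc l) + q ^ suc k * E q (suc k) l

  -- `cancel` is primitivity of p in the form used throughout: pⁱ - 1 is not a zero divisor for 0 <
  -- i < n.
  module RootOfUnity (n′ : ℕ) (p q : Carrier) (pq≈1 : p * q ≈ 1#) (pⁿ≈1 : p ^ suc n′ ≈ 1#)
    (cancel : ∀ i → 0 ℕ.< i → i ℕ.< suc n′ → ∀ x → p ^ i * x ≈ x → x ≈ 0#) where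

    n = suc n′

    pⁱqⁱ≈1 : ∀ i → p ^ i * q ^ i ≈ 1#
    pⁱqⁱ≈1 zero    = *-identityˡ 1#
    pⁱqⁱ≈1 (suc i) = begin
      p * p ^ i * (q * q ^ i)    ≈⟨ solve 4 (λ p x q y → p :* x :* (q :* y) := p :* q :* (x :* y)) refl p (p ^ i) q (q ^ i) ⟩
      p * q * (p ^ i * q ^ i)    ≈⟨ *-cong pq≈1 (pⁱqⁱ≈1 i) ⟩
      1# * 1#                    ≈⟨ *-identityˡ 1# ⟩
      1# ∎

    pⁿˢ≈1 : ∀ s → p ^ (n ℕ.* s) ≈ 1#
    pⁿˢ≈1 s = trans (sym (^-assocʳ p n s)) (trans (^-congˡ s pⁿ≈1) (1^≈1 s))

    -- By `B-ratio`, (1 - pⁱ⁺¹) [n, i+1] = (1 - pⁿ) [n-1, i] = 0, and 1 - pⁱ⁺¹ cancels.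
    B-vanishes : ∀ i → suc i ℕ.< n → B p n (suc i) ≈ 0#
    B-vanishes i i<n = cancel (suc i) (s≤s z≤n) i<n _ (begin
      p ^ suc i * b′                 ≈⟨ sym (+-identityˡ _) ⟩
      0# + p ^ suc i * b′            ≈⟨ +-congʳ (sym (εx+x≈0 b)) ⟩
      ε * b + b + p ^ suc i * b′     ≈⟨ +-assoc _ b _ ⟩
      ε * b + (b + p ^ suc i * b′)   ≈⟨ +-congˡ (sym (B-ratio p n′ i)) ⟩
      ε * b + (b′ + p ^ n * b)       ≈⟨ +-congˡ (+-congˡ (trans (*-congʳ pⁿ≈1) (*-identityˡ b))) ⟩
      ε * b + (b′ + b)               ≈⟨ solve 3 (λ x y z → x :+ (y :+ z) := (x :+ z) :+ y) refl (ε * b) b′ b ⟩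
      ε * b + b + b′                 ≈⟨ +-congʳ (εx+x≈0 b) ⟩
      0# + b′                        ≈⟨ +-identityˡ b′ ⟩
      b′ ∎)
      where
      b  = B p n′ i
      b′ = B p n (suc i)

    -- ρ i = (−1)ⁱ pⁱ⁽ⁱ⁺¹⁾ᐟ²; both sides of E≈ρB satisfy the same Pascal rule, because
    -- Pascal's rule at q = p⁻¹ reads backwards as Pascal's rule at p.
    ρ : ℕ → Carrier
    ρ i = τ p i * p ^ i

    ρ-suc : ∀ i b → ρ (suc i) * b ≈ ρ i * (ε * (p ^ suc i * b))
    ρ-suc i b = solve 5 (λ e p x t b → e :* (x :* t) :* (p :* x) :* b := t :* x :* (e :* (p :* x :* b))) refl ε p (p ^ i) (τ p i) b

    -- Pascal's rule for the vanishing [n, i+1] reads pⁱ⁺¹ [n-1, i+1] = - [n-1, i], which determines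
    -- row n - 1 from its first entry. This row is the boundary l = 0 of `E≈ρB`, where E is 1.
    ρB≈1 : ∀ i → i ℕ.< n → ρ i * B p n′ i ≈ 1#
    ρB≈1 zero    _ = trans (*-identityʳ _) (*-identityˡ 1#)
    ρB≈1 (suc i) h = begin
      ρ (suc i) * B p n′ (suc i)                 ≈⟨ ρ-suc i _ ⟩
      ρ i * (ε * (p ^ suc i * B p n′ (suc i)))   ≈⟨ *-congˡ (*-congˡ (+≈0⇒≈ε (B-vanishes i h))) ⟩
      ρ i * (ε * (ε * B p n′ i))                 ≈⟨ *-congˡ (ε*ε* _) ⟩
      ρ i * B p n′ i                             ≈⟨ ρB≈1 i (ℕ.<-trans (ℕ.n<1+n i) h) ⟩
      1# ∎

    E≈ρB : ∀ i l → i ℕ.< n → l ℕ.< n → E q i l ≈ ρ i * B p (n′ ℕ.∸ l) i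
    E≈ρB zero    l       _ _ = sym (trans (*-identityʳ _) (*-identityˡ 1#))
    E≈ρB (suc i) zero    h _ = sym (ρB≈1 (suc i) h)
    E≈ρB (suc i) (suc l) h (s≤s l<n′) = begin
      E q i (suc l) + q ^ suc i * E q (suc i) l
        ≈⟨ +-cong (E≈ρB i (suc l) (ℕ.<-trans (ℕ.n<1+n i) h) (s≤s l<n′)) (*-congˡ (E≈ρB (suc i) l h (ℕ.m≤n⇒m≤1+n l<n′))) ⟩
      ρ i * c₀ + q ^ suc i * (ρ (suc i) * B p (n′ ℕ.∸ l) (suc i))
        ≡⟨ ≡.cong (λ k → ρ i * c₀ + q ^ suc i * (ρ (suc i) * B p k (suc i))) (≡.sym (≡.trans (≡.sym (suc-∸ l<n′)) ≡.refl)) ⟩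
      ρ i * c₀ + q ^ suc i * (ρ (suc i) * (c₀ + p ^ suc i * c₁))
        ≈⟨ +-congˡ (*-congˡ (ρ-suc i _)) ⟩
      ρ i * c₀ + q ^ suc i * (ρ i * (ε * (p ^ suc i * (c₀ + p ^ suc i * c₁))))
        ≈⟨ solve 6 (λ r c₀ q e p c₁ → r :* c₀ :+ q :* (r :* (e :* (p :* (c₀ :+ p :* c₁)))) := r :* (c₀ :+ p :* q :* (e :* c₀) :+ p :* q :* (e :* (p :* c₁)))) refl (ρ i) c₀ (q ^ suc i) ε (p ^ suc i) c₁ ⟩
      ρ i * (c₀ + p ^ suc i * q ^ suc i * (ε * c₀) + p ^ suc i * q ^ suc i * (ε * (p ^ suc i * c₁)))
        ≈⟨ *-congˡ (+-cong (+-congˡ (unit (ε * c₀))) (unit _)) ⟩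
      ρ i * (c₀ + ε * c₀ + ε * (p ^ suc i * c₁))
        ≈⟨ *-congˡ (trans (+-congʳ (x+εx≈0 c₀)) (+-identityˡ _)) ⟩
      ρ i * (ε * (p ^ suc i * c₁))
        ≈⟨ sym (ρ-suc i c₁) ⟩
      ρ (suc i) * c₁ ∎
      where
      c₀ = B p (n′ ℕ.∸ suc l) i
      c₁ = B p (n′ ℕ.∸ suc l) (suc i)
      unit : ∀ x → p ^ suc i * q ^ suc i * x ≈ x
      unit x = trans (*-congʳ (pⁱqⁱ≈1 (suc i))) (*-identityˡ x)

    -- In the diagonal case l = k of `E≈ρB` (with k+1 for i), the power q^{k+1} in the sum cancels
    -- the factor p^{k+1} of ρ and leaves τ.
    sum≈schur : 1# + Σ< n′ (λ k → q ^ suc k * E q (suc k) k) ≈ schur p n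
    sum≈schur = begin
      1# + Σ< n′ (λ k → q ^ suc k * E q (suc k) k)                  ≈⟨ +-cong (sym (*-identityˡ 1#)) (Σ-cong n′ term) ⟩
      1# * 1# + Σ< n′ f                                             ≈⟨ sym (+-identityʳ _) ⟩
      1# * 1# + Σ< n′ f + 0#                                        ≈⟨ +-congˡ (sym last) ⟩
      1# * 1# + Σ< n′ f + f n′                                      ≈⟨ +-assoc _ _ _ ⟩
      1# * 1# + Σ< n f                                              ≈⟨ sym (Σ-head n _) ⟩
      schur p n ∎
      where
      f : ℕ → Carrier
      f k = τ p (suc k) * B p (n′ ℕ.∸ k) (suc k)
      -- Schur's sum runs up to j = n, one further than the given sum; that summand contains [0, n]
      -- = 0.
      last : f n′ ≈ 0#
      last rewrite ℕ.n∸n≡0 n′ = zeroʳ _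
      term : ∀ k → k ℕ.< n′ → q ^ suc k * E q (suc k) k ≈ f k
      term k k<n′ = begin
        q ^ suc k * E q (suc k) k                                   ≈⟨ *-congˡ (E≈ρB (suc k) k (s≤s k<n′) (ℕ.m≤n⇒m≤1+n k<n′)) ⟩
        q ^ suc k * (τ p (suc k) * p ^ suc k * b)                   ≈⟨ solve 4 (λ q t p b → q :* (t :* p :* b) := p :* q :* (t :* b)) refl (q ^ suc k) (τ p (suc k)) (p ^ suc k) b ⟩
        p ^ suc k * q ^ suc k * (τ p (suc k) * b)                   ≈⟨ trans (*-congʳ (pⁱqⁱ≈1 (suc k))) (*-identityˡ _) ⟩
        τ p (suc k) * b ∎
        where
        b = B p (n′ ℕ.∸ k) (suc k)

    -- From (p^h - 1)(p^h + 1) = 0 the first factor is cancelled, as 0 < h < n.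
    half : ∀ h → n ≡ h ℕ.+ h → p ^ h ≈ ε
    half zero    ()
    half h@(suc h′) e = trans (+≈0⇒≈ε (cancel h (s≤s z≤n) h<n (1# + p ^ h) (begin
      p ^ h * (1# + p ^ h)       ≈⟨ solve 1 (λ x → x :* (con 1 :+ x) := x :* x :+ x) refl (p ^ h) ⟩
      p ^ h * p ^ h + p ^ h      ≈⟨ +-congʳ (trans (sym (^-homo-* p h h)) (trans (reflexive (≡.cong (p ^_) (≡.sym e))) pⁿ≈1)) ⟩
      1# + p ^ h ∎))) (*-identityʳ ε)
      where
      h<n : h ℕ.< n
      h<n = ≡.subst (h ℕ.<_) (≡.sym e) (ℕ.m<m+n h (s≤s z≤n))

    cancel-^ : ∀ s {x y} → x * p ^ s ≈ y * p ^ s → x ≈ y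
    cancel-^ s {x} {y} h = begin
      x                      ≈⟨ insert x ⟩
      x * p ^ s * q ^ s      ≈⟨ *-congʳ h ⟩
      y * p ^ s * q ^ s      ≈⟨ sym (insert y) ⟩
      y ∎
      where
      insert : ∀ x → x ≈ x * p ^ s * q ^ s
      insert x = sym (trans (*-assoc x _ _) (trans (*-congˡ (pⁱqⁱ≈1 s)) (*-identityʳ x)))

    parity : ∀ t → ∃ λ s → t ≡ s ℕ.+ s ⊎ t ≡ suc (s ℕ.+ s)
    parity zero    = 0 , inj₁ ≡.refl
    parity (suc t) with parity t
    ... | s , inj₁ e = s , inj₂ (≡.cong suc e)
    ... | s , inj₂ e = suc s , inj₁ (≡.trans (≡.cong suc e) (≡.cong suc (≡.sym (ℕ.+-suc s s))))

    schur-3∣n : ∀ t → n ≡ t ℕ.* 3 → schur p n ≈ ε * p ^ t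
    schur-3∣n t e with parity t
    ... | s , inj₁ ≡.refl = cancel-^ s (begin
      schur p n * p ^ s                     ≡⟨ ≡.cong (λ k → schur p k * p ^ s) e₆ ⟩
      schur p (s ℕ.* 6) * p ^ s             ≈⟨ schur-6s p s ⟩
      p ^ (s ℕ.* 6 ℕ.* s)                   ≡⟨ ≡.cong (λ k → p ^ (k ℕ.* s)) (≡.sym e₆) ⟩
      p ^ (n ℕ.* s)                         ≈⟨ pⁿˢ≈1 s ⟩
      1#                                    ≈⟨ sym ε²≈1 ⟩
      ε * ε                                 ≈⟨ *-congˡ (sym (half (s ℕ.* 3) (≡.trans e (eq₂ s)))) ⟩
      ε * p ^ (s ℕ.* 3)                     ≡⟨ ≡.cong (λ k → ε * p ^ k) (eq₃ s) ⟩
      ε * p ^ (s ℕ.+ s ℕ.+ s)               ≈⟨ *-congˡ (^-homo-* p (s ℕ.+ s) s) ⟩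
      ε * (p ^ (s ℕ.+ s) * p ^ s)           ≈⟨ sym (*-assoc ε _ _) ⟩
      ε * p ^ (s ℕ.+ s) * p ^ s ∎)
      where
      eq₁ : ∀ s → (s ℕ.+ s) ℕ.* 3 ≡ s ℕ.* 6
      eq₁ = ℕ-Solver.solve-∀
      eq₂ : ∀ s → (s ℕ.+ s) ℕ.* 3 ≡ s ℕ.* 3 ℕ.+ s ℕ.* 3
      eq₂ = ℕ-Solver.solve-∀
      eq₃ : ∀ s → s ℕ.* 3 ≡ s ℕ.+ s ℕ.+ s
      eq₃ = ℕ-Solver.solve-∀
      e₆ = ≡.trans e (eq₁ s)
    ... | s , inj₂ ≡.refl = cancel-^ s (begin
      schur p n * p ^ s                                ≡⟨ ≡.cong (λ k → schur p k * p ^ s) e₆ ⟩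
      schur p (3 ℕ.+ s ℕ.* 6) * p ^ s                  ≈⟨ *-congʳ (schur-3 p (s ℕ.* 6)) ⟩
      ε * (p ^ suc (s ℕ.* 6) * schur p (s ℕ.* 6)) * p ^ s ≈⟨ solve 4 (λ e x a y → e :* (x :* a) :* y := e :* (x :* (a :* y))) refl ε (p ^ suc (s ℕ.* 6)) (schur p (s ℕ.* 6)) (p ^ s) ⟩
      ε * (p ^ suc (s ℕ.* 6) * (schur p (s ℕ.* 6) * p ^ s)) ≈⟨ *-congˡ (*-congˡ (schur-6s p s)) ⟩
      ε * (p ^ suc (s ℕ.* 6) * p ^ (s ℕ.* 6 ℕ.* s))    ≈⟨ *-congˡ (sym (^-homo-* p (suc (s ℕ.* 6)) _)) ⟩
      ε * p ^ (suc (s ℕ.* 6) ℕ.+ s ℕ.* 6 ℕ.* s)        ≡⟨ ≡.cong (λ k → ε * p ^ k) (≡.trans (eq₂ s) (≡.cong (λ k → k ℕ.* s ℕ.+ (suc (s ℕ.+ s) ℕ.+ s)) (≡.sym e₆))) ⟩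
      ε * p ^ (n ℕ.* s ℕ.+ (suc (s ℕ.+ s) ℕ.+ s))      ≈⟨ *-congˡ (^-homo-* p (n ℕ.* s) _) ⟩
      ε * (p ^ (n ℕ.* s) * p ^ (suc (s ℕ.+ s) ℕ.+ s))  ≈⟨ *-congˡ (*-cong (pⁿˢ≈1 s) (^-homo-* p (suc (s ℕ.+ s)) s)) ⟩
      ε * (1# * (p ^ suc (s ℕ.+ s) * p ^ s))           ≈⟨ solve 3 (λ e x y → e :* (con 1 :* (x :* y)) := e :* x :* y) refl ε (p ^ suc (s ℕ.+ s)) (p ^ s) ⟩
      ε * p ^ suc (s ℕ.+ s) * p ^ s ∎)
      where
      eq₁ : ∀ s → suc (s ℕ.+ s) ℕ.* 3 ≡ 3 ℕ.+ s ℕ.* 6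
      eq₁ = ℕ-Solver.solve-∀
      eq₂ : ∀ s → suc (s ℕ.* 6) ℕ.+ s ℕ.* 6 ℕ.* s ≡ (3 ℕ.+ s ℕ.* 6) ℕ.* s ℕ.+ (suc (s ℕ.+ s) ℕ.+ s)
      eq₂ = ℕ-Solver.solve-∀
      e₆ = ≡.trans e (eq₁ s)

    ε^odd : ∀ s → ε ^ suc (s ℕ.+ s) ≈ ε
    ε^odd zero    = *-identityʳ ε
    ε^odd (suc s) = trans (reflexive (≡.cong (λ k → ε ^ suc (suc k)) (ℕ.+-suc s s))) (trans (ε*ε* _) (ε^odd s))

    -- For n = 6s + 1 the exponent is the multiple ns of n. For n = 6s + 4 = 2h it is h(2s + 1), so
    -- the power is (-1)^{2s+1}, and the sign of `schur-3` makes the value 1.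
    schur-n≡1 : ∀ t → n ≡ 1 ℕ.+ t ℕ.* 3 → schur p n ≈ 1#
    schur-n≡1 t e with parity t
    ... | s , inj₁ ≡.refl = begin
      schur p n                          ≡⟨ ≡.cong (schur p) e₆ ⟩
      schur p (s ℕ.* 6 ℕ.+ 1)            ≈⟨ schur-6s+1 p s ⟩
      p ^ ((s ℕ.* 6 ℕ.+ 1) ℕ.* s)        ≡⟨ ≡.cong (λ k → p ^ (k ℕ.* s)) (≡.sym e₆) ⟩
      p ^ (n ℕ.* s)                      ≈⟨ pⁿˢ≈1 s ⟩
      1# ∎
      where
      eq₁ : ∀ s → 1 ℕ.+ (s ℕ.+ s) ℕ.* 3 ≡ s ℕ.* 6 ℕ.+ 1
      eq₁ = ℕ-Solver.solve-∀
      e₆ = ≡.trans e (eq₁ s)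
    ... | s , inj₂ ≡.refl = begin
      schur p n                                        ≡⟨ ≡.cong (schur p) (≡.trans e (eq₁ s)) ⟩
      schur p (3 ℕ.+ N)                                ≈⟨ schur-3 p N ⟩
      ε * (p ^ suc N * schur p N)                      ≈⟨ *-congˡ (*-congˡ (schur-6s+1 p s)) ⟩
      ε * (p ^ suc N * p ^ (N ℕ.* s))                  ≈⟨ *-congˡ (sym (^-homo-* p (suc N) _)) ⟩
      ε * p ^ (suc N ℕ.+ N ℕ.* s)                      ≡⟨ ≡.cong (λ k → ε * p ^ k) (eq₂ s) ⟩
      ε * p ^ (h ℕ.* suc (s ℕ.+ s))                    ≈⟨ *-congˡ (sym (^-assocʳ p h (suc (s ℕ.+ s)))) ⟩
      ε * (p ^ h) ^ suc (s ℕ.+ s)                      ≈⟨ *-congˡ (trans (^-congˡ (suc (s ℕ.+ s)) (half h (≡.trans e (eq₃ s)))) (ε^odd s)) ⟩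
      ε * ε                                            ≈⟨ ε²≈1 ⟩
      1# ∎
      where
      N = s ℕ.* 6 ℕ.+ 1
      h = s ℕ.* 3 ℕ.+ 2
      eq₁ : ∀ s → 1 ℕ.+ suc (s ℕ.+ s) ℕ.* 3 ≡ 3 ℕ.+ (s ℕ.* 6 ℕ.+ 1)
      eq₁ = ℕ-Solver.solve-∀
      eq₂ : ∀ s → suc (s ℕ.* 6 ℕ.+ 1) ℕ.+ (s ℕ.* 6 ℕ.+ 1) ℕ.* s ≡ (s ℕ.* 3 ℕ.+ 2) ℕ.* suc (s ℕ.+ s)
      eq₂ = ℕ-Solver.solve-∀
      eq₃ : ∀ s → 1 ℕ.+ suc (s ℕ.+ s) ℕ.* 3 ≡ (s ℕ.* 3 ℕ.+ 2) ℕ.+ (s ℕ.* 3 ℕ.+ 2)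
      eq₃ = ℕ-Solver.solve-∀

    schur-n≡2 : ∀ t → n ≡ 2 ℕ.+ t ℕ.* 3 → schur p n ≈ 0#
    schur-n≡2 t e = trans (reflexive (≡.cong (schur p) e)) (schur-3t+2 p t)

-- Evaluation of integer polynomials in a commutative ring

module Polynomials {c ℓ} (R : CommutativeRing c ℓ) where

  open CommutativeRing R hiding (zero)

  module Evaluation
    (φ : ℤ → Carrier) (φ-+ : ∀ a b → φ (a ℤ.+ b) ≈ φ a + φ b) (φ-* : ∀ a b → φ (a ℤ.* b) ≈ φ a * φ b)
    (φ-0 : φ 0ℤ ≈ 0#) (φ-1 : φ 1ℤ ≈ 1#) (z : Carrier) where

    open FiniteSums R
    open QBinomial R using (E)
    open Relation.Binary.Reasoning.Setoid setoid
    open Polynomial using (_+ᵖ_; _·ᵖ_; _*ᵖ_; _^ᵖ_; X; pascal)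

    ⟦_⟧ : Poly → Carrier
    ⟦ [] ⟧    = φ 0ℤ
    ⟦ a ∷ p ⟧ = φ a + z * ⟦ p ⟧

    ⟦⟧-+ : ∀ p q → ⟦ p +ᵖ q ⟧ ≈ ⟦ p ⟧ + ⟦ q ⟧
    ⟦⟧-+ []      q       = sym (trans (+-congʳ φ-0) (+-identityˡ _))
    ⟦⟧-+ (a ∷ p) []      = sym (trans (+-congˡ φ-0) (+-identityʳ _))
    ⟦⟧-+ (a ∷ p) (b ∷ q) = trans (+-cong (φ-+ a b) (*-congˡ (⟦⟧-+ p q)))
      (solve 5 (λ a b z x y → (a :+ b) :+ z :* (x :+ y) := (a :+ z :* x) :+ (b :+ z :* y)) refl (φ a) (φ b) z ⟦ p ⟧ ⟦ q ⟧)

    ⟦⟧-· : ∀ a p → ⟦ a ·ᵖ p ⟧ ≈ φ a * ⟦ p ⟧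
    ⟦⟧-· a []      = trans φ-0 (sym (trans (*-congˡ φ-0) (zeroʳ (φ a))))
    ⟦⟧-· a (b ∷ p) = trans (+-cong (φ-* a b) (*-congˡ (⟦⟧-· a p)))
      (solve 4 (λ a b z x → a :* b :+ z :* (a :* x) := a :* (b :+ z :* x)) refl (φ a) (φ b) z ⟦ p ⟧)

    ⟦⟧-* : ∀ p q → ⟦ p *ᵖ q ⟧ ≈ ⟦ p ⟧ * ⟦ q ⟧
    ⟦⟧-* []      q = trans φ-0 (sym (trans (*-congʳ φ-0) (zeroˡ ⟦ q ⟧)))
    ⟦⟧-* (a ∷ p) q = begin
      ⟦ a ·ᵖ q +ᵖ (0ℤ ∷ p *ᵖ q) ⟧                ≈⟨ ⟦⟧-+ (a ·ᵖ q) (0ℤ ∷ p *ᵖ q) ⟩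
      ⟦ a ·ᵖ q ⟧ + (φ 0ℤ + z * ⟦ p *ᵖ q ⟧)       ≈⟨ +-cong (⟦⟧-· a q) (+-cong φ-0 (*-congˡ (⟦⟧-* p q))) ⟩
      φ a * ⟦ q ⟧ + (0# + z * (⟦ p ⟧ * ⟦ q ⟧))   ≈⟨ solve 4 (λ a z x y → a :* y :+ (con 0 :+ z :* (x :* y)) := (a :+ z :* x) :* y) refl (φ a) z ⟦ p ⟧ ⟦ q ⟧ ⟩
      (φ a + z * ⟦ p ⟧) * ⟦ q ⟧ ∎

    ⟦1⟧ : ⟦ 1ℤ ∷ [] ⟧ ≈ 1#
    ⟦1⟧ = trans (+-cong φ-1 (trans (*-congˡ φ-0) (zeroʳ z))) (+-identityʳ 1#)

    ⟦X⟧ : ⟦ X ⟧ ≈ z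
    ⟦X⟧ = trans (+-cong φ-0 (trans (*-congˡ ⟦1⟧) (*-identityʳ z))) (+-identityˡ z)

    ⟦X^⟧ : ∀ k → ⟦ X ^ᵖ k ⟧ ≈ z ^ k
    ⟦X^⟧ zero    = ⟦1⟧
    ⟦X^⟧ (suc k) = trans (⟦⟧-* X (X ^ᵖ k)) (*-cong ⟦X⟧ (⟦X^⟧ k))

    ⟦pascal⟧ : ∀ k l → ⟦ pascal k l ⟧ ≈ E z k l
    ⟦pascal⟧ zero    l       = ⟦1⟧
    ⟦pascal⟧ (suc k) zero    = ⟦1⟧
    ⟦pascal⟧ (suc k) (suc l) = trans (⟦⟧-+ (pascal k (suc l)) (X ^ᵖ suc k *ᵖ pascal (suc k) l))
      (+-cong (⟦pascal⟧ k (suc l)) (trans (⟦⟧-* (X ^ᵖ suc k) (pascal (suc k) l)) (*-cong (⟦X^⟧ (suc k)) (⟦pascal⟧ (suc k) l))))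

-- Cancellability of wᵃ - 1, cube roots of unity and √-3

module Roots {c ℓ} (R : CommutativeRing c ℓ) where

  open CommutativeRing R hiding (zero)
  open FiniteSums R
  open QBinomial R using (ε; εx+x≈0; x+εx≈0; +≈0⇒≈ε; ε²≈1; ε*ε*)
  open Relation.Binary.Reasoning.Setoid setoid
  open Div using (_∣_; divides)
  open GCD using (gcd; gcd-GCD; gcd[m,n]∣m; gcd[m,n]∣n; module Bézout)

  fix-multiple : ∀ w {x} a k → w ^ a * x ≈ x → w ^ (k ℕ.* a) * x ≈ x
  fix-multiple w {x} a zero    h = *-identityˡ x
  fix-multiple w {x} a (suc k) h = begin
    w ^ (a ℕ.+ k ℕ.* a) * x          ≈⟨ *-congʳ (^-homo-* w a (k ℕ.* a)) ⟩
    w ^ a * w ^ (k ℕ.* a) * x        ≈⟨ *-assoc _ _ x ⟩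
    w ^ a * (w ^ (k ℕ.* a) * x)      ≈⟨ *-congˡ (fix-multiple w a k h) ⟩
    w ^ a * x                        ≈⟨ h ⟩
    x ∎

  fix-difference : ∀ w {x} g {a b} → w ^ a * x ≈ x → w ^ b * x ≈ x → g ℕ.+ b ≡ a → w ^ g * x ≈ x
  fix-difference w {x} g {a} {b} ha hb e = begin
    w ^ g * x                ≈⟨ *-congˡ (sym hb) ⟩
    w ^ g * (w ^ b * x)      ≈⟨ sym (*-assoc _ _ x) ⟩
    w ^ g * w ^ b * x        ≈⟨ *-congʳ (sym (^-homo-* w g b)) ⟩
    w ^ (g ℕ.+ b) * x        ≡⟨ ≡.cong (λ k → w ^ k * x) e ⟩
    w ^ a * x                ≈⟨ ha ⟩
    x ∎

  -- The exponents that fix x are closed under multiples and differences, so Bézout's identity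
  -- applies without an inverse of w.
  fix-gcd : ∀ w {x} a b → w ^ a * x ≈ x → w ^ b * x ≈ x → w ^ gcd a b * x ≈ x
  fix-gcd w {x} a b ha hb = go (Bézout.identity (gcd-GCD a b))
    where
    go : Bézout.Identity (gcd a b) a b → w ^ gcd a b * x ≈ x
    go (Bézout.+- k l e) = fix-difference w (gcd a b) (fix-multiple w a k ha) (fix-multiple w b l hb) e
    go (Bézout.-+ k l e) = fix-difference w (gcd a b) (fix-multiple w b l hb) (fix-multiple w a k ha) e

  -- Passing from a to g = gcd a n leaves only divisors of n to check. There n = d g, and d = 1
  -- would give n ∣ a, so d ≥ 2; for w = e^{2πi/n} the power w^g is e^{2πi/d}.
  primitive-cancel : ∀ w n .{{_ : ℕ.NonZero n}} → w ^ n ≈ 1# →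
    (∀ g d → 2 ℕ.≤ d → n ≡ d ℕ.* g → ∀ x → w ^ g * x ≈ x → x ≈ 0#) →
    ∀ a → ¬ (n ∣ a) → ∀ x → w ^ a * x ≈ x → x ≈ 0#
  primitive-cancel w n wⁿ≈1 base a n∤a x h = go (gcd[m,n]∣n a n)
    where
    fixed : w ^ gcd a n * x ≈ x
    fixed = fix-gcd w a n h (trans (*-congʳ wⁿ≈1) (*-identityˡ x))
    go : gcd a n ∣ n → x ≈ 0#
    go (divides zero e)            = contradiction e (ℕ.≢-nonZero⁻¹ n)
    go (divides (suc zero) e)      = contradiction (≡.subst (_∣ a) (≡.sym (≡.trans e (ℕ.+-identityʳ _))) (gcd[m,n]∣m a n)) n∤a
    go (divides d@(suc (suc _)) e) = base (gcd a n) d (s≤s (s≤s z≤n)) e x fixed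

  fix-inverse : ∀ {p q x} i → p * q ≈ 1# → p ^ i * x ≈ x → q ^ i * x ≈ x
  fix-inverse {p} {q} {x} i pq≈1 h = begin
    q ^ i * x                ≈⟨ *-congˡ (sym h) ⟩
    q ^ i * (p ^ i * x)      ≈⟨ sym (*-assoc _ _ x) ⟩
    q ^ i * p ^ i * x        ≈⟨ *-congʳ (inverse^ i) ⟩
    1# * x                   ≈⟨ *-identityˡ x ⟩
    x ∎
    where
    inverse^ : ∀ i → q ^ i * p ^ i ≈ 1#
    inverse^ zero    = *-identityˡ 1#
    inverse^ (suc i) = trans (solve 4 (λ p x q y → q :* y :* (p :* x) := p :* q :* (y :* x)) refl p (p ^ i) q (q ^ i))
      (trans (*-cong pq≈1 (inverse^ i)) (*-identityˡ 1#))

  -- y⁴ − 1 = (y − 1) (y + 1) y (y + y⁻¹)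
  y⁴-factors : ∀ {y ȳ} → y * ȳ ≈ 1# → ∀ x → y ^ 4 * x ≈ x → (y + ε) * ((y + 1#) * (y * ((y + ȳ) * x))) ≈ 0#
  y⁴-factors {y} {ȳ} yȳ≈1 x h = begin
    (y + ε) * ((y + 1#) * (y * ((y + ȳ) * x)))
      ≈⟨ solve 4 (λ y ȳ e x → (y :+ e) :* ((y :+ con 1) :* (y :* ((y :+ ȳ) :* x))) := (y :* y :+ (e :* y :+ y) :+ e) :* ((y :* y :+ y :* ȳ) :* x)) refl y ȳ ε x ⟩
    (y * y + (ε * y + y) + ε) * ((y * y + y * ȳ) * x)
      ≈⟨ *-cong (+-congʳ (+-congˡ (εx+x≈0 y))) (*-congʳ (+-congˡ yȳ≈1)) ⟩
    (y * y + 0# + ε) * ((y * y + 1#) * x)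
      ≈⟨ solve 3 (λ y e x → (y :* y :+ con 0 :+ e) :* ((y :* y :+ con 1) :* x) := y :* (y :* (y :* (y :* con 1))) :* x :+ (e :* (y :* y :* x) :+ y :* y :* x) :+ e :* x) refl y ε x ⟩
    y ^ 4 * x + (ε * (y * y * x) + y * y * x) + ε * x
      ≈⟨ +-congʳ (trans (+-cong h (εx+x≈0 (y * y * x))) (+-identityʳ x)) ⟩
    x + ε * x
      ≈⟨ x+εx≈0 x ⟩
    0# ∎

  *≈0-unit : ∀ {y ȳ} → y * ȳ ≈ 1# → ∀ x → y * x ≈ 0# → x ≈ 0#
  *≈0-unit {y} {ȳ} yȳ≈1 x h = begin
    x                ≈⟨ sym (*-identityˡ x) ⟩
    1# * x           ≈⟨ *-congʳ (sym yȳ≈1) ⟩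
    y * ȳ * x        ≈⟨ solve 3 (λ y ȳ x → y :* ȳ :* x := ȳ :* (y :* x)) refl y ȳ x ⟩
    ȳ * (y * x)      ≈⟨ *-congˡ h ⟩
    ȳ * 0#           ≈⟨ zeroʳ ȳ ⟩
    0# ∎

  2# 3# : Carrier
  2# = 1# + 1#
  3# = 1# + 2#

  cube-root : ∀ {ω} → ω ^ 3 ≈ 1# → (∀ x → ω * x ≈ x → x ≈ 0#) → 1# + ω + ω * ω ≈ 0#
  cube-root {ω} ω³≈1 cancel = cancel _ (begin
    ω * (1# + ω + ω * ω)      ≈⟨ solve 1 (λ w → w :* (con 1 :+ w :+ w :* w) := w :+ w :* w :+ w :* (w :* (w :* con 1))) refl ω ⟩
    ω + ω * ω + ω ^ 3         ≈⟨ +-congˡ ω³≈1 ⟩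
    ω + ω * ω + 1#            ≈⟨ solve 1 (λ w → w :+ w :* w :+ con 1 := con 1 :+ w :+ w :* w) refl ω ⟩
    1# + ω + ω * ω ∎)

  -- (2ω + 1)² = −3 = (ι ρ)²
  sqrt-3 : ∀ {ω ι ρ} → 1# + ω + ω * ω ≈ 0# → ι * ι ≈ ε → ρ * ρ ≈ 3# →
    (∀ x → (2# * ω + 1# + ι * ρ) * x ≈ 0# → x ≈ 0#) → 2# * ω + 1# ≈ ι * ρ
  sqrt-3 {ω} {ι} {ρ} h ι² ρ² cancel = trans (+≈0⇒≈ε (trans (+-comm _ _) (cancel _ (begin
    (s + y) * (s + ε * y)                          ≈⟨ solve 3 (λ s y e → (s :+ y) :* (s :+ e :* y) := s :* s :+ (e :* (s :* y) :+ s :* y) :+ e :* (y :* y)) refl s y ε ⟩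
    s * s + (ε * (s * y) + s * y) + ε * (y * y)    ≈⟨ +-cong (trans (+-congˡ (εx+x≈0 _)) (+-identityʳ _)) (*-congˡ y²) ⟩
    s * s + ε * (ε * 3#)                           ≈⟨ +-cong refl (ε*ε* 3#) ⟩
    s * s + 3#                                     ≈⟨ solve 1 (λ w → ((con 1 :+ con 1) :* w :+ con 1) :* ((con 1 :+ con 1) :* w :+ con 1) :+ (con 1 :+ (con 1 :+ con 1)) := con 4 :* (con 1 :+ w :+ w :* w)) refl ω ⟩
    4# * (1# + ω + ω * ω)                          ≈⟨ trans (*-congˡ h) (zeroʳ 4#) ⟩
    0# ∎)))) (trans (sym (*-assoc ε ε y)) (trans (*-congʳ ε²≈1) (*-identityˡ y)))
    where
    s = 2# * ω + 1#
    y = ι * ρ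
    4# = 1# + 1# + 1# + 1#
    y² : y * y ≈ ε * 3#
    y² = trans (solve 2 (λ i r → i :* r :* (i :* r) := i :* i :* (r :* r)) refl ι ρ) (*-cong ι² ρ²)

-- Value of the sum at e^{2πim/n}

open Polynomial using (pascal)
open Real using (/-≡; /-suc)

choose≡pascal : ∀ {n k} → k ℕ.≤ n → n choose k ≡ pascal k (n ℕ.∸ k)
choose≡pascal {n} {k} k≤n with k ℕ.≤? n
... | yes _  = ≡.refl
... | no k≰n = contradiction k≤n k≰n

[2k-1]choose-k : ∀ k → (2 ℕ.* suc k ℕ.∸ 1) choose suc k ≡ pascal (suc k) k
[2k-1]choose-k k = ≡.trans (≡.cong (_choose suc k) eq)
  (≡.trans (choose≡pascal (ℕ.m≤m+n (suc k) k)) (≡.cong (pascal (suc k)) (ℕ.m+n∸m≡n (suc k) k)))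
  where
  eq : 2 ℕ.* suc k ℕ.∸ 1 ≡ suc k ℕ.+ k
  eq = ≡.trans (ℕ.+-suc k (k ℕ.+ 0)) (≡.cong (λ l → suc (k ℕ.+ l)) (ℕ.+-identityʳ k))

legendre₃-1 : ∀ a → a ℤ.%ℕ 3 ≡ 1 → legendre₃ a ≡ 1ℤ
legendre₃-1 a h rewrite h = ≡.refl

legendre₃-2 : ∀ a → a ℤ.%ℕ 3 ≡ 2 → legendre₃ a ≡ -1ℤ
legendre₃-2 a h rewrite h = ≡.refl

negative-%ℕ : ∀ k r → suc k ℕ.% 3 ≡ suc r → -[1+ k ] ℤ.%ℕ 3 ≡ 3 ℕ.∸ suc r
negative-%ℕ k r h rewrite h = ≡.refl

mod3 : ∀ n → n ℕ.% 3 ≡ 0 ⊎ n ℕ.% 3 ≡ 1 ⊎ n ℕ.% 3 ≡ 2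
mod3 n = go (n ℕ.% 3) (ℕ.m%n<n n 3)
  where
  go : ∀ r → r ℕ.< 3 → r ≡ 0 ⊎ r ≡ 1 ⊎ r ≡ 2
  go 0 _ = inj₁ ≡.refl
  go 1 _ = inj₂ (inj₁ ≡.refl)
  go 2 _ = inj₂ (inj₂ ≡.refl)
  go (suc (suc (suc r))) (s≤s (s≤s (s≤s ())))

module MainSum {c ℓ} (R : CommutativeRing c ℓ) where

  open CommutativeRing R hiding (zero)

  -- The intended ring is ℂ, with `cis r` = e^{2πir}, ι = i, ρ = √3 and φ the embedding of ℤ. All
  -- that is needed from analysis is collected in these hypotheses.
  module Evaluation
    (φ : ℤ → Carrier) (φ-+ : ∀ a b → φ (a ℤ.+ b) ≈ φ a + φ b) (φ-* : ∀ a b → φ (a ℤ.* b) ≈ φ a * φ b)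
    (φ-0 : φ 0ℤ ≈ 0#) (φ-1 : φ 1ℤ ≈ 1#)
    (cis : ℚ → Carrier) (cis-+ : ∀ r s → cis (r ℚ.+ s) ≈ cis r * cis s) (cis-0 : cis 0ℚ ≈ 1#)
    (ι ρ : Carrier) (cis-¼ : cis (+ 1 ℚ./ 4) ≈ ι) (ι² : ι * ι ≈ - 1#) (ρ² : ρ * ρ ≈ 1# + (1# + 1#))
    (cancel-y-1 : ∀ d x → (cis (+ 1 ℚ./ (4 ℕ.* (2 ℕ.+ d))) + - 1#) * x ≈ 0# → x ≈ 0#)
    (cancel-y+1 : ∀ d x → (cis (+ 1 ℚ./ (4 ℕ.* (2 ℕ.+ d))) + 1#) * x ≈ 0# → x ≈ 0#)
    (cancel-y+ȳ : ∀ d x → (cis (+ 1 ℚ./ (4 ℕ.* (2 ℕ.+ d))) + cis (ℚ.- (+ 1 ℚ./ (4 ℕ.* (2 ℕ.+ d))))) * x ≈ 0# → x ≈ 0#)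
    (cancel-iy : ∀ x → ((1# + 1#) * (ι * cis (+ 1 ℚ./ 12)) + 1# + ι * ρ) * x ≈ 0# → x ≈ 0#)
    where

    open FiniteSums R
    open QBinomial R
    open Roots R
    open Relation.Binary.Reasoning.Setoid setoid
    module Eval = Polynomials.Evaluation R φ φ-+ φ-* φ-0 φ-1
    open Div using (_∣_; divides)

    cis-cong : ∀ {r s} → r ≡ s → cis r ≈ cis s
    cis-cong e = reflexive (≡.cong cis e)

    cis-inverse : ∀ r → cis r * cis (ℚ.- r) ≈ 1#
    cis-inverse r = trans (sym (cis-+ r (ℚ.- r))) (trans (cis-cong (ℚ.+-inverseʳ r)) cis-0)

    cis-½ : cis ½ ≈ ε
    cis-½ = trans (cis-+ (+ 1 ℚ./ 4) (+ 1 ℚ./ 4)) (trans (*-cong cis-¼ cis-¼) ι²)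

    cis-1 : cis 1ℚ ≈ 1#
    cis-1 = trans (cis-+ ½ ½) (trans (*-cong cis-½ cis-½) ε²≈1)

    cis-^ : ∀ k d .{{_ : ℕ.NonZero d}} → cis (+ k ℚ./ d) ≈ cis (+ 1 ℚ./ d) ^ k
    cis-^ zero    d@(suc _)  = trans (cis-cong (/-≡ 0 d 0 1 ≡.refl)) cis-0
    cis-^ (suc k) d@(suc d′) = trans (cis-cong (/-suc k d′)) (trans (cis-+ (+ 1 ℚ./ d) (+ k ℚ./ d)) (*-congˡ (cis-^ k d)))

    cis-root : ∀ d .{{_ : ℕ.NonZero d}} → cis (+ 1 ℚ./ d) ^ d ≈ 1#
    cis-root d = trans (sym (cis-^ d d)) (trans (cis-cong (/-≡ d d 1 1 (ℕ.*-comm d 1))) cis-1)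

    cis-cancel : ∀ d x → cis (+ 1 ℚ./ (2 ℕ.+ d)) * x ≈ x → x ≈ 0#
    cis-cancel d x h = cancel-y+ȳ d x (*≈0-unit (cis-inverse t) ((y + ȳ) * x) (cancel-y+1 d (y * ((y + ȳ) * x))
      (cancel-y-1 d ((y + 1#) * (y * ((y + ȳ) * x))) (y⁴-factors (cis-inverse t) x (trans (*-congʳ y⁴) h)))))
      where
      t = + 1 ℚ./ (4 ℕ.* (2 ℕ.+ d))
      y = cis t
      ȳ = cis (ℚ.- t)
      y⁴ : y ^ 4 ≈ cis (+ 1 ℚ./ (2 ℕ.+ d))
      y⁴ = trans (sym (cis-^ 4 (4 ℕ.* (2 ℕ.+ d)))) (cis-cong (/-≡ 4 (4 ℕ.* (2 ℕ.+ d)) 1 (2 ℕ.+ d) (≡.sym (ℕ.*-identityˡ (4 ℕ.* (2 ℕ.+ d))))))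

    ω : Carrier
    ω = cis (+ 1 ℚ./ 3)

    1+ω+ω²≈0 : 1# + ω + ω * ω ≈ 0#
    1+ω+ω²≈0 = cube-root (cis-root 3) (cis-cancel 1)

    -- Since 1/3 = 1/4 + 1/12, ω is i times a point of small angle. This puts the other factor 2ω +
    -- 1 + ι ρ into the form that `cancel-iy` handles.
    2ω+1≈ιρ : 2# * ω + 1# ≈ ι * ρ
    2ω+1≈ιρ = sqrt-3 1+ω+ω²≈0 ι² ρ² λ x h → cancel-iy x (trans (*-congʳ (+-congʳ (+-congʳ (*-congˡ (sym ω≈))))) h)
      where
      ω≈ : ω ≈ ι * cis (+ 1 ℚ./ 12)
      ω≈ = trans (cis-+ (+ 1 ℚ./ 4) (+ 1 ℚ./ 12)) (*-congʳ cis-¼)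

    ω-mod : ∀ k {r} → k ℕ.% 3 ≡ r → ω ^ k ≈ ω ^ r
    ω-mod k {r} ≡.refl = begin
      ω ^ k                                    ≡⟨ ≡.cong (ω ^_) (ℕ.m≡m%n+[m/n]*n k 3) ⟩
      ω ^ (r ℕ.+ k ℕ./ 3 ℕ.* 3)                ≈⟨ ^-homo-* ω r (k ℕ./ 3 ℕ.* 3) ⟩
      ω ^ r * ω ^ (k ℕ./ 3 ℕ.* 3)              ≈⟨ *-congˡ (trans (sym (*-identityʳ _)) (fix-multiple ω 3 (k ℕ./ 3) (trans (*-identityʳ _) (cis-root 3)))) ⟩
      ω ^ r * 1#                               ≈⟨ *-identityʳ _ ⟩
      ω ^ r ∎

    φ-neg : φ -1ℤ ≈ ε
    φ-neg = trans (+≈0⇒≈ε (trans (+-congʳ (sym φ-1)) (trans (sym (φ-+ 1ℤ -1ℤ)) φ-0))) (*-identityʳ ε)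

    sum : Carrier → ℕ → Carrier
    sum q n′ = φ 1ℤ + φ (+ 2) * Σ< n′ (λ k → q ^ suc k * Eval.⟦_⟧ q ((2 ℕ.* suc k ℕ.∸ 1) choose suc k))

    module _ (n′ : ℕ) (p q : Carrier) (pq≈1 : p * q ≈ 1#) (pⁿ≈1 : p ^ suc n′ ≈ 1#)
      (cancel : ∀ i → 0 ℕ.< i → i ℕ.< suc n′ → ∀ x → p ^ i * x ≈ x → x ≈ 0#) where

      open RootOfUnity n′ p q pq≈1 pⁿ≈1 cancel using (n; sum≈schur; schur-3∣n; schur-n≡1; schur-n≡2)

      sum≈2schur : ∀ {s} → schur p n ≈ s → sum q n′ ≈ 2# * s + ε
      sum≈2schur {s} h = begin
        sum q n′                              ≈⟨ +-cong φ-1 (*-cong (trans (φ-+ 1ℤ 1ℤ) (+-cong φ-1 φ-1)) (Σ-cong n′ λ k _ →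
                                                   *-congˡ (trans (reflexive (≡.cong (Eval.⟦_⟧ q) ([2k-1]choose-k k))) (Eval.⟦pascal⟧ q (suc k) k)))) ⟩
        1# + 2# * T                           ≈⟨ sym (trans (+-congˡ (εx+x≈0 1#)) (+-identityʳ _)) ⟩
        1# + 2# * T + (ε * 1# + 1#)           ≈⟨ solve 2 (λ e t → con 1 :+ con 2 :* t :+ (e :* con 1 :+ con 1) := con 2 :* (con 1 :+ t) :+ e) refl ε T ⟩
        2# * (1# + T) + ε                     ≈⟨ +-congʳ (*-congˡ (trans sum≈schur h)) ⟩
        2# * s + ε ∎
        where
        T = Σ< n′ (λ k → q ^ suc k * E q (suc k) k)

      value-n≡1 : n ℕ.% 3 ≡ 1 → sum q n′ ≈ 1#
      value-n≡1 h = trans (sum≈2schur (schur-n≡1 (n ℕ./ 3) (≡.trans (ℕ.m≡m%n+[m/n]*n n 3) (≡.cong (ℕ._+ n ℕ./ 3 ℕ.* 3) h))))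
        (trans (solve 1 (λ e → con 2 :* con 1 :+ e := con 1 :+ (con 1 :+ e :* con 1)) refl ε) (trans (+-congˡ (x+εx≈0 1#)) (+-identityʳ 1#)))

      value-n≡2 : n ℕ.% 3 ≡ 2 → sum q n′ ≈ ε
      value-n≡2 h = trans (sum≈2schur (schur-n≡2 (n ℕ./ 3) (≡.trans (ℕ.m≡m%n+[m/n]*n n 3) (≡.cong (ℕ._+ n ℕ./ 3 ℕ.* 3) h))))
        (trans (+-congʳ (zeroʳ 2#)) (+-identityˡ ε))

      value-3∣n : ∀ t → n ≡ t ℕ.* 3 → sum q n′ ≈ ε * (2# * p ^ t + 1#)
      value-3∣n t e = trans (sum≈2schur (schur-3∣n t e))
        (solve 2 (λ e x → con 2 :* (e :* x) :+ e := e :* (con 2 :* x :+ con 1)) refl ε (p ^ t))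

      value-ω : ∀ t → n ≡ t ℕ.* 3 → p ^ t ≈ ω ^ 1 → sum q n′ ≈ φ -1ℤ * ι * ρ
      value-ω t e h = begin
        sum q n′                     ≈⟨ value-3∣n t e ⟩
        ε * (2# * p ^ t + 1#)        ≈⟨ *-congˡ (+-congʳ (*-congˡ (trans h (*-identityʳ ω)))) ⟩
        ε * (2# * ω + 1#)            ≈⟨ *-cong (sym φ-neg) 2ω+1≈ιρ ⟩
        φ -1ℤ * (ι * ρ)              ≈⟨ sym (*-assoc _ ι ρ) ⟩
        φ -1ℤ * ι * ρ ∎

      value-ω² : ∀ t → n ≡ t ℕ.* 3 → p ^ t ≈ ω ^ 2 → sum q n′ ≈ φ 1ℤ * ι * ρ
      value-ω² t e h = begin
        sum q n′                     ≈⟨ value-3∣n t e ⟩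
        ε * (2# * p ^ t + 1#)        ≈⟨ *-congˡ (+-congʳ (*-congˡ h)) ⟩
        -- 2ω + 1 and 2ω² + 1 add up to 2(1 + ω + ω²) = 0.
        ε * (2# * ω ^ 2 + 1#)        ≈⟨ *-congˡ (+≈0⇒≈ε (trans (solve 1 (λ w → con 2 :* w :+ con 1 :+ (con 2 :* (w :* (w :* con 1)) :+ con 1)
                                           := con 2 :* (con 1 :+ w :+ w :* w)) refl ω) (trans (*-congˡ 1+ω+ω²≈0) (zeroʳ 2#)))) ⟩
        ε * (ε * (2# * ω + 1#))      ≈⟨ ε*ε* _ ⟩
        2# * ω + 1#                  ≈⟨ trans 2ω+1≈ιρ (sym (*-identityˡ _)) ⟩
        1# * (ι * ρ)                 ≈⟨ trans (*-congʳ (sym φ-1)) (sym (*-assoc _ ι ρ)) ⟩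
        φ 1ℤ * ι * ρ ∎

    -- K = |m|; one of p and q is the K-th power of W = e^{2πi/n}, the other is its inverse.
    module Primitive (n′ K : ℕ) (coprime : Coprime (suc n′) K) where

      n = suc n′
      W = cis (+ 1 ℚ./ n)

      W-fix : ∀ a → ¬ (n ∣ a) → ∀ x → W ^ a * x ≈ x → x ≈ 0#
      W-fix = primitive-cancel W n (cis-root n) base
        where
        base : ∀ g d → 2 ℕ.≤ d → n ≡ d ℕ.* g → ∀ x → W ^ g * x ≈ x → x ≈ 0#
        base g (suc (suc d)) (s≤s (s≤s z≤n)) e x h = cis-cancel d x (trans (*-congʳ (trans (cis-cong (≡.sym (/-≡ g n 1 (2 ℕ.+ d)
          (≡.trans (ℕ.*-comm g (2 ℕ.+ d)) (≡.trans (≡.sym e) (≡.sym (ℕ.*-identityˡ n))))))) (cis-^ g n))) h)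

      u = cis (+ K ℚ./ n)

      u^ : ∀ i → u ^ i ≈ W ^ (K ℕ.* i)
      u^ i = trans (^-congˡ i (cis-^ K n)) (^-assocʳ W K i)

      uⁿ≈1 : u ^ n ≈ 1#
      uⁿ≈1 = trans (u^ n) (trans (sym (*-identityʳ _)) (fix-multiple W n K (trans (*-identityʳ _) (cis-root n))))

      u-cancel : ∀ i → 0 ℕ.< i → i ℕ.< n → ∀ x → u ^ i * x ≈ x → x ≈ 0#
      u-cancel i@(suc _) _ i<n x h = W-fix (K ℕ.* i) (λ n∣Ki → ℕ.<⇒≱ i<n (Div.∣⇒≤ (coprime-divisor coprime n∣Ki))) x
        (trans (*-congʳ (sym (u^ i))) h)

      u^t : ∀ t → n ≡ t ℕ.* 3 → u ^ t ≈ ω ^ K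
      u^t t e = begin
        u ^ t                 ≈⟨ u^ t ⟩
        W ^ (K ℕ.* t)         ≡⟨ ≡.cong (W ^_) (ℕ.*-comm K t) ⟩
        W ^ (t ℕ.* K)         ≈⟨ sym (^-assocʳ W t K) ⟩
        (W ^ t) ^ K           ≈⟨ ^-congˡ K (trans (sym (cis-^ t n)) (cis-cong (/-≡ t n 1 3 (≡.trans (≡.sym e) (≡.sym (ℕ.*-identityˡ n)))))) ⟩
        ω ^ K ∎

      v = cis (ℚ.- (+ K ℚ./ n))

      uv≈1 : u * v ≈ 1#
      uv≈1 = cis-inverse (+ K ℚ./ n)

      vu≈1 : v * u ≈ 1#
      vu≈1 = trans (*-comm v u) uv≈1

      vⁿ≈1 : v ^ n ≈ 1#
      vⁿ≈1 = trans (sym (*-identityʳ _)) (fix-inverse n uv≈1 (trans (*-identityʳ _) uⁿ≈1))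

      v-cancel : ∀ i → 0 ℕ.< i → i ℕ.< n → ∀ x → v ^ i * x ≈ x → x ≈ 0#
      v-cancel i 0<i i<n x h = u-cancel i 0<i i<n x (fix-inverse i vu≈1 h)

      v^t : ∀ t → n ≡ t ℕ.* 3 → ∀ r s → r ℕ.+ s ≡ 3 → K ℕ.% 3 ≡ r → v ^ t ≈ ω ^ s
      v^t t e r s r+s≡3 h = begin
        v ^ t                          ≈⟨ sym (*-identityʳ _) ⟩
        v ^ t * 1#                     ≈⟨ *-congˡ (sym (trans (reflexive (≡.cong (ω ^_) r+s≡3)) (cis-root 3))) ⟩
        v ^ t * ω ^ (r ℕ.+ s)          ≈⟨ *-congˡ (trans (^-homo-* ω r s) (*-congʳ (sym (trans (u^t t e) (ω-mod K h))))) ⟩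
        v ^ t * (u ^ t * ω ^ s)        ≈⟨ sym (*-assoc _ _ _) ⟩
        v ^ t * u ^ t * ω ^ s          ≈⟨ *-congʳ (trans (*-comm _ _) (RootOfUnity.pⁱqⁱ≈1 n′ u v uv≈1 uⁿ≈1 u-cancel t)) ⟩
        1# * ω ^ s                     ≈⟨ *-identityˡ _ ⟩
        ω ^ s ∎

      3∤K : ∀ t → n ≡ t ℕ.* 3 → ¬ (K ℕ.% 3 ≡ 0)
      3∤K t e h = contradiction (coprime (divides t e , Div.m%n≡0⇒n∣m K 3 h)) λ ()

    Conclusion : ℕ → ℤ → Carrier → Set ℓ
    Conclusion n′ m q = (3 ∣ suc n′ → sum q n′ ≈ φ (legendre₃ m) * ι * ρ) × (¬ (3 ∣ suc n′) → sum q n′ ≈ φ (legendre₃ (+ suc n′)))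

    not-divisible : ∀ n′ p q (pq≈1 : p * q ≈ 1#) (pⁿ≈1 : p ^ suc n′ ≈ 1#)
      (cancel : ∀ i → 0 ℕ.< i → i ℕ.< suc n′ → ∀ x → p ^ i * x ≈ x → x ≈ 0#) →
      ¬ (3 ∣ suc n′) → sum q n′ ≈ φ (legendre₃ (+ suc n′))
    not-divisible n′ p q pq≈1 pⁿ≈1 cancel 3∤n = go (mod3 n)
      where
      n = suc n′
      go : n ℕ.% 3 ≡ 0 ⊎ n ℕ.% 3 ≡ 1 ⊎ n ℕ.% 3 ≡ 2 → sum q n′ ≈ φ (legendre₃ (+ n))
      go (inj₁ h)        = contradiction (Div.m%n≡0⇒n∣m n 3 h) 3∤n
      go (inj₂ (inj₁ h)) = trans (value-n≡1 n′ p q pq≈1 pⁿ≈1 cancel h) (trans (sym φ-1) (reflexive (≡.cong φ (≡.sym (legendre₃-1 (+ n) h)))))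
      go (inj₂ (inj₂ h)) = trans (value-n≡2 n′ p q pq≈1 pⁿ≈1 cancel h) (trans (sym φ-neg) (reflexive (≡.cong φ (≡.sym (legendre₃-2 (+ n) h)))))

    evaluation : ∀ n′ m → Coprime (suc n′) ℤ.∣ m ∣ → Conclusion n′ m (cis (m ℚ./ suc n′))
    evaluation n′ (+ K) coprime = divisible , not-divisible n′ v u vu≈1 vⁿ≈1 v-cancel
      where
      open Primitive n′ K coprime
      divisible : 3 ∣ suc n′ → sum u n′ ≈ φ (legendre₃ (+ K)) * ι * ρ
      divisible (divides t e) = go (mod3 K)
        where
        go : K ℕ.% 3 ≡ 0 ⊎ K ℕ.% 3 ≡ 1 ⊎ K ℕ.% 3 ≡ 2 → sum u n′ ≈ φ (legendre₃ (+ K)) * ι * ρ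
        go (inj₁ h)        = contradiction h (3∤K t e)
        go (inj₂ (inj₁ h)) = trans (value-ω² n′ v u vu≈1 vⁿ≈1 v-cancel t e (v^t t e 1 2 ≡.refl h))
          (reflexive (≡.cong (λ a → φ a * ι * ρ) (≡.sym (legendre₃-1 (+ K) h))))
        go (inj₂ (inj₂ h)) = trans (value-ω n′ v u vu≈1 vⁿ≈1 v-cancel t e (v^t t e 2 1 ≡.refl h))
          (reflexive (≡.cong (λ a → φ a * ι * ρ) (≡.sym (legendre₃-2 (+ K) h))))
    evaluation n′ -[1+ k ] coprime = divisible , not-divisible n′ u v uv≈1 uⁿ≈1 u-cancel
      where
      open Primitive n′ (suc k) coprime
      divisible : 3 ∣ suc n′ → sum v n′ ≈ φ (legendre₃ -[1+ k ]) * ι * ρ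
      divisible (divides t e) = go (mod3 (suc k))
        where
        go : suc k ℕ.% 3 ≡ 0 ⊎ suc k ℕ.% 3 ≡ 1 ⊎ suc k ℕ.% 3 ≡ 2 → sum v n′ ≈ φ (legendre₃ -[1+ k ]) * ι * ρ
        go (inj₁ h)        = contradiction h (3∤K t e)
        go (inj₂ (inj₁ h)) = trans (value-ω n′ u v uv≈1 uⁿ≈1 u-cancel t e (trans (u^t t e) (ω-mod (suc k) h)))
          (reflexive (≡.cong (λ a → φ a * ι * ρ) (≡.sym (legendre₃-2 -[1+ k ] (negative-%ℕ k 0 h)))))
        go (inj₂ (inj₂ h)) = trans (value-ω² n′ u v uv≈1 uⁿ≈1 u-cancel t e (trans (u^t t e) (ω-mod (suc k) h)))
          (reflexive (≡.cong (λ a → φ a * ι * ρ) (≡.sym (legendre₃-1 -[1+ k ] (negative-%ℕ k 1 h)))))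

-- The exponential series

module ExponentialSeries {c ℓ} (R : CommutativeRing c ℓ) where

  open CommutativeRing R hiding (zero)

  -- f k is 1/k! and ν k is k as a ring element. The module serves twice: over ℚ[i] for the
  -- exponential and over ℚ for the series that dominates it.
  module CauchyProduct
    (f ν : ℕ → Carrier) (f0 : f 0 ≈ 1#) (ν0 : ν 0 ≈ 0#) (ν-+ : ∀ m n → ν (m ℕ.+ n) ≈ ν m + ν n)
    (f-suc : ∀ k → ν (suc k) * f (suc k) ≈ f k)
    (ν-cancel : ∀ k {x y} → ν (suc k) * x ≈ ν (suc k) * y → x ≈ y) where

    open FiniteSums R
    open Relation.Binary.Reasoning.Setoid setoid

    e : Carrier → ℕ → Carrier
    e x k = f k * x ^ k

    νe-suc : ∀ x k → ν (suc k) * e x (suc k) ≈ x * e x k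
    νe-suc x k = begin
      ν (suc k) * (f (suc k) * (x * x ^ k))   ≈⟨ solve 4 (λ a b x y → a :* (b :* (x :* y)) := x :* (a :* b :* y)) refl (ν (suc k)) (f (suc k)) x (x ^ k) ⟩
      x * (ν (suc k) * f (suc k) * x ^ k)     ≈⟨ *-congˡ (*-congʳ (f-suc k)) ⟩
      x * (f k * x ^ k) ∎

    conv : Carrier → Carrier → ℕ → Carrier
    conv x y n = Σ< (suc n) λ i → e x i * e y (n ℕ.∸ i)

    -- A discrete Leibniz rule: n + 1 = i + (n + 1 - i) distributes the factor over the two series,
    -- and each part lowers one index. Both sides of `e-+` then obey one recursion, so no binomial
    -- coefficients are needed.
    conv-suc : ∀ x y n → ν (suc n) * conv x y (suc n) ≈ (x + y) * conv x y n
    conv-suc x y n = begin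
      ν (suc n) * conv x y (suc n)                           ≈⟨ sym (Σ-* (2 ℕ.+ n) (ν (suc n)) _) ⟩
      Σ< (2 ℕ.+ n) (λ i → ν (suc n) * (e x i * e y (suc n ℕ.∸ i)))  ≈⟨ Σ-cong (2 ℕ.+ n) split ⟩
      Σ< (2 ℕ.+ n) (λ i → u i + v i)                         ≈⟨ Σ-+ (2 ℕ.+ n) u v ⟩
      Σ< (2 ℕ.+ n) u + Σ< (2 ℕ.+ n) v                        ≈⟨ +-cong left right ⟩
      x * conv x y n + y * conv x y n                        ≈⟨ sym (distribʳ (conv x y n) x y) ⟩
      (x + y) * conv x y n ∎
      where
      u v : ℕ → Carrier
      u i = ν i * e x i * e y (suc n ℕ.∸ i)
      v i = e x i * (ν (suc n ℕ.∸ i) * e y (suc n ℕ.∸ i))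
      split : ∀ i → i ℕ.< 2 ℕ.+ n → ν (suc n) * (e x i * e y (suc n ℕ.∸ i)) ≈ u i + v i
      split i (s≤s i≤) = trans
        (*-congʳ (trans (reflexive (≡.cong ν (≡.sym (ℕ.m+[n∸m]≡n i≤)))) (ν-+ i (suc n ℕ.∸ i))))
        (solve 4 (λ a b c d → (a :+ b) :* (c :* d) := a :* c :* d :+ c :* (b :* d)) refl (ν i) (ν (suc n ℕ.∸ i)) (e x i) (e y (suc n ℕ.∸ i)))
      left : Σ< (2 ℕ.+ n) u ≈ x * conv x y n
      left = begin
        Σ< (2 ℕ.+ n) u                                       ≈⟨ Σ-head (suc n) u ⟩
        u 0 + Σ< (suc n) (λ i → u (suc i))                   ≈⟨ +-cong (trans (*-congʳ (trans (*-congʳ ν0) (zeroˡ _))) (zeroˡ _))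
                                                                  (Σ-cong (suc n) λ i _ → trans (*-congʳ (νe-suc x i)) (*-assoc x _ _)) ⟩
        0# + Σ< (suc n) (λ i → x * (e x i * e y (n ℕ.∸ i)))  ≈⟨ trans (+-identityˡ _) (Σ-* (suc n) x _) ⟩
        x * conv x y n ∎
      right : Σ< (2 ℕ.+ n) v ≈ y * conv x y n
      right = begin
        Σ< (suc n) v + v (suc n)                             ≈⟨ +-cong (Σ-cong (suc n) step) last ⟩
        Σ< (suc n) (λ i → y * (e x i * e y (n ℕ.∸ i))) + 0#  ≈⟨ trans (+-identityʳ _) (Σ-* (suc n) y _) ⟩
        y * conv x y n ∎
        where
        last : v (suc n) ≈ 0#
        last rewrite ℕ.n∸n≡0 n = trans (*-congˡ (trans (*-congʳ ν0) (zeroˡ _))) (zeroʳ _)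
        step : ∀ i → i ℕ.< suc n → v i ≈ y * (e x i * e y (n ℕ.∸ i))
        step i (s≤s i≤n) rewrite ℕ.+-∸-assoc 1 i≤n = trans (*-congˡ (νe-suc y (n ℕ.∸ i)))
          (solve 3 (λ a y b → a :* (y :* b) := y :* (a :* b)) refl (e x i) y (e y (n ℕ.∸ i)))

    e-+ : ∀ x y n → e (x + y) n ≈ conv x y n
    e-+ x y zero    = trans (*-identityʳ _) (trans f0 (sym (trans (+-identityˡ _)
      (trans (*-cong (trans (*-identityʳ _) f0) (trans (*-identityʳ _) f0)) (*-identityˡ 1#)))))
    e-+ x y (suc n) = ν-cancel n (trans (νe-suc (x + y) n) (trans (*-congˡ (e-+ x y n)) (sym (conv-suc x y n))))

    partial : Carrier → ℕ → Carrier
    partial x n = Σ< n (e x)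

    -- The partial sum for x + y covers the triangle i + j < n of the double series, here taken row
    -- by row.
    partial-+ : ∀ x y n → partial (x + y) n ≈ Σ< n (λ i → e x i * partial y (n ℕ.∸ i))
    partial-+ x y zero    = refl
    partial-+ x y (suc n) = begin
      partial (x + y) n + e (x + y) n                          ≈⟨ +-cong (partial-+ x y n) (e-+ x y n) ⟩
      Σ< n g + conv x y n                                      ≈⟨ +-congʳ (sym (trans (+-congˡ last) (+-identityʳ _))) ⟩
      Σ< n g + g n + conv x y n                                ≈⟨ sym (Σ-+ (suc n) g _) ⟩
      Σ< (suc n) (λ i → g i + e x i * e y (n ℕ.∸ i))           ≈⟨ Σ-cong (suc n) step ⟩
      Σ< (suc n) (λ i → e x i * partial y (suc n ℕ.∸ i)) ∎
      where
      g : ℕ → Carrier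
      g i = e x i * partial y (n ℕ.∸ i)
      last : g n ≈ 0#
      last rewrite ℕ.n∸n≡0 n = zeroʳ _
      step : ∀ i → i ℕ.< suc n → g i + e x i * e y (n ℕ.∸ i) ≈ e x i * partial y (suc n ℕ.∸ i)
      step i (s≤s i≤n) rewrite ℕ.+-∸-assoc 1 i≤n = sym (distribˡ (e x i) _ _)

-- Gaussian rationals and the addition theorem for partial sums

module Analysis where

  open import Data.Rational.Base hiding (_≃_)
  open import Data.Rational.Properties
  open ≡ using (refl; sym; trans; cong; cong₂; subst)
  open Real hiding (Σ<)
  open Complex

  negᵍ : ℚ[i] → ℚ[i]
  negᵍ z = - re z +i - im z

  ℚ[i]-ring : CommutativeRing 0ℓ 0ℓ
  ℚ[i]-ring = record
    { Carrier = ℚ[i] ; _≈_ = _≡_ ; _+_ = _+ᵍ_ ; _*_ = _*ᵍ_ ; -_ = negᵍ ; 0# = 0ᵍ ; 1# = 1ᵍ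
    ; isCommutativeRing = record
      { isRing = record
        { +-isAbelianGroup = record
          { isGroup = record
            { isMonoid = record
              { isSemigroup = record
                { isMagma = record { isEquivalence = ≡.isEquivalence ; ∙-cong = ≡.cong₂ _+ᵍ_ }
                ; assoc = λ x y z → ᵍ-ext (+-assoc (re x) (re y) (re z)) (+-assoc (im x) (im y) (im z)) }
              ; identity = (λ x → ᵍ-ext (+-identityˡ (re x)) (+-identityˡ (im x)))
                         , (λ x → ᵍ-ext (+-identityʳ (re x)) (+-identityʳ (im x))) }
            ; inverse = (λ x → ᵍ-ext (+-inverseˡ (re x)) (+-inverseˡ (im x)))
                      , (λ x → ᵍ-ext (+-inverseʳ (re x)) (+-inverseʳ (im x)))
            ; ⁻¹-cong = ≡.cong negᵍ }
          ; comm = λ x y → ᵍ-ext (+-comm (re x) (re y)) (+-comm (im x) (im y)) }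
        ; *-cong = ≡.cong₂ _*ᵍ_
        ; *-assoc = λ x y z → ᵍ-ext (assoc₁ (re x) (im x) (re y) (im y) (re z) (im z)) (assoc₂ (re x) (im x) (re y) (im y) (re z) (im z))
        ; *-identity = (λ x → ᵍ-ext (idˡ₁ (re x) (im x)) (idˡ₂ (re x) (im x)))
                     , (λ x → ᵍ-ext (idʳ₁ (re x) (im x)) (idʳ₂ (re x) (im x)))
        ; distrib = (λ x y z → ᵍ-ext (dˡ₁ (re x) (im x) (re y) (im y) (re z) (im z)) (dˡ₂ (re x) (im x) (re y) (im y) (re z) (im z)))
                  , (λ x y z → ᵍ-ext (dʳ₁ (re x) (im x) (re y) (im y) (re z) (im z)) (dʳ₂ (re x) (im x) (re y) (im y) (re z) (im z))) }
      ; *-comm = λ x y → ᵍ-ext (c₁ (re x) (im x) (re y) (im y)) (c₂ (re x) (im x) (re y) (im y)) } }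
    where
    assoc₁ : ∀ a b c d e f → (a * c - b * d) * e - (a * d + b * c) * f ≡ a * (c * e - d * f) - b * (c * f + d * e)
    assoc₁ = solve-∀ ℚ-ring
    assoc₂ : ∀ a b c d e f → (a * c - b * d) * f + (a * d + b * c) * e ≡ a * (c * f + d * e) + b * (c * e - d * f)
    assoc₂ = solve-∀ ℚ-ring
    idˡ₁ : ∀ a b → 1ℚ * a - 0ℚ * b ≡ a
    idˡ₁ = solve-∀ ℚ-ring
    idˡ₂ : ∀ a b → 1ℚ * b + 0ℚ * a ≡ b
    idˡ₂ = solve-∀ ℚ-ring
    idʳ₁ : ∀ a b → a * 1ℚ - b * 0ℚ ≡ a
    idʳ₁ = solve-∀ ℚ-ring
    idʳ₂ : ∀ a b → a * 0ℚ + b * 1ℚ ≡ b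
    idʳ₂ = solve-∀ ℚ-ring
    dˡ₁ : ∀ a b c d e f → a * (c + e) - b * (d + f) ≡ (a * c - b * d) + (a * e - b * f)
    dˡ₁ = solve-∀ ℚ-ring
    dˡ₂ : ∀ a b c d e f → a * (d + f) + b * (c + e) ≡ (a * d + b * c) + (a * f + b * e)
    dˡ₂ = solve-∀ ℚ-ring
    dʳ₁ : ∀ a b c d e f → (c + e) * a - (d + f) * b ≡ (c * a - d * b) + (e * a - f * b)
    dʳ₁ = solve-∀ ℚ-ring
    dʳ₂ : ∀ a b c d e f → (c + e) * b + (d + f) * a ≡ (c * b + d * a) + (e * b + f * a)
    dʳ₂ = solve-∀ ℚ-ring
    c₁ : ∀ a b c d → a * c - b * d ≡ c * a - d * b
    c₁ = solve-∀ ℚ-ring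
    c₂ : ∀ a b c d → a * d + b * c ≡ c * b + d * a
    c₂ = solve-∀ ℚ-ring

  ℚ[i]-acr : AlmostCommutativeRing 0ℓ 0ℓ
  ℚ[i]-acr = fromCommutativeRing ℚ[i]-ring λ { (mkℚ (+ 0) 0 _ +i mkℚ (+ 0) 0 _) → just ≡.refl ; _ → nothing }

  module G = CommutativeRing ℚ[i]-ring

  module Sℚ = FiniteSums +-*-commutativeRing
  module Sᵍ = FiniteSums ℚ[i]-ring

  ι-cancel : ∀ k {x y} → ι (suc k) * x ≡ ι (suc k) * y → x ≡ y
  ι-cancel k {x} {y} h = trans (sym (insert x)) (trans (cong (r *_) h) (insert y))
    where
    r = + 1 / suc k
    insert : ∀ x → r * (ι (suc k) * x) ≡ x
    insert x = trans (sym (*-assoc r _ x)) (trans (cong (_* x) (1/-ι (suc k))) (*-identityˡ x))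

  module Cℚ = ExponentialSeries.CauchyProduct +-*-commutativeRing (λ k → 1/ k !) ι refl refl ι-+
    (λ k → trans (*-comm (ι (suc k)) (1/ suc k !)) (1/!-suc k)) ι-cancel

  real-* : ∀ c z → (c +i 0ℚ) *ᵍ z ≡ c ·ᵍ z
  real-* c z = ᵍ-ext (lem₁ c (re z) (im z)) (lem₂ c (re z) (im z))
    where
    lem₁ : ∀ c a b → c * a - 0ℚ * b ≡ c * a
    lem₁ = solve-∀ ℚ-ring
    lem₂ : ∀ c a b → c * b + 0ℚ * a ≡ c * b
    lem₂ = solve-∀ ℚ-ring

  ι-cancelᵍ : ∀ k {x y} → (ι (suc k) +i 0ℚ) *ᵍ x ≡ (ι (suc k) +i 0ℚ) *ᵍ y → x ≡ y
  ι-cancelᵍ k {x} {y} h = ᵍ-ext (ι-cancel k (cong re h′)) (ι-cancel k (cong im h′))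
    where
    h′ : ι (suc k) ·ᵍ x ≡ ι (suc k) ·ᵍ y
    h′ = trans (sym (real-* (ι (suc k)) x)) (trans h (real-* (ι (suc k)) y))

  module Cᵍ = ExponentialSeries.CauchyProduct ℚ[i]-ring (λ k → (1/ k !) +i 0ℚ) (λ k → ι k +i 0ℚ) refl refl
    (λ m n → ᵍ-ext (ι-+ m n) refl)
    (λ k → trans (real-* (ι (suc k)) ((1/ suc k !) +i 0ℚ)) (ᵍ-ext (trans (*-comm (ι (suc k)) (1/ suc k !)) (1/!-suc k)) (*-zeroʳ (ι (suc k)))))
    ι-cancelᵍ

  ^ᵍ≡^ : ∀ z k → z ^ᵍ k ≡ z Sᵍ.^ k
  ^ᵍ≡^ z zero    = refl
  ^ᵍ≡^ z (suc k) = cong (z *ᵍ_) (^ᵍ≡^ z k)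

  ^ℚ≡^ : ∀ p k → p ^ℚ k ≡ p Sℚ.^ k
  ^ℚ≡^ p zero    = refl
  ^ℚ≡^ p (suc k) = cong (p *_) (^ℚ≡^ p k)

  expᵍ≡partial : ∀ n z → expᵍ n z ≡ Cᵍ.partial z n
  expᵍ≡partial zero    z = refl
  expᵍ≡partial (suc n) z = cong₂ _+ᵍ_ (expᵍ≡partial n z) (trans (sym (real-* (1/ n !) (z ^ᵍ n))) (cong (((1/ n !) +i 0ℚ) *ᵍ_) (^ᵍ≡^ z n)))

  Σℚ-mono : ∀ n {f g : ℕ → ℚ} → (∀ k → k ℕ.< n → f k ≤ g k) → Sℚ.Σ< n f ≤ Sℚ.Σ< n g
  Σℚ-mono zero    h = ≤-refl
  Σℚ-mono (suc n) h = +-mono-≤ (Σℚ-mono n (λ k p → h k (ℕ.m≤n⇒m≤1+n p))) (h n ℕ.≤-refl)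

  Σℚ-extend : ∀ m n {f : ℕ → ℚ} → (∀ k → 0ℚ ≤ f k) → Sℚ.Σ< n f ≤ Sℚ.Σ< (m ℕ.+ n) f
  Σℚ-extend zero    n h = ≤-refl
  Σℚ-extend (suc m) n h = ≤-trans (Σℚ-extend m n h) (p≤p+q _ (h (m ℕ.+ n)))

  -- In the application f i is the i-th term of one series, c a full partial sum of the other and g
  -- i a shorter one, so that the left side compares the square of indices with the triangle.
  ∥Σ-Σ∥ : ∀ n (f g : ℕ → ℚ[i]) c →
    ∥ Sᵍ.Σ< n f *ᵍ c -ᵍ Sᵍ.Σ< n (λ i → f i *ᵍ g i) ∥ ≤ Sℚ.Σ< n (λ i → ∥ f i ∥ * ∥ c -ᵍ g i ∥)
  ∥Σ-Σ∥ zero    f g c = ≤-reflexive (cong ∥_∥ (ᵍ-ext (lem₁ (re c) (im c)) (lem₂ (re c) (im c))))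
    where
    lem₁ : ∀ a b → (0ℚ * a - 0ℚ * b) - 0ℚ ≡ 0ℚ
    lem₁ = solve-∀ ℚ-ring
    lem₂ : ∀ a b → (0ℚ * b + 0ℚ * a) - 0ℚ ≡ 0ℚ
    lem₂ = solve-∀ ℚ-ring
  ∥Σ-Σ∥ (suc n) f g c = ≤-trans
    (≤-reflexive (cong ∥_∥ (ᵍ-ext (lem₁ (re F) (im F) (re u) (im u) (re c) (im c) (re G) (re v) (im v)) (lem₂ (re F) (im F) (re u) (im u) (re c) (im c) (im G) (re v) (im v)))))
    (≤-trans (∥∥-+ (F *ᵍ c -ᵍ G) (u *ᵍ (c -ᵍ v))) (+-mono-≤ (∥Σ-Σ∥ n f g c) (∥∥-* u (c -ᵍ v))))
    where
    F = Sᵍ.Σ< n f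
    G = Sᵍ.Σ< n (λ i → f i *ᵍ g i)
    u = f n
    v = g n
    lem₁ : ∀ a b x y c d p v w → ((a + x) * c - (b + y) * d) - (p + (x * v - y * w))
           ≡ ((a * c - b * d) - p) + (x * (c - v) - y * (d - w))
    lem₁ = solve-∀ ℚ-ring
    lem₂ : ∀ a b x y c d p v w → ((a + x) * d + (b + y) * c) - (p + (x * w + y * v))
           ≡ ((a * d + b * c) - p) + (x * (d - w) + y * (c - v))
    lem₂ = solve-∀ ℚ-ring

  module ExpProduct (B : ℚ) (0≤B : 0ℚ ≤ B) where

    open Majorant B 0≤B public
    module Double = Majorant (B + B) (+-nonneg 0≤B 0≤B)

    s≡partial : ∀ (C : ℚ) (0≤C : 0ℚ ≤ C) n → Majorant.s C 0≤C n ≡ Cℚ.partial C n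
    s≡partial C 0≤C zero    = refl
    s≡partial C 0≤C (suc n) = cong₂ _+_ (s≡partial C 0≤C n) (cong ((1/ n !) *_) (^ℚ≡^ C n))

    b≡e : ∀ k → b k ≡ Cℚ.e B k
    b≡e k = cong ((1/ k !) *_) (^ℚ≡^ B k)

    s≡Σ : ∀ n → s n ≡ Sℚ.Σ< n b
    s≡Σ zero    = refl
    s≡Σ (suc n) = cong (_+ b n) (s≡Σ n)

    double≡ : ∀ n → Double.s n ≡ Sℚ.Σ< n (λ i → b i * s (n ℕ.∸ i))
    double≡ n = trans (s≡partial (B + B) (+-nonneg 0≤B 0≤B) n) (trans (Cℚ.partial-+ B B n)
      (Sℚ.Σ-cong n λ i _ → cong₂ _*_ (sym (b≡e i)) (sym (s≡partial B 0≤B (n ℕ.∸ i)))))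

    s-nonneg : ∀ n → 0ℚ ≤ s n
    s-nonneg n = s-mono {0} {n} z≤n

    -- The square i, j < n lies inside the triangle i + j < 2n, whose sum is the partial sum of the
    -- exponential series of 2B.
    s²≤ : ∀ n → s n * s n ≤ Double.s (n ℕ.+ n)
    s²≤ n = begin
      s n * s n                                               ≡⟨ cong (s n *_) (s≡Σ n) ⟩
      s n * Sℚ.Σ< n b                                         ≡⟨ sym (Sℚ.Σ-* n (s n) b) ⟩
      Sℚ.Σ< n (λ i → s n * b i)                               ≤⟨ Σℚ-mono n (λ i i<n → ≤-trans (≤-reflexive (*-comm (s n) (b i)))
                                                                   (*-monoˡ (b i) (b-nonneg i) (s-mono (fits i i<n)))) ⟩
      Sℚ.Σ< n (λ i → b i * s (n ℕ.+ n ℕ.∸ i))                 ≤⟨ Σℚ-extend n n (λ i → *-nonneg (b-nonneg i) (s-nonneg (n ℕ.+ n ℕ.∸ i))) ⟩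
      Sℚ.Σ< (n ℕ.+ n) (λ i → b i * s (n ℕ.+ n ℕ.∸ i))         ≡⟨ sym (double≡ (n ℕ.+ n)) ⟩
      Double.s (n ℕ.+ n) ∎
      where
      open ≤-Reasoning
      fits : ∀ i → i ℕ.< n → n ℕ.≤ n ℕ.+ n ℕ.∸ i
      fits i i<n = ℕ.≤-trans (ℕ.m≤m+n n (n ℕ.∸ i)) (ℕ.≤-reflexive (sym (ℕ.+-∸-assoc n (ℕ.<⇒≤ i<n))))

    -- The terms in the square but outside the triangle i + j < n are dominated by the same terms
    -- for B. These amount to s n · s n - Double.s n, which `s²≤` bounds by a Cauchy difference of
    -- the series for 2B, uniformly in z and w.
    exp-error : ∀ z w → ∥ z ∥ ≤ B → ∥ w ∥ ≤ B → ∀ n →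
      ∥ expᵍ n z *ᵍ expᵍ n w -ᵍ expᵍ n (z +ᵍ w) ∥ ≤ Double.s (n ℕ.+ n) - Double.s n
    exp-error z w hz hw n = begin
      ∥ expᵍ n z *ᵍ expᵍ n w -ᵍ expᵍ n (z +ᵍ w) ∥
        ≡⟨ cong ∥_∥ (cong₂ _-ᵍ_ (cong (_*ᵍ expᵍ n w) (expᵍ≡partial n z)) (trans (expᵍ≡partial n (z +ᵍ w)) (Cᵍ.partial-+ z w n))) ⟩
      ∥ Sᵍ.Σ< n (Cᵍ.e z) *ᵍ expᵍ n w -ᵍ Sᵍ.Σ< n (λ i → Cᵍ.e z i *ᵍ Cᵍ.partial w (n ℕ.∸ i)) ∥
        ≤⟨ ∥Σ-Σ∥ n (Cᵍ.e z) (λ i → Cᵍ.partial w (n ℕ.∸ i)) (expᵍ n w) ⟩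
      Sℚ.Σ< n (λ i → ∥ Cᵍ.e z i ∥ * ∥ expᵍ n w -ᵍ Cᵍ.partial w (n ℕ.∸ i) ∥)
        ≤⟨ Σℚ-mono n (λ i _ → *-mono (∥∥-nonneg (expᵍ n w -ᵍ Cᵍ.partial w (n ℕ.∸ i))) (b-nonneg i) (term i) (tail i)) ⟩
      Sℚ.Σ< n (λ i → b i * (s n - s (n ℕ.∸ i)))
        ≡⟨ Sℚ.Σ-cong n (λ i _ → lem (b i) (s n) (s (n ℕ.∸ i))) ⟩
      Sℚ.Σ< n (λ i → s n * b i + -1ℚ * t i)
        ≡⟨ trans (Sℚ.Σ-+ n (λ i → s n * b i) (λ i → -1ℚ * t i)) (cong₂ _+_ (Sℚ.Σ-* n (s n) b) (Sℚ.Σ-* n -1ℚ t)) ⟩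
      s n * Sℚ.Σ< n b + -1ℚ * Sℚ.Σ< n t
        ≡⟨ cong₂ (λ x y → s n * x + -1ℚ * y) (sym (s≡Σ n)) (sym (double≡ n)) ⟩
      s n * s n + -1ℚ * Double.s n
        ≡⟨ lem′ (s n * s n) (Double.s n) ⟩
      s n * s n - Double.s n
        ≤⟨ +-monoˡ-≤ (- Double.s n) (s²≤ n) ⟩
      Double.s (n ℕ.+ n) - Double.s n ∎
      where
      open ≤-Reasoning
      -1ℚ = - 1ℚ
      t : ℕ → ℚ
      t i = b i * s (n ℕ.∸ i)
      lem : ∀ b s t → b * (s - t) ≡ s * b + (- 1ℚ) * (b * t)
      lem = solve-∀ ℚ-ring
      lem′ : ∀ s t → s + (- 1ℚ) * t ≡ s - t
      lem′ = solve-∀ ℚ-ring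
      term : ∀ i → ∥ Cᵍ.e z i ∥ ≤ b i
      term i = ≤-trans (≤-reflexive (trans (cong ∥_∥ (trans (real-* (1/ i !) (z Sᵍ.^ i)) (cong ((1/ i !) ·ᵍ_) (sym (^ᵍ≡^ z i))))) (∥∥-· (1/ i !) (z ^ᵍ i) (1/!-nonneg i))))
        (*-monoˡ (1/ i !) (1/!-nonneg i) (^-bound z hz i))
      tail : ∀ i → ∥ expᵍ n w -ᵍ Cᵍ.partial w (n ℕ.∸ i) ∥ ≤ s n - s (n ℕ.∸ i)
      tail i = ≤-trans (≤-reflexive (cong (λ x → ∥ expᵍ n w -ᵍ x ∥) (sym (expᵍ≡partial (n ℕ.∸ i) w))))
        (exp-tail w hw (ℕ.m∸n≤m n i))

    η : ℕ → ℚ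
    η n = Double.s (n ℕ.+ n) - Double.s n

    η-small : Small (λ i _ → η i)
    η-small δ 0<δ = proj₁ (Double.s-small δ 0<δ) , λ i _ p _ → ≤-<-trans (p≤∣p∣ (η i))
      (proj₂ (Double.s-small δ 0<δ) (i ℕ.+ i) i (ℕ.≤-trans p (ℕ.m≤m+n i i)) p)

    exp-bound : ∀ z → ∥ z ∥ ≤ B → ∀ n → ∥ expᵍ n z ∥ ≤ M
    exp-bound z hz n = ≤-trans (≤-reflexive (cong ∥_∥ (ᵍ-ext (lem (re (expᵍ n z))) (lem (im (expᵍ n z))))))
      (≤-trans (exp-tail z hz {0} {n} z≤n) (≤-trans (≤-reflexive (+-identityʳ (s n))) (≤-trans (s-bound n) (p≤p+q (u K) (<⇒≤ 0<1)))))
      where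
      lem : ∀ a → a ≡ a - 0ℚ
      lem = solve-∀ ℚ-ring

  -- Complex numbers up to the equality of limits

  module ℂ-Ring where

    infix 4 _≋_
    -- Stated for the norm of the difference instead of componentwise, so that `∥∥-+` and `∥∥-*`
    -- give the congruences, and identities in ℚ[i] give the ring laws termwise. `Small` has two
    -- indices, of which the first is used here.
    record _≋_ (z w : ℂ) : Set where
      constructor mk≋
      field
        small : Small (λ i _ → ∥ approx z i -ᵍ approx w i ∥)

    ≋⇒≃ : ∀ {z w} → z ≋ w → z ≃ w
    ≋⇒≃ {z} {w} (mk≋ h) =
        (λ ε 0<ε → proj₁ (h ε 0<ε) , λ i p → ≤-<-trans (p≤p+q _ (0≤∣p∣ (im (d i)))) (proj₂ (h ε 0<ε) i i p p))
      , (λ ε 0<ε → proj₁ (h ε 0<ε) , λ i p → ≤-<-trans (p≤q+p _ (0≤∣p∣ (re (d i)))) (proj₂ (h ε 0<ε) i i p p))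
      where
      d : ℕ → ℚ[i]
      d i = approx z i -ᵍ approx w i

    ∥z-z∥ : ∀ z → ∥ z -ᵍ z ∥ ≡ 0ℚ
    ∥z-z∥ z = trans (cong ∥_∥ (ᵍ-ext {re z - re z} {im z - im z} {0ℚ} {0ℚ} (+-inverseʳ (re z)) (+-inverseʳ (im z)))) refl

    ∥∥-sym : ∀ z w → ∥ z -ᵍ w ∥ ≡ ∥ w -ᵍ z ∥
    ∥∥-sym = Majorant.∥-∥-sym 0ℚ ≤-refl

    ∥∥-tri : ∀ x y z → ∥ x -ᵍ z ∥ ≤ ∥ x -ᵍ y ∥ + ∥ y -ᵍ z ∥
    ∥∥-tri x y z = ≤-trans (≤-reflexive (cong ∥_∥ (ᵍ-ext (lem (re x) (re y) (re z)) (lem (im x) (im y) (im z)))))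
      (∥∥-+ (x -ᵍ y) (y -ᵍ z))
      where
      lem : ∀ a b c → a - c ≡ (a - b) + (b - c)
      lem = solve-∀ ℚ-ring

    ∥∥-+-+ : ∀ x y z w → ∥ (x +ᵍ y) -ᵍ (z +ᵍ w) ∥ ≤ ∥ x -ᵍ z ∥ + ∥ y -ᵍ w ∥
    ∥∥-+-+ x y z w = ≤-trans
      (≤-reflexive (cong ∥_∥ (ᵍ-ext (lem (re x) (re y) (re z) (re w)) (lem (im x) (im y) (im z) (im w)))))
      (∥∥-+ (x -ᵍ z) (y -ᵍ w))
      where
      lem : ∀ a b c d → (a + b) - (c + d) ≡ (a - c) + (b - d)
      lem = solve-∀ ℚ-ring

    *-split : ∀ x y z w → x *ᵍ y -ᵍ z *ᵍ w ≡ x *ᵍ (y -ᵍ w) +ᵍ w *ᵍ (x -ᵍ z)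
    *-split x y z w = ᵍ-ext (lem₁ (re x) (im x) (re z) (im z) (re y) (im y) (re w) (im w))
                            (lem₂ (re x) (im x) (re z) (im z) (re y) (im y) (re w) (im w))
      where
      lem₁ : ∀ a b c d p q r s → (a * p - b * q) - (c * r - d * s)
             ≡ (a * (p - r) - b * (q - s)) + (r * (a - c) - s * (b - d))
      lem₁ = solve-∀ ℚ-ring
      lem₂ : ∀ a b c d p q r s → (a * q + b * p) - (c * s + d * r)
             ≡ (a * (q - s) + b * (p - r)) + (r * (b - d) + s * (a - c))
      lem₂ = solve-∀ ℚ-ring

    ∥∥-*-* : ∀ x y z w → ∥ x *ᵍ y -ᵍ z *ᵍ w ∥ ≤ ∥ x ∥ * ∥ y -ᵍ w ∥ + ∥ w ∥ * ∥ x -ᵍ z ∥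
    ∥∥-*-* x y z w = ≤-trans (≤-reflexive (cong ∥_∥ (*-split x y z w)))
      (≤-trans (∥∥-+ (x *ᵍ (y -ᵍ w)) (w *ᵍ (x -ᵍ z))) (+-mono-≤ (∥∥-* x (y -ᵍ w)) (∥∥-* w (x -ᵍ z))))

    β : ℂ → ℚ
    β z = proj₁ (bounded (Re z)) + proj₁ (bounded (Im z))

    0<β : ∀ z → 0ℚ < β z
    0<β z = <-≤-trans (proj₁ (proj₂ (bounded (Re z)))) (p≤p+q _ (<⇒≤ (proj₁ (proj₂ (bounded (Im z))))))

    approx≤β : ∀ z i → ∥ approx z i ∥ ≤ β z
    approx≤β z i = +-mono-≤ (proj₂ (proj₂ (bounded (Re z))) i) (proj₂ (proj₂ (bounded (Im z))) i)

    Small-cong : ∀ {d e : ℕ → ℚ} → (∀ i → d i ≤ e i) → Small (λ i _ → e i) → Small (λ i _ → d i)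
    Small-cong h = Small-≤ 0 (λ i _ _ _ → h i)

    pointwise : ∀ {z w} → (∀ i → approx z i ≡ approx w i) → z ≋ w
    pointwise {z} {w} h = mk≋ λ ε 0<ε → 0 , λ i _ _ _ →
      ≤-<-trans (≤-reflexive (trans (cong (λ x → ∥ x -ᵍ approx w i ∥) (h i)) (∥z-z∥ (approx w i)))) 0<ε

    ≋-refl : ∀ {z} → z ≋ z
    ≋-refl {z} = pointwise {z} {z} λ _ → refl

    ≋-sym : ∀ {z w} → z ≋ w → w ≋ z
    ≋-sym {z} {w} (mk≋ h) = mk≋ (Small-cong (λ i → ≤-reflexive (∥∥-sym (approx w i) (approx z i))) h)

    ≋-trans : ∀ {x y z} → x ≋ y → y ≋ z → x ≋ z
    ≋-trans {x} {y} {z} (mk≋ h) (mk≋ k) = mk≋ (Small-cong (λ i → ∥∥-tri (approx x i) (approx y i) (approx z i)) (Small-+ h k))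

    -- Opaque copies of the operations: conversion checking would otherwise unfold them
    -- down to their Cauchy moduli.
    infixl 6 _⊕_
    infixl 7 _⊗_
    infix  8 ⊖_
    abstract
      _⊕_ _⊗_ : ℂ → ℂ → ℂ
      z ⊕ w = z +ᶜ w
      z ⊗ w = z *ᶜ w

      ⊖_ : ℂ → ℂ
      ⊖ z = mkℂ (-ʳ Re z) (-ʳ Im z)

      ⊕≡+ᶜ : ∀ z w → z ⊕ w ≡ z +ᶜ w
      ⊕≡+ᶜ z w = refl

      ⊗≡*ᶜ : ∀ z w → z ⊗ w ≡ z *ᶜ w
      ⊗≡*ᶜ z w = refl

      approx-+ : ∀ x y i → approx (x ⊕ y) i ≡ approx x i +ᵍ approx y i
      approx-+ x y i = refl

      approx-* : ∀ x y i → approx (x ⊗ y) i ≡ approx x i *ᵍ approx y i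
      approx-* x y i = refl

      approx-- : ∀ x i → approx (⊖ x) i ≡ negᵍ (approx x i)
      approx-- x i = refl

    ⊕-cong : ∀ {x y z w} → x ≋ z → y ≋ w → x ⊕ y ≋ z ⊕ w
    ⊕-cong {x} {y} {z} {w} (mk≋ h) (mk≋ k) = mk≋ (Small-cong (λ i → ≤-trans
      (≤-reflexive (cong₂ (λ u v → ∥ u -ᵍ v ∥) (approx-+ x y i) (approx-+ z w i))) (∥∥-+-+ (approx x i) (approx y i) (approx z i) (approx w i))) (Small-+ h k))

    ⊗-cong : ∀ {x y z w} → x ≋ z → y ≋ w → x ⊗ y ≋ z ⊗ w
    ⊗-cong {x} {y} {z} {w} (mk≋ h) (mk≋ k) = mk≋ (Small-cong
      (λ i → ≤-trans (≤-trans (≤-reflexive (cong₂ (λ u v → ∥ u -ᵍ v ∥) (approx-* x y i) (approx-* z w i))) (∥∥-*-* (approx x i) (approx y i) (approx z i) (approx w i)))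
        (+-mono-≤ (*-monoʳ _ (∥∥-nonneg (approx y i -ᵍ approx w i)) (approx≤β x i))
                  (*-monoʳ _ (∥∥-nonneg (approx x i -ᵍ approx z i)) (approx≤β w i))))
      (Small-+ (Small-* (β x) (0<β x) k) (Small-* (β w) (0<β w) h)))

    ⊖-cong : ∀ {x y} → x ≋ y → ⊖ x ≋ ⊖ y
    ⊖-cong {x} {y} (mk≋ h) = mk≋ (Small-cong (λ i → ≤-reflexive (trans
      (cong ∥_∥ (trans (cong₂ _-ᵍ_ (approx-- x i) (approx-- y i)) (ᵍ-ext (lem (re (approx x i)) (re (approx y i))) (lem (im (approx x i)) (im (approx y i))))))
      (∥∥-sym (approx y i) (approx x i)))) h)
      where
      lem : ∀ a b → - a - - b ≡ b - a
      lem = solve-∀ ℚ-ring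

    ptw : ∀ z w → (∀ i → approx z i ≡ approx w i) → z ≋ w
    ptw z w = pointwise {z} {w}

    ⊕-assoc : ∀ x y z → (x ⊕ y) ⊕ z ≋ x ⊕ (y ⊕ z)
    ⊕-assoc x y z = ptw ((x ⊕ y) ⊕ z) (x ⊕ (y ⊕ z)) λ i →
      trans (approx-+ (x ⊕ y) z i) (trans (cong (_+ᵍ approx z i) (approx-+ x y i))
      (trans (G.+-assoc (approx x i) (approx y i) (approx z i))
      (sym (trans (approx-+ x (y ⊕ z) i) (cong (approx x i +ᵍ_) (approx-+ y z i))))))

    ⊕-comm : ∀ x y → x ⊕ y ≋ y ⊕ x
    ⊕-comm x y = ptw (x ⊕ y) (y ⊕ x) λ i →
      trans (approx-+ x y i) (trans (G.+-comm (approx x i) (approx y i)) (sym (approx-+ y x i)))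

    ⊕-identityˡ : ∀ x → fromℤᶜ 0ℤ ⊕ x ≋ x
    ⊕-identityˡ x = ptw (fromℤᶜ 0ℤ ⊕ x) x λ i → trans (approx-+ (fromℤᶜ 0ℤ) x i) (G.+-identityˡ (approx x i))

    ⊕-inverseˡ : ∀ x → ⊖ x ⊕ x ≋ fromℤᶜ 0ℤ
    ⊕-inverseˡ x = ptw (⊖ x ⊕ x) (fromℤᶜ 0ℤ) λ i →
      trans (approx-+ (⊖ x) x i) (trans (cong (_+ᵍ approx x i) (approx-- x i)) (G.-‿inverseˡ (approx x i)))

    ⊗-assoc : ∀ x y z → (x ⊗ y) ⊗ z ≋ x ⊗ (y ⊗ z)
    ⊗-assoc x y z = ptw ((x ⊗ y) ⊗ z) (x ⊗ (y ⊗ z)) λ i →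
      trans (approx-* (x ⊗ y) z i) (trans (cong (_*ᵍ approx z i) (approx-* x y i))
      (trans (G.*-assoc (approx x i) (approx y i) (approx z i))
      (sym (trans (approx-* x (y ⊗ z) i) (cong (approx x i *ᵍ_) (approx-* y z i))))))

    ⊗-comm : ∀ x y → x ⊗ y ≋ y ⊗ x
    ⊗-comm x y = ptw (x ⊗ y) (y ⊗ x) λ i →
      trans (approx-* x y i) (trans (G.*-comm (approx x i) (approx y i)) (sym (approx-* y x i)))

    ⊗-identityˡ : ∀ x → fromℤᶜ 1ℤ ⊗ x ≋ x
    ⊗-identityˡ x = ptw (fromℤᶜ 1ℤ ⊗ x) x λ i → trans (approx-* (fromℤᶜ 1ℤ) x i) (G.*-identityˡ (approx x i))

    ⊗-distribˡ-⊕ : ∀ x y z → x ⊗ (y ⊕ z) ≋ x ⊗ y ⊕ x ⊗ z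
    ⊗-distribˡ-⊕ x y z = ptw (x ⊗ (y ⊕ z)) (x ⊗ y ⊕ x ⊗ z) λ i →
      trans (approx-* x (y ⊕ z) i) (trans (cong (approx x i *ᵍ_) (approx-+ y z i))
      (trans (G.distribˡ (approx x i) (approx y i) (approx z i))
      (sym (trans (approx-+ (x ⊗ y) (x ⊗ z) i) (cong₂ _+ᵍ_ (approx-* x y i) (approx-* x z i))))))

    ≋-isEquivalence : IsEquivalence _≋_
    ≋-isEquivalence = record { refl = λ {x} → ≋-refl {x} ; sym = λ {x} {y} → ≋-sym {x} {y} ; trans = λ {x} {y} {z} → ≋-trans {x} {y} {z} }

    ⊕-identityʳ : ∀ x → x ⊕ fromℤᶜ 0ℤ ≋ x
    ⊕-identityʳ x = ≋-trans {x ⊕ fromℤᶜ 0ℤ} {fromℤᶜ 0ℤ ⊕ x} {x} (⊕-comm x (fromℤᶜ 0ℤ)) (⊕-identityˡ x)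

    ⊕-inverseʳ : ∀ x → x ⊕ ⊖ x ≋ fromℤᶜ 0ℤ
    ⊕-inverseʳ x = ≋-trans {x ⊕ ⊖ x} { ⊖ x ⊕ x} {fromℤᶜ 0ℤ} (⊕-comm x (⊖ x)) (⊕-inverseˡ x)

    ⊗-identityʳ : ∀ x → x ⊗ fromℤᶜ 1ℤ ≋ x
    ⊗-identityʳ x = ≋-trans {x ⊗ fromℤᶜ 1ℤ} {fromℤᶜ 1ℤ ⊗ x} {x} (⊗-comm x (fromℤᶜ 1ℤ)) (⊗-identityˡ x)

    ⊗-distribʳ-⊕ : ∀ x y z → (y ⊕ z) ⊗ x ≋ y ⊗ x ⊕ z ⊗ x
    ⊗-distribʳ-⊕ x y z = ≋-trans {(y ⊕ z) ⊗ x} {x ⊗ (y ⊕ z)} {y ⊗ x ⊕ z ⊗ x} (⊗-comm (y ⊕ z) x)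
      (≋-trans {x ⊗ (y ⊕ z)} {x ⊗ y ⊕ x ⊗ z} {y ⊗ x ⊕ z ⊗ x} (⊗-distribˡ-⊕ x y z)
        (⊕-cong {x ⊗ y} {x ⊗ z} {y ⊗ x} {z ⊗ x} (⊗-comm x y) (⊗-comm x z)))

    ⊕-isMonoid : IsMonoid _≋_ _⊕_ (fromℤᶜ 0ℤ)
    ⊕-isMonoid = record
      { isSemigroup = record
        { isMagma = record { isEquivalence = ≋-isEquivalence ; ∙-cong = λ {x} {y} {z} {w} → ⊕-cong {x} {z} {y} {w} }
        ; assoc = ⊕-assoc }
      ; identity = ⊕-identityˡ , ⊕-identityʳ }

    ⊕-inverse : Inverse _≋_ (fromℤᶜ 0ℤ) ⊖_ _⊕_
    ⊕-inverse = ⊕-inverseˡ , ⊕-inverseʳ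

    ⊕-isGroup : IsGroup _≋_ _⊕_ (fromℤᶜ 0ℤ) ⊖_
    ⊕-isGroup = record { isMonoid = ⊕-isMonoid ; inverse = ⊕-inverse ; ⁻¹-cong = λ {x} {y} → ⊖-cong {x} {y} }

    ℂ-ring : CommutativeRing 0ℓ 0ℓ
    ℂ-ring = record
      { Carrier = ℂ ; _≈_ = _≋_ ; _+_ = _⊕_ ; _*_ = _⊗_ ; -_ = ⊖_ ; 0# = fromℤᶜ 0ℤ ; 1# = fromℤᶜ 1ℤ
      ; isCommutativeRing = record
        { isRing = record
          { +-isAbelianGroup = record { isGroup = ⊕-isGroup ; comm = ⊕-comm }
          ; *-cong = λ {x} {y} {z} {w} → ⊗-cong {x} {z} {y} {w}
          ; *-assoc = ⊗-assoc
          ; *-identity = ⊗-identityˡ , ⊗-identityʳ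
          ; distrib = ⊗-distribˡ-⊕ , ⊗-distribʳ-⊕ }
        ; *-comm = ⊗-comm } }

    exp-cong : ∀ {z w} → z ≋ w → exp z ≋ exp w
    exp-cong {z} {w} (mk≋ h) = mk≋ (Small-cong
      (λ i → exp-lipschitz (approx z i) (approx w i)
        (≤-trans (approx≤β z i) (p≤p+q _ (<⇒≤ (0<β w)))) (≤-trans (approx≤β w i) (p≤q+p _ (<⇒≤ (0<β z)))) i)
      (Small-* M 0<M h))
      where
      open Majorant (β z + β w) (+-nonneg (<⇒≤ (0<β z)) (<⇒≤ (0<β w)))

    -- Along the diagonal all three exponentials are partial sums with i terms at the i-th
    -- approximations, so `exp-error` applies at each index with a radius bounding all of them.
    exp-+ : ∀ z w → exp (z ⊕ w) ≋ exp z ⊗ exp w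
    exp-+ z w = ≋-sym {exp z ⊗ exp w} {exp (z ⊕ w)} (mk≋ (Small-cong
      (λ i → ≤-trans (≤-reflexive (cong₂ (λ u v → ∥ u -ᵍ v ∥) (approx-* (exp z) (exp w) i) (cong (expᵍ i) (approx-+ z w i))))
        (exp-error (approx z i) (approx w i)
          (≤-trans (approx≤β z i) (p≤p+q _ (<⇒≤ (0<β w)))) (≤-trans (approx≤β w i) (p≤q+p _ (<⇒≤ (0<β z)))) i))
      η-small))
      where
      open ExpProduct (β z + β w) (+-nonneg (<⇒≤ (0<β z)) (<⇒≤ (0<β w)))

  open ℂ-Ring

  -- Second-order Taylor estimate and bounds for π

  ¾ 1½ : ℚ
  ¾  = + 3 / 4
  1½ = + 3 / 2

  module SecondOrder where

    R : ℕ → ℚ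
    R zero    = 0ℚ
    R (suc n) = R n + 1/ (2 ℕ.+ n) !

    -- Strengthened for the induction: the reciprocal factorials from 1/2! on shrink at least by the
    -- factor 1/3, so all that follow sum to at most 1/(1 - 1/3) = 3/2 times the first. For n = 0
    -- there is equality, 3/2 · 1/2 = 3/4.
    R-bound′ : ∀ n → R n + 1½ * (1/ (2 ℕ.+ n) !) ≤ ¾
    R-bound′ zero    = ≤-refl
    R-bound′ (suc n) = ≤-trans
      (≤-trans (≤-reflexive (lem₁ (R n) f g)) (≤-trans (+-monoʳ-≤ (R n + f) (*-monoˡ ½ (<⇒≤ 0<½) 3g≤f)) (≤-reflexive (lem₂ (R n) f))))
      (R-bound′ n)
      where
      f = 1/ (2 ℕ.+ n) !
      g = 1/ (3 ℕ.+ n) !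
      3g≤f : g * ι 3 ≤ f
      3g≤f = ≤-trans (*-monoˡ g (1/!-nonneg (3 ℕ.+ n)) (ι-mono (ℕ.m≤m+n 3 n))) (≤-reflexive (1/!-suc (2 ℕ.+ n)))
      lem₁ : ∀ r f g → (r + f) + 1½ * g ≡ (r + f) + ½ * (g * ι 3)
      lem₁ = solve-∀ ℚ-ring
      lem₂ : ∀ r f → (r + f) + ½ * f ≡ r + 1½ * f
      lem₂ = solve-∀ ℚ-ring

    R-bound : ∀ n → R n ≤ ¾
    R-bound n = ≤-trans (p≤p+q (R n) (*-nonneg {1½} {1/ (2 ℕ.+ n) !} (0≤/ 3 2) (1/!-nonneg (2 ℕ.+ n)))) (R-bound′ n)

    module _ (z : ℚ[i]) (∥z∥≤1 : ∥ z ∥ ≤ 1ℚ) where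

      a² : ℚ
      a² = ∥ z ∥ * ∥ z ∥

      a²≥0 : 0ℚ ≤ a²
      a²≥0 = *-nonneg (∥∥-nonneg z) (∥∥-nonneg z)

      pow : ∀ k → ∥ z ^ᵍ (2 ℕ.+ k) ∥ ≤ a²
      pow zero    = ≤-trans (∥∥-* z (z *ᵍ 1ᵍ)) (≤-reflexive (cong (λ w → ∥ z ∥ * ∥ w ∥) (G.*-identityʳ z)))
      pow (suc k) = ≤-trans (∥∥-* z (z ^ᵍ (2 ℕ.+ k)))
        (≤-trans (*-mono (∥∥-nonneg (z ^ᵍ (2 ℕ.+ k))) (<⇒≤ 0<1) ∥z∥≤1 (pow k)) (≤-reflexive (*-identityˡ a²)))

      exp₂ : expᵍ 2 z ≡ 1ᵍ +ᵍ z
      exp₂ = ᵍ-ext (lem₁ (re z) (im z)) (lem₂ (re z) (im z))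
        where
        lem₁ : ∀ x y → (0ℚ + 1ℚ * 1ℚ) + 1ℚ * (x * 1ℚ - y * 0ℚ) ≡ 1ℚ + x
        lem₁ = solve-∀ ℚ-ring
        lem₂ : ∀ x y → (0ℚ + 1ℚ * 0ℚ) + 1ℚ * (x * 0ℚ + y * 1ℚ) ≡ 0ℚ + y
        lem₂ = solve-∀ ℚ-ring

      second′ : ∀ n → ∥ expᵍ (2 ℕ.+ n) z -ᵍ (1ᵍ +ᵍ z) ∥ ≤ R n * a²
      second′ zero    = ≤-reflexive (trans (cong (λ w → ∥ w -ᵍ (1ᵍ +ᵍ z) ∥) exp₂) (trans (∥z-z∥ (1ᵍ +ᵍ z)) (sym (*-zeroˡ a²))))
      second′ (suc n) = begin
        ∥ (E +ᵍ f ·ᵍ P) -ᵍ (1ᵍ +ᵍ z) ∥    ≡⟨ cong ∥_∥ (ᵍ-ext (lem (re E) (f * re P) (re (1ᵍ +ᵍ z))) (lem (im E) (f * im P) (im (1ᵍ +ᵍ z)))) ⟩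
        ∥ (E -ᵍ (1ᵍ +ᵍ z)) +ᵍ f ·ᵍ P ∥    ≤⟨ ∥∥-+ (E -ᵍ (1ᵍ +ᵍ z)) (f ·ᵍ P) ⟩
        ∥ E -ᵍ (1ᵍ +ᵍ z) ∥ + ∥ f ·ᵍ P ∥   ≤⟨ +-mono-≤ (second′ n) (≤-trans (≤-reflexive (∥∥-· f P (1/!-nonneg (2 ℕ.+ n)))) (*-monoˡ f (1/!-nonneg (2 ℕ.+ n)) (pow n))) ⟩
        R n * a² + f * a²                 ≡⟨ sym (*-distribʳ-+ a² (R n) f) ⟩
        R (suc n) * a² ∎
        where
        open ≤-Reasoning
        E = expᵍ (2 ℕ.+ n) z
        f = 1/ (2 ℕ.+ n) !
        P = z ^ᵍ (2 ℕ.+ n)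
        lem : ∀ a b c → (a + b) - c ≡ (a - c) + b
        lem = solve-∀ ℚ-ring

      second : ∀ n → ∥ expᵍ (2 ℕ.+ n) z -ᵍ (1ᵍ +ᵍ z) ∥ ≤ ¾ * a²
      second n = ≤-trans (second′ n) (*-monoʳ a² a²≥0 (R-bound n))

  open SecondOrder using (second)

  -- A Riemann sum of a decreasing function is at most the one with a single step, which is the
  -- initial value 4; the final value 2 gives the bound below.
  π≤4 : ∀ j → π-seq j ≤ ι 4
  π≤4 j = subst (λ d → π-seq d ≤ ι 4) (ℕ.+-identityʳ j) (Refine.below 0 j)

  2≤π : ∀ j → ι 2 ≤ π-seq j
  2≤π j = ≤-trans (≤-reflexive (sym eq)) (Σ<-≥const (suc j) (π-term j (suc j)) (λ k k<n → π-term-anti j (ℕ.<⇒≤ k<n)))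
    where
    N = suc j
    lem : ∀ N → (N ℕ.* (4 ℕ.* N)) ℕ.* 1 ≡ 2 ℕ.* (1 ℕ.* (N ℕ.* N ℕ.+ N ℕ.* N))
    lem = ℕ-Solver.solve-∀
    eq : ι N * π-term j N ≡ ι 2
    eq = trans (cong (_* π-term j N) (ι-≡ N)) (trans (/-* N 1 (4 ℕ.* N) (N ℕ.* N ℕ.+ N ℕ.* N))
      (/-≡ (N ℕ.* (4 ℕ.* N)) (1 ℕ.* (N ℕ.* N ℕ.+ N ℕ.* N)) 2 1 (lem N)))

  -- exp (iπ/2) = i

  -- Telescoping, with w the exponential of a sum and x, y those of its summands: the defect of the
  -- addition theorem, the local error y u - 1, and the error x g - 1 carried over from before.
  step-identity : ∀ w x y g u → w *ᵍ (g *ᵍ u) +ᵍ negᵍ 1ᵍ ≡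
    ((w +ᵍ negᵍ (x *ᵍ y)) *ᵍ (g *ᵍ u) +ᵍ (x *ᵍ g) *ᵍ (y *ᵍ u +ᵍ negᵍ 1ᵍ)) +ᵍ (x *ᵍ g +ᵍ negᵍ 1ᵍ)
  step-identity = solve-∀ ℚ[i]-acr

  local-identity : ∀ e v → e *ᵍ (1ᵍ +ᵍ negᵍ v) +ᵍ negᵍ 1ᵍ ≡
    (e +ᵍ negᵍ (1ᵍ +ᵍ v)) *ᵍ (1ᵍ +ᵍ negᵍ v) +ᵍ negᵍ (v *ᵍ v)
  local-identity = solve-∀ ℚ[i]-acr

  ∥negᵍ∥ : ∀ z → ∥ negᵍ z ∥ ≡ ∥ z ∥
  ∥negᵍ∥ z = cong₂ _+_ (∣-p∣≡∣p∣ (re z)) (∣-p∣≡∣p∣ (im z))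

  ∥∥-sub : ∀ x y → ∥ x +ᵍ negᵍ y ∥ ≤ ∥ x ∥ + ∥ y ∥
  ∥∥-sub x y = ≤-trans (∥∥-+ x (negᵍ y)) (≤-reflexive (cong (_+_ ∥ x ∥) (∥negᵍ∥ y)))

  2ℚ : ℚ
  2ℚ = 1ℚ + 1ℚ

  0≤2 : 0ℚ ≤ 2ℚ
  0≤2 = ι-nonneg 2

  local-error : ∀ v n → ∥ v ∥ ≤ 1ℚ → ∥ expᵍ (2 ℕ.+ n) v *ᵍ (1ᵍ +ᵍ negᵍ v) +ᵍ negᵍ 1ᵍ ∥ ≤ ι 3 * (∥ v ∥ * ∥ v ∥)
  local-error v n h = begin
    ∥ E *ᵍ w +ᵍ negᵍ 1ᵍ ∥                        ≡⟨ cong ∥_∥ (local-identity E v) ⟩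
    ∥ ρ *ᵍ w +ᵍ negᵍ (v *ᵍ v) ∥                  ≤⟨ ∥∥-sub (ρ *ᵍ w) (v *ᵍ v) ⟩
    ∥ ρ *ᵍ w ∥ + ∥ v *ᵍ v ∥                      ≤⟨ +-mono-≤ (≤-trans (∥∥-* ρ w) (*-mono (∥∥-nonneg w) 0≤¾a² (second v h n) w≤2)) (∥∥-* v v) ⟩
    -- The factor 1 - v has norm at most 2, so the constant is ¾ · 2 + 1 = 5/2, rounded up to 3.
    ¾ * a² * 2ℚ + a²                             ≡⟨ lem a² ⟩
    1½ * a² + 1ℚ * a²                            ≡⟨ sym (*-distribʳ-+ a² 1½ 1ℚ) ⟩
    (1½ + 1ℚ) * a²                               ≤⟨ *-monoʳ a² (SecondOrder.a²≥0 v h) (/-≤ 5 2 3 1 (ℕ.n≤1+n 5)) ⟩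
    ι 3 * a² ∎
    where
    open ≤-Reasoning
    a² = ∥ v ∥ * ∥ v ∥
    E = expᵍ (2 ℕ.+ n) v
    w = 1ᵍ +ᵍ negᵍ v
    ρ = E +ᵍ negᵍ (1ᵍ +ᵍ v)
    0≤¾a² : 0ℚ ≤ ¾ * a²
    0≤¾a² = *-nonneg {¾} {a²} (0≤/ 3 4) (SecondOrder.a²≥0 v h)
    w≤2 : ∥ w ∥ ≤ 2ℚ
    w≤2 = ≤-trans (∥∥-sub 1ᵍ v) (+-monoʳ-≤ 1ℚ h)
    lem : ∀ a → ¾ * a * 2ℚ + a ≡ 1½ * a + 1ℚ * a
    lem = solve-∀ ℚ-ring

  -- Radius 2 covers every argument below: the partial sums V k of the polygon steps, and iπ/2
  -- because π ≤ 4.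
  open ExpProduct 2ℚ 0≤2 using (M; 0<M; η; η-small; exp-error; exp-bound; exp-lipschitz)

  exp0 : ∀ n → expᵍ (suc n) 0ᵍ ≡ 1ᵍ
  exp0 zero    = refl
  exp0 (suc n) = trans (cong₂ _+ᵍ_ (exp0 n) (trans (cong ((1/ suc n !) ·ᵍ_) (G.zeroˡ (0ᵍ ^ᵍ n))) (ᵍ-ext (*-zeroʳ (1/ suc n !)) (*-zeroʳ (1/ suc n !)))))
    (G.+-identityʳ 1ᵍ)

  -- The polygon through the points N + σ k i (0 ≤ k ≤ N), scaled by 1/N: consecutive points
  -- have the ratio 1 + (k + σ N i)/(N² + k²), whose imaginary part is σ/4 times a summand of π-seq.
  module Arc (n : ℕ) (1≤n : 1 ℕ.≤ n) (σ : ℚ) (∣σ∣≡1 : ∣ σ ∣ ≡ 1ℚ) (σσ≡1 : σ * σ ≡ 1ℚ) where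

    N : ℕ
    N = suc n

    h : ℚ
    h = + 1 / N

    r : ℕ → ℚ
    r k = + 1 / (N ℕ.* N ℕ.+ k ℕ.* k)

    h-inv : h * ι N ≡ 1ℚ
    h-inv = 1/-ι N

    0≤h : 0ℚ ≤ h
    0≤h = 0≤/ 1 N

    0≤r : ∀ k → 0ℚ ≤ r k
    0≤r k = 0≤/ 1 (N ℕ.* N ℕ.+ k ℕ.* k)

    r-inv : ∀ k → r k * (ι N * ι N + ι k * ι k) ≡ 1ℚ
    r-inv k = trans (cong (r k *_) (sym (trans (ι-+ (N ℕ.* N) (k ℕ.* k)) (cong₂ _+_ (ι-* N N) (ι-* k k)))))
      (1/-ι (N ℕ.* N ℕ.+ k ℕ.* k))

    -- v k is minus the excess of the ratio over 1, and g k is the k-th point. The induction keeps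
    -- exp (V k) · g k near 1, so no division by g k is needed.
    v V g : ℕ → ℚ[i]
    v k = - (ι k * r k) +i - (σ * (ι N * r k))
    V zero    = 0ᵍ
    V (suc k) = V k +ᵍ v k
    g k = 1ℚ +i σ * (ι k * h)

    g-suc : ∀ k → g (suc k) ≡ g k *ᵍ (1ᵍ +ᵍ negᵍ (v k))
    g-suc k = ᵍ-ext
      (sym (trans (lem₁ σ (ι k) (r k) (ι N) h) (trans (cong₂ (λ s t → 1ℚ + ι k * r k * (1ℚ - s * t)) σσ≡1 h-inv) (lem₁′ (ι k * r k)))))
      (sym (trans (lem₂ σ (ι k) (r k) (ι N) h) (trans (cong₂ (λ s t → σ * (ι k * h + h * s + ι N * r k * (1ℚ - t))) (r-inv k) h-inv)
        (trans (lem₂′ σ (ι k) h (ι N * r k)) (cong (λ x → σ * (x * h)) (sym (ι-+ 1 k)))))))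
      where
      lem₁ : ∀ σ k r N h → 1ℚ * (1ℚ + - - (k * r)) - σ * (k * h) * (0ℚ + - - (σ * (N * r))) ≡ 1ℚ + k * r * (1ℚ - (σ * σ) * (h * N))
      lem₁ = solve-∀ ℚ-ring
      lem₁′ : ∀ x → 1ℚ + x * (1ℚ - 1ℚ * 1ℚ) ≡ 1ℚ
      lem₁′ = solve-∀ ℚ-ring
      lem₂ : ∀ σ k r N h → 1ℚ * (0ℚ + - - (σ * (N * r))) + σ * (k * h) * (1ℚ + - - (k * r))
             ≡ σ * (k * h + h * (r * (N * N + k * k)) + N * r * (1ℚ - h * N))
      lem₂ = solve-∀ ℚ-ring
      lem₂′ : ∀ σ k h x → σ * (k * h + h * 1ℚ + x * (1ℚ - 1ℚ)) ≡ σ * ((1ℚ + k) * h)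
      lem₂′ = solve-∀ ℚ-ring

    c : ℚ
    c = h + h

    Nr≤h : ∀ k → ι N * r k ≤ h
    Nr≤h k = begin
      ι N * r k                                    ≡⟨ sym (*-identityˡ (ι N * r k)) ⟩
      1ℚ * (ι N * r k)                             ≡⟨ cong (_* (ι N * r k)) (sym h-inv) ⟩
      h * ι N * (ι N * r k)                        ≡⟨ lem h (ι N) (r k) ⟩
      h * (r k * (ι N * ι N))                      ≤⟨ *-monoˡ h 0≤h (*-monoˡ (r k) (0≤r k) (p≤p+q (ι N * ι N) (*-nonneg (ι-nonneg k) (ι-nonneg k)))) ⟩
      h * (r k * (ι N * ι N + ι k * ι k))          ≡⟨ cong (h *_) (r-inv k) ⟩
      h * 1ℚ                                       ≡⟨ *-identityʳ h ⟩
      h ∎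
      where
      open ≤-Reasoning
      lem : ∀ h N r → h * N * (N * r) ≡ h * (r * (N * N))
      lem = solve-∀ ℚ-ring

    ∣σx∣ : ∀ x → 0ℚ ≤ x → ∣ σ * x ∣ ≡ x
    ∣σx∣ x 0≤x = trans (∣p*q∣≡∣p∣*∣q∣ σ x) (trans (cong₂ _*_ ∣σ∣≡1 (0≤p⇒∣p∣≡p 0≤x)) (*-identityˡ x))

    v≤c : ∀ k → k ℕ.≤ N → ∥ v k ∥ ≤ c
    v≤c k k≤N = ≤-trans (≤-reflexive (cong₂ _+_
        (trans (∣-p∣≡∣p∣ (ι k * r k)) (0≤p⇒∣p∣≡p (*-nonneg (ι-nonneg k) (0≤r k))))
        (trans (∣-p∣≡∣p∣ (σ * (ι N * r k))) (∣σx∣ (ι N * r k) (*-nonneg (ι-nonneg N) (0≤r k))))))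
      (+-mono-≤ (≤-trans (*-monoʳ (r k) (0≤r k) (ι-mono k≤N)) (Nr≤h k)) (Nr≤h k))

    0≤c : 0ℚ ≤ c
    0≤c = +-nonneg 0≤h 0≤h

    ι*c≤2 : ∀ {k} → k ℕ.≤ N → ι k * c ≤ 2ℚ
    ι*c≤2 {k} k≤N = ≤-trans (*-monoʳ c 0≤c (ι-mono k≤N)) (≤-reflexive (trans (lem (ι N) h) (cong₂ _+_ h-inv h-inv)))
      where
      lem : ∀ N h → N * (h + h) ≡ h * N + h * N
      lem = solve-∀ ℚ-ring

    V≤ : ∀ k → k ℕ.≤ N → ∥ V k ∥ ≤ ι k * c
    V≤ zero    _   = ≤-reflexive (sym (*-zeroˡ c))
    V≤ (suc k) k<N = ≤-trans (∥∥-+ (V k) (v k)) (≤-trans (+-mono-≤ (V≤ k (ℕ.<⇒≤ k<N)) (v≤c k (ℕ.<⇒≤ k<N)))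
      (≤-reflexive (sym (ι-suc* k c))))

    V≤2 : ∀ k → k ℕ.≤ N → ∥ V k ∥ ≤ 2ℚ
    V≤2 k k≤N = ≤-trans (V≤ k k≤N) (ι*c≤2 k≤N)

    -- N ≥ 2 makes every polygon step short enough for the second-order estimate.
    c≤1 : c ≤ 1ℚ
    c≤1 = ≤-trans (≤-reflexive (lem h)) (≤-trans (*-monoˡ h 0≤h (ι-mono {2} {N} (s≤s 1≤n))) (≤-reflexive h-inv))
      where
      lem : ∀ h → h + h ≡ h * ι 2
      lem = solve-∀ ℚ-ring

    v≤2 : ∀ k → k ℕ.≤ N → ∥ v k ∥ ≤ 2ℚ
    v≤2 k k≤N = ≤-trans (v≤c k k≤N) (≤-trans c≤1 (p≤p+q 1ℚ (<⇒≤ 0<1)))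

    g≤2 : ∀ k → k ℕ.≤ N → ∥ g k ∥ ≤ 2ℚ
    g≤2 k k≤N = +-monoʳ-≤ 1ℚ (≤-trans (≤-reflexive (∣σx∣ (ι k * h) (*-nonneg (ι-nonneg k) 0≤h)))
      (≤-trans (*-monoʳ h 0≤h (ι-mono k≤N)) (≤-reflexive (trans (*-comm (ι N) h) h-inv))))

    module _ (i′ : ℕ) where

      i : ℕ
      i = 2 ℕ.+ i′

      D : ℚ
      D = η i * 2ℚ + (M * 2ℚ) * (ι 3 * (c * c))

      0≤M : 0ℚ ≤ M
      0≤M = <⇒≤ 0<M

      0≤η : 0ℚ ≤ η i
      0≤η = ≤-trans (∥∥-nonneg (expᵍ i 0ᵍ *ᵍ expᵍ i 0ᵍ -ᵍ expᵍ i (0ᵍ +ᵍ 0ᵍ))) (exp-error 0ᵍ 0ᵍ 0≤2 0≤2 i)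

      -- Errors add up, at most D per step. With c = 2/N the total N D is 2N η i + 24M/N: the second
      -- term vanishes as N grows, the first as i grows for fixed N.
      drift : ∀ k → k ℕ.≤ N → ∥ expᵍ i (V k) *ᵍ g k +ᵍ negᵍ 1ᵍ ∥ ≤ ι k * D
      drift zero    _   = ≤-reflexive (trans (cong (λ z → ∥ z +ᵍ negᵍ 1ᵍ ∥) (trans (cong₂ _*ᵍ_ (exp0 (suc i′)) g0) refl)) (sym (*-zeroˡ D)))
        where
        g0 : g 0 ≡ 1ᵍ
        g0 = ᵍ-ext refl (trans (cong (σ *_) (*-zeroˡ h)) (*-zeroʳ σ))
      drift (suc k) k<N = begin
        ∥ w *ᵍ g (suc k) +ᵍ negᵍ 1ᵍ ∥                               ≡⟨ cong (λ z → ∥ w *ᵍ z +ᵍ negᵍ 1ᵍ ∥) (g-suc k) ⟩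
        ∥ w *ᵍ (g k *ᵍ u) +ᵍ negᵍ 1ᵍ ∥                              ≡⟨ cong ∥_∥ (step-identity w x y (g k) u) ⟩
        ∥ (p *ᵍ (g k *ᵍ u) +ᵍ (x *ᵍ g k) *ᵍ l) +ᵍ d ∥               ≤⟨ ≤-trans (∥∥-+ (p *ᵍ (g k *ᵍ u) +ᵍ (x *ᵍ g k) *ᵍ l) d) (+-monoˡ-≤ ∥ d ∥ (∥∥-+ (p *ᵍ (g k *ᵍ u)) ((x *ᵍ g k) *ᵍ l))) ⟩
        ∥ p *ᵍ (g k *ᵍ u) ∥ + ∥ (x *ᵍ g k) *ᵍ l ∥ + ∥ d ∥           ≤⟨ +-mono-≤ (+-mono-≤ first second₀) (drift k (ℕ.<⇒≤ k<N)) ⟩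
        D + ι k * D                                                 ≡⟨ +-comm D (ι k * D) ⟩
        ι k * D + D                                                 ≡⟨ sym (ι-suc* k D) ⟩
        ι (suc k) * D ∎
        where
        open ≤-Reasoning
        k≤N = ℕ.<⇒≤ k<N
        w = expᵍ i (V k +ᵍ v k)
        x = expᵍ i (V k)
        y = expᵍ i (v k)
        u = 1ᵍ +ᵍ negᵍ (v k)
        p = w +ᵍ negᵍ (x *ᵍ y)
        l = y *ᵍ u +ᵍ negᵍ 1ᵍ
        d = x *ᵍ g k +ᵍ negᵍ 1ᵍ
        p≤η : ∥ p ∥ ≤ η i
        p≤η = ≤-trans (≤-reflexive (∥∥-sym w (x *ᵍ y))) (exp-error (V k) (v k) (V≤2 k k≤N) (v≤2 k k≤N) i)
        gu≤2 : ∥ g k *ᵍ u ∥ ≤ 2ℚ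
        gu≤2 = ≤-trans (≤-reflexive (cong ∥_∥ (sym (g-suc k)))) (g≤2 (suc k) k<N)
        first : ∥ p *ᵍ (g k *ᵍ u) ∥ ≤ η i * 2ℚ
        first = ≤-trans (∥∥-* p (g k *ᵍ u)) (*-mono (∥∥-nonneg (g k *ᵍ u)) 0≤η p≤η gu≤2)
        l≤ : ∥ l ∥ ≤ ι 3 * (c * c)
        l≤ = ≤-trans (local-error (v k) i′ (≤-trans (v≤c k k≤N) c≤1))
          (*-monoˡ (ι 3) (ι-nonneg 3) (*-mono (∥∥-nonneg (v k)) 0≤c (v≤c k k≤N) (v≤c k k≤N)))
        xg≤ : ∥ x *ᵍ g k ∥ ≤ M * 2ℚ
        xg≤ = ≤-trans (∥∥-* x (g k)) (*-mono (∥∥-nonneg (g k)) 0≤M (exp-bound (V k) (V≤2 k k≤N) i) (g≤2 k k≤N))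
        second₀ : ∥ (x *ᵍ g k) *ᵍ l ∥ ≤ (M * 2ℚ) * (ι 3 * (c * c))
        second₀ = ≤-trans (∥∥-* (x *ᵍ g k) l) (*-mono (∥∥-nonneg l) (*-nonneg {M} {2ℚ} 0≤M 0≤2) xg≤ l≤)

      drift-N : ∥ expᵍ i (V N) *ᵍ (1ℚ +i σ) +ᵍ negᵍ 1ᵍ ∥ ≤ ι N * D
      drift-N = ≤-trans (≤-reflexive (cong (λ z → ∥ expᵍ i (V N) *ᵍ z +ᵍ negᵍ 1ᵍ ∥) (sym gN))) (drift N ℕ.≤-refl)
        where
        gN : g N ≡ (1ℚ +i σ)
        gN = ᵍ-ext refl (trans (cong (σ *_) (trans (*-comm (ι N) h) h-inv)) (*-identityʳ σ))

  1+i 1-i iᵍ : ℚ[i]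
  1+i = 1ℚ +i 1ℚ
  1-i = 1ℚ +i - 1ℚ
  iᵍ  = 0ℚ +i 1ℚ

  quarter : ℕ → ℚ[i]
  quarter j = 0ℚ +i ½ * π-seq j

  module Quarter (n : ℕ) (1≤n : 1 ℕ.≤ n) where

    private
      module P = Arc n 1≤n 1ℚ refl refl
      module Q = Arc n 1≤n (- 1ℚ) refl refl
    open P using (N; h; h-inv)

    π-term≡ : ∀ k → π-term n k ≡ ι 4 * (ι N * P.r k)
    π-term≡ k = sym (trans (cong (ι 4 *_) (trans (cong (_* P.r k) (ι-≡ N)) (/-* N 1 1 d)))
      (trans (cong (_* (+ (N ℕ.* 1) / (1 ℕ.* d))) (ι-≡ 4)) (trans (/-* 4 1 (N ℕ.* 1) (1 ℕ.* d))
      (/-≡ (4 ℕ.* (N ℕ.* 1)) (1 ℕ.* (1 ℕ.* d)) (4 ℕ.* N) d (lem N d)))))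
      where
      d = N ℕ.* N ℕ.+ k ℕ.* k
      lem : ∀ N d → (4 ℕ.* (N ℕ.* 1)) ℕ.* d ≡ (4 ℕ.* N) ℕ.* (1 ℕ.* (1 ℕ.* d))
      lem = ℕ-Solver.solve-∀

    -- The two polygons are conjugate, so the real parts of their steps cancel and the imaginary
    -- parts double. What remains is exactly i/2 times the Riemann sum, with no error term.
    V-V : ∀ k → Q.V k +ᵍ negᵍ (P.V k) ≡ (0ℚ +i ½ * Real.Σ< k (π-term n))
    V-V zero    = refl
    V-V (suc k) = trans (interchange (Q.V k) (Q.v k) (P.V k) (P.v k))
      (trans (cong (_+ᵍ (Q.v k +ᵍ negᵍ (P.v k))) (V-V k))
      (ᵍ-ext (lem₁ (ι k * P.r k)) (trans (lem₂ (Real.Σ< k (π-term n)) (ι N * P.r k)) (cong (λ x → ½ * (Real.Σ< k (π-term n) + x)) (sym (π-term≡ k))))))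
      where
      interchange : ∀ a b c d → (a +ᵍ b) +ᵍ negᵍ (c +ᵍ d) ≡ (a +ᵍ negᵍ c) +ᵍ (b +ᵍ negᵍ d)
      interchange = solve-∀ ℚ[i]-acr
      lem₁ : ∀ x → 0ℚ + (- x + - - x) ≡ 0ℚ
      lem₁ = solve-∀ ℚ-ring
      lem₂ : ∀ s x → ½ * s + (- (- 1ℚ * x) + - - (1ℚ * x)) ≡ ½ * (s + ι 4 * x)
      lem₂ = solve-∀ ℚ-ring

    module _ (i′ : ℕ) where

      i : ℕ
      i = 2 ℕ.+ i′

      D : ℚ
      D = P.D i′

      -- Leads from a m to p through x u m, u and u y p, one error at a time; here x, y, u, a
      -- approximate the exponentials of X, Y, -Y, X - Y, while m = 1 - i and p = 1 + i.
      combine : ∀ a x y u m p → a *ᵍ m +ᵍ negᵍ p ≡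
        (((a +ᵍ negᵍ (x *ᵍ u)) *ᵍ m +ᵍ u *ᵍ (x *ᵍ m +ᵍ negᵍ 1ᵍ)) +ᵍ negᵍ (u *ᵍ (y *ᵍ p +ᵍ negᵍ 1ᵍ))) +ᵍ (u *ᵍ y +ᵍ negᵍ 1ᵍ) *ᵍ p
      combine = solve-∀ ℚ[i]-acr

      X Y U : ℚ[i]
      X = Q.V N
      Y = P.V N
      U = negᵍ Y

      U≤2 : ∥ U ∥ ≤ 2ℚ
      U≤2 = ≤-trans (≤-reflexive (∥negᵍ∥ Y)) (P.V≤2 N ℕ.≤-refl)

      X≤2 : ∥ X ∥ ≤ 2ℚ
      X≤2 = Q.V≤2 N ℕ.≤-refl

      eA eX eY eU : ℚ[i]
      eA = expᵍ i (X +ᵍ U)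
      eX = expᵍ i X
      eY = expᵍ i Y
      eU = expᵍ i U

      0≤η : 0ℚ ≤ η i
      0≤η = P.0≤η i′

      0≤M : 0ℚ ≤ M
      0≤M = <⇒≤ 0<M

      t₁ : ∥ (eA +ᵍ negᵍ (eX *ᵍ eU)) *ᵍ 1-i ∥ ≤ η i * 2ℚ
      t₁ = ≤-trans (∥∥-* (eA +ᵍ negᵍ (eX *ᵍ eU)) 1-i) (*-monoʳ 2ℚ 0≤2
        (≤-trans (≤-reflexive (∥∥-sym eA (eX *ᵍ eU))) (exp-error X U X≤2 U≤2 i)))

      t₂ : ∥ eU *ᵍ (eX *ᵍ 1-i +ᵍ negᵍ 1ᵍ) ∥ ≤ M * (ι N * D)
      t₂ = ≤-trans (∥∥-* eU (eX *ᵍ 1-i +ᵍ negᵍ 1ᵍ)) (*-mono (∥∥-nonneg (eX *ᵍ 1-i +ᵍ negᵍ 1ᵍ)) 0≤M (exp-bound U U≤2 i) (Q.drift-N i′))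

      t₃ : ∥ negᵍ (eU *ᵍ (eY *ᵍ 1+i +ᵍ negᵍ 1ᵍ)) ∥ ≤ M * (ι N * D)
      t₃ = ≤-trans (≤-reflexive (∥negᵍ∥ (eU *ᵍ (eY *ᵍ 1+i +ᵍ negᵍ 1ᵍ)))) (≤-trans (∥∥-* eU (eY *ᵍ 1+i +ᵍ negᵍ 1ᵍ))
        (*-mono (∥∥-nonneg (eY *ᵍ 1+i +ᵍ negᵍ 1ᵍ)) 0≤M (exp-bound U U≤2 i) (P.drift-N i′)))

      t₄ : ∥ (eU *ᵍ eY +ᵍ negᵍ 1ᵍ) *ᵍ 1+i ∥ ≤ η i * 2ℚ
      t₄ = ≤-trans (∥∥-* (eU *ᵍ eY +ᵍ negᵍ 1ᵍ) 1+i) (*-monoʳ 2ℚ 0≤2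
        (≤-trans (≤-reflexive (cong (λ z → ∥ eU *ᵍ eY +ᵍ negᵍ z ∥) (sym (trans (cong (expᵍ i) (G.-‿inverseˡ Y)) (exp0 (suc i′))))))
          (exp-error U Y U≤2 (P.V≤2 N ℕ.≤-refl) i)))

      bound₁ : ∥ eA *ᵍ 1-i +ᵍ negᵍ 1+i ∥ ≤ ((η i * 2ℚ + M * (ι N * D)) + M * (ι N * D)) + η i * 2ℚ
      bound₁ = ≤-trans (≤-reflexive (cong ∥_∥ (combine eA eX eY eU 1-i 1+i)))
        (≤-trans (∥∥-+ ((a₁ +ᵍ a₂) +ᵍ a₃) a₄) (+-mono-≤ (≤-trans (∥∥-+ (a₁ +ᵍ a₂) a₃) (+-mono-≤ (≤-trans (∥∥-+ a₁ a₂) (+-mono-≤ t₁ t₂)) t₃)) t₄))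
        where
        a₁ = (eA +ᵍ negᵍ (eX *ᵍ eU)) *ᵍ 1-i
        a₂ = eU *ᵍ (eX *ᵍ 1-i +ᵍ negᵍ 1ᵍ)
        a₃ = negᵍ (eU *ᵍ (eY *ᵍ 1+i +ᵍ negᵍ 1ᵍ))
        a₄ = (eU *ᵍ eY +ᵍ negᵍ 1ᵍ) *ᵍ 1+i

      -- N D = 2N η + 24M/N enters twice with the factor M, and η · 2 twice from the addition
      -- theorem.
      total : ℚ
      total = (ι 4 + ι 4 * (M * ι N)) * η i + ι 48 * (M * M) * h

      bound₂ : ((η i * 2ℚ + M * (ι N * D)) + M * (ι N * D)) + η i * 2ℚ ≡ total
      bound₂ = trans (lem₁ (η i) M (ι N) h) (trans (cong (λ t → (ι 4 + ι 4 * (M * ι N)) * η i + ι 48 * (M * M) * (h * t)) h-inv)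
        (cong (λ x → (ι 4 + ι 4 * (M * ι N)) * η i + ι 48 * (M * M) * x) (*-identityʳ h)))
        where
        lem₁ : ∀ e M N h → ((e * 2ℚ + M * (N * (e * 2ℚ + (M * 2ℚ) * (ι 3 * ((h + h) * (h + h))))))
                         + M * (N * (e * 2ℚ + (M * 2ℚ) * (ι 3 * ((h + h) * (h + h)))))) + e * 2ℚ
               ≡ (ι 4 + ι 4 * (M * N)) * e + ι 48 * (M * M) * (h * (h * N))
        lem₁ = solve-∀ ℚ-ring

      -- ½ + ½i is the inverse of 1 - i and has ℓ¹ norm 1, so the division costs nothing in the
      -- bound.
      to-i : ∀ a → a +ᵍ negᵍ iᵍ ≡ (a *ᵍ 1-i +ᵍ negᵍ 1+i) *ᵍ (½ +i ½)
      to-i a = ᵍ-ext (lem₁ (re a) (im a)) (lem₂ (re a) (im a))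
        where
        lem₁ : ∀ x y → x + - 0ℚ ≡ ((x * 1ℚ - y * - 1ℚ) + - 1ℚ) * ½ - ((x * - 1ℚ + y * 1ℚ) + - 1ℚ) * ½
        lem₁ = solve-∀ ℚ-ring
        lem₂ : ∀ x y → y + - 1ℚ ≡ ((x * 1ℚ - y * - 1ℚ) + - 1ℚ) * ½ + ((x * - 1ℚ + y * 1ℚ) + - 1ℚ) * ½
        lem₂ = solve-∀ ℚ-ring

      bound₃ : ∥ expᵍ i (quarter n) +ᵍ negᵍ iᵍ ∥ ≤ total
      bound₃ = ≤-trans (≤-reflexive (cong (λ z → ∥ expᵍ i z +ᵍ negᵍ iᵍ ∥) (sym (V-V N))))
        (≤-trans (≤-reflexive (cong ∥_∥ (to-i eA))) (≤-trans (∥∥-* (eA *ᵍ 1-i +ᵍ negᵍ 1+i) (½ +i ½))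
        (≤-trans (≤-reflexive (*-identityʳ ∥ eA *ᵍ 1-i +ᵍ negᵍ 1+i ∥)) (≤-trans bound₁ (≤-reflexive bound₂)))))

  ∥imag∥ : ∀ x y → ∥ (0ℚ +i x) -ᵍ (0ℚ +i y) ∥ ≡ ∣ x - y ∣
  ∥imag∥ x y = +-identityˡ ∣ x - y ∣

  quarter≤2 : ∀ j → ∥ quarter j ∥ ≤ 2ℚ
  quarter≤2 j = ≤-trans (≤-reflexive (trans (+-identityˡ ∣ ½ * π-seq j ∣) (0≤p⇒∣p∣≡p (*-nonneg (<⇒≤ 0<½) (≤-trans (ι-nonneg 2) (2≤π j))))))
    (*-monoˡ ½ (<⇒≤ 0<½) (π≤4 j))

  quarter-close : ∀ i j → ∥ quarter i -ᵍ quarter j ∥ ≤ ∣ π-seq i - π-seq j ∣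
  quarter-close i j = begin
    ∥ quarter i -ᵍ quarter j ∥         ≡⟨ ∥imag∥ (½ * π-seq i) (½ * π-seq j) ⟩
    ∣ ½ * π-seq i - ½ * π-seq j ∣      ≡⟨ cong ∣_∣ (lem (π-seq i) (π-seq j)) ⟩
    ∣ ½ * (π-seq i - π-seq j) ∣        ≡⟨ ∣p*q∣≡∣p∣*∣q∣ ½ (π-seq i - π-seq j) ⟩
    ½ * ∣ π-seq i - π-seq j ∣          ≤⟨ p≤p+q (½ * ∣ π-seq i - π-seq j ∣) (*-nonneg (<⇒≤ 0<½) (0≤∣p∣ (π-seq i - π-seq j))) ⟩
    ½ * ∣ π-seq i - π-seq j ∣ + ½ * ∣ π-seq i - π-seq j ∣ ≡⟨ ½+½ ∣ π-seq i - π-seq j ∣ ⟩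
    ∣ π-seq i - π-seq j ∣ ∎
    where
    open ≤-Reasoning
    lem : ∀ x y → ½ * x - ½ * y ≡ ½ * (x - y)
    lem = solve-∀ ℚ-ring

  48M² : ℚ
  48M² = ι 48 * (M * M)

  0<48M² : 0ℚ < 48M²
  0<48M² = *-pos {ι 48} {M * M} (*<* (ℤ.+<+ (s≤s z≤n))) (*-pos {M} {M} 0<M 0<M)

  -- The mesh n of the polygon is kept apart from the diagonal index i, since η i carries a factor
  -- that grows with n. The first term pays for replacing the i-th approximation of π by the n-th.
  exp-quarter-bound : ∀ n (1≤n : 1 ℕ.≤ n) i → 2 ℕ.≤ i →
    ∥ expᵍ i (quarter i) -ᵍ iᵍ ∥ ≤ (M * ∣ π-seq i - π-seq n ∣ + 48M² * (+ 1 / suc n)) + (ι 4 + ι 4 * (M * ι (suc n))) * η i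
  exp-quarter-bound n 1≤n i@(suc (suc i′)) (s≤s (s≤s z≤n)) = begin
    ∥ expᵍ i (quarter i) -ᵍ iᵍ ∥
      ≤⟨ ∥∥-tri (expᵍ i (quarter i)) (expᵍ i (quarter n)) iᵍ ⟩
    ∥ expᵍ i (quarter i) -ᵍ expᵍ i (quarter n) ∥ + ∥ expᵍ i (quarter n) -ᵍ iᵍ ∥
      ≤⟨ +-mono-≤ (≤-trans (exp-lipschitz (quarter i) (quarter n) (quarter≤2 i) (quarter≤2 n) i) (*-monoˡ M (<⇒≤ 0<M) (quarter-close i n)))
                  (Quarter.bound₃ n 1≤n i′) ⟩
    M * ∣ π-seq i - π-seq n ∣ + (K₀ * η i + 48M² * (+ 1 / suc n))
      ≡⟨ lem (M * ∣ π-seq i - π-seq n ∣) (K₀ * η i) (48M² * (+ 1 / suc n)) ⟩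
    (M * ∣ π-seq i - π-seq n ∣ + 48M² * (+ 1 / suc n)) + K₀ * η i ∎
    where
    open ≤-Reasoning
    K₀ = ι 4 + ι 4 * (M * ι (suc n))
    lem : ∀ a b c → a + (b + c) ≡ (a + c) + b
    lem = solve-∀ ℚ-ring

  mesh-error : ℕ → ℕ → ℚ
  mesh-error i j = M * ∣ π-seq i - π-seq j ∣ + 48M² * (+ 1 / suc i + + 1 / suc j)

  mesh-error-small : Small mesh-error
  mesh-error-small = Small-+ {λ i j → M * ∣ π-seq i - π-seq j ∣} {λ i j → 48M² * (+ 1 / suc i + + 1 / suc j)}
    (Small-* {λ i j → ∣ π-seq i - π-seq j ∣} M 0<M (cauchy π)) (Small-* {λ i j → + 1 / suc i + + 1 / suc j} 48M² 0<48M² Small-recip)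

  η-factor : ℕ → ℚ
  η-factor n = ι 4 + ι 4 * (M * ι (suc n))

  0<η-factor : ∀ n → 0ℚ < η-factor n
  0<η-factor n = <-≤-trans {0ℚ} {ι 4} (*<* (ℤ.+<+ (s≤s z≤n)))
    (p≤p+q (ι 4) (*-nonneg {ι 4} {M * ι (suc n)} (ι-nonneg 4) (*-nonneg {M} {ι (suc n)} (<⇒≤ 0<M) (ι-nonneg (suc n)))))

  exp-quarter-bound′ : ∀ n (1≤n : 1 ℕ.≤ n) i → 2 ℕ.≤ i → ∥ expᵍ i (quarter i) -ᵍ iᵍ ∥ ≤ mesh-error i n + η-factor n * η i
  exp-quarter-bound′ n 1≤n i 2≤i = ≤-trans (exp-quarter-bound n 1≤n i 2≤i)
    (+-monoˡ-≤ (η-factor n * η i) (+-monoʳ-≤ (M * ∣ π-seq i - π-seq n ∣) (*-monoˡ 48M² (<⇒≤ 0<48M²) (p≤q+p (+ 1 / suc n) (0≤/ 1 (suc i))))))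

  -- Choose n first, then the index i.
  Small-iterated : ∀ {f e : ℕ → ℚ} {d : ℕ → ℕ → ℚ} (k : ℕ → ℚ) → (∀ n → 0ℚ < k n) →
    (∀ n → 1 ℕ.≤ n → ∀ i → 2 ℕ.≤ i → f i ≤ d i n + k n * e i) →
    Small d → Small (λ i _ → e i) → Small (λ i _ → f i)
  Small-iterated {f} {e} {d} k 0<k h d-small e-small ε 0<ε = 2 ℕ.⊔ (n ℕ.⊔ N₂) , λ i _ p _ →
    let q   = ℕ.m⊔n≤o⇒n≤o 2 (n ℕ.⊔ N₂) p
        n≤i = ℕ.m⊔n≤o⇒m≤o n N₂ q
        N≤i = ℕ.m⊔n≤o⇒n≤o n N₂ q
    in ≤-<-trans (h n (s≤s z≤n) i (ℕ.m⊔n≤o⇒m≤o 2 (n ℕ.⊔ N₂) p))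
      (<-≤-trans (+-mono-< (close i n≤i) (proj₂ S₂ i i N≤i N≤i)) (≤-reflexive (½+½ ε)))
    where
    S₁ : ∃ λ N → ∀ i j → N ℕ.≤ i → N ℕ.≤ j → d i j < ½ * ε
    S₁ = d-small (½ * ε) (*-pos 0<½ 0<ε)
    n = suc (proj₁ S₁)
    S₂ : ∃ λ N → ∀ i j → N ℕ.≤ i → N ℕ.≤ j → k n * e i < ½ * ε
    S₂ = Small-* {λ i _ → e i} (k n) (0<k n) e-small (½ * ε) (*-pos 0<½ 0<ε)
    N₂ = proj₁ S₂
    close : ∀ i → n ℕ.≤ i → d i n < ½ * ε
    close i n≤i = proj₂ S₁ i n (ℕ.≤-trans (ℕ.n≤1+n (proj₁ S₁)) n≤i) (ℕ.n≤1+n (proj₁ S₁))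

  exp-quarter : Small (λ i _ → ∥ expᵍ i (quarter i) -ᵍ iᵍ ∥)
  exp-quarter = Small-iterated {λ i → ∥ expᵍ i (quarter i) -ᵍ iᵍ ∥} {η} {mesh-error} η-factor 0<η-factor exp-quarter-bound′ mesh-error-small η-small

  -- Powers of e^{2πi/n}

  /1-+ : ∀ a b → (a ℤ.+ b) / 1 ≡ a / 1 + b / 1
  /1-+ a b = toℚᵘ-injective (begin
    toℚᵘ (fromℚᵘ (ℚᵘ.mkℚᵘ (a ℤ.+ b) 0))   ≈⟨ toℚᵘ-fromℚᵘ (ℚᵘ.mkℚᵘ (a ℤ.+ b) 0) ⟩
    ℚᵘ.mkℚᵘ (a ℤ.+ b) 0                   ≡⟨ cong (λ z → ℚᵘ.mkℚᵘ z 0) (sym (cong₂ ℤ._+_ (ℤ.*-identityʳ a) (ℤ.*-identityʳ b))) ⟩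
    ℚᵘ.mkℚᵘ a 0 ℚᵘ.+ ℚᵘ.mkℚᵘ b 0          ≈⟨ ℚᵘ.+-cong (ℚᵘ.≃-sym (toℚᵘ-fromℚᵘ (ℚᵘ.mkℚᵘ a 0))) (ℚᵘ.≃-sym (toℚᵘ-fromℚᵘ (ℚᵘ.mkℚᵘ b 0))) ⟩
    toℚᵘ (a / 1) ℚᵘ.+ toℚᵘ (b / 1)        ≈⟨ ℚᵘ.≃-sym (toℚᵘ-homo-+ (a / 1) (b / 1)) ⟩
    toℚᵘ (a / 1 + b / 1) ∎)
    where open ℚᵘ.≃-Reasoning

  /1-* : ∀ a b → (a ℤ.* b) / 1 ≡ (a / 1) * (b / 1)
  /1-* a b = toℚᵘ-injective (begin
    toℚᵘ (fromℚᵘ (ℚᵘ.mkℚᵘ (a ℤ.* b) 0))   ≈⟨ toℚᵘ-fromℚᵘ (ℚᵘ.mkℚᵘ (a ℤ.* b) 0) ⟩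
    ℚᵘ.mkℚᵘ a 0 ℚᵘ.* ℚᵘ.mkℚᵘ b 0          ≈⟨ ℚᵘ.*-cong (ℚᵘ.≃-sym (toℚᵘ-fromℚᵘ (ℚᵘ.mkℚᵘ a 0))) (ℚᵘ.≃-sym (toℚᵘ-fromℚᵘ (ℚᵘ.mkℚᵘ b 0))) ⟩
    toℚᵘ (a / 1) ℚᵘ.* toℚᵘ (b / 1)        ≈⟨ ℚᵘ.≃-sym (toℚᵘ-homo-* (a / 1) (b / 1)) ⟩
    toℚᵘ ((a / 1) * (b / 1)) ∎)
    where open ℚᵘ.≃-Reasoning

  real+ : ∀ p q → (p +i 0ℚ) +ᵍ (q +i 0ℚ) ≡ (p + q +i 0ℚ)
  real+ p q = refl

  real* : ∀ p q → (p +i 0ℚ) *ᵍ (q +i 0ℚ) ≡ (p * q +i 0ℚ)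
  real* p q = trans (real-* p (q +i 0ℚ)) (cong (λ x → p * q +i x) (*-zeroʳ p))

  approx-fromℤᶜ : ∀ a i → approx (fromℤᶜ a) i ≡ (a / 1 +i 0ℚ)
  approx-fromℤᶜ a i = refl

  fromℤᶜ-+ : ∀ a b → fromℤᶜ (a ℤ.+ b) ≋ fromℤᶜ a ⊕ fromℤᶜ b
  fromℤᶜ-+ a b = ptw (fromℤᶜ (a ℤ.+ b)) (fromℤᶜ a ⊕ fromℤᶜ b) λ i →
    trans (approx-fromℤᶜ (a ℤ.+ b) i) (trans (cong (_+i 0ℚ) (/1-+ a b)) (trans (sym (real+ (a / 1) (b / 1)))
    (sym (trans (approx-+ (fromℤᶜ a) (fromℤᶜ b) i) (cong₂ _+ᵍ_ (approx-fromℤᶜ a i) (approx-fromℤᶜ b i))))))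

  fromℤᶜ-* : ∀ a b → fromℤᶜ (a ℤ.* b) ≋ fromℤᶜ a ⊗ fromℤᶜ b
  fromℤᶜ-* a b = ptw (fromℤᶜ (a ℤ.* b)) (fromℤᶜ a ⊗ fromℤᶜ b) λ i →
    trans (approx-fromℤᶜ (a ℤ.* b) i) (trans (cong (_+i 0ℚ) (/1-* a b)) (trans (sym (real* (a / 1) (b / 1)))
    (sym (trans (approx-* (fromℤᶜ a) (fromℤᶜ b) i) (cong₂ _*ᵍ_ (approx-fromℤᶜ a i) (approx-fromℤᶜ b i))))))

  abstract
    cis : ℚ → ℂ
    cis r = exp (fromℤᶜ (+ 2) *ᶜ fromℝ π *ᶜ fromℚᶜ r *ᶜ 𝐢)

    cis≡ : ∀ r → cis r ≡ exp (fromℤᶜ (+ 2) *ᶜ fromℝ π *ᶜ fromℚᶜ r *ᶜ 𝐢)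
    cis≡ r = refl

  approx-*ᶜ : ∀ x y i → approx (x *ᶜ y) i ≡ approx x i *ᵍ approx y i
  approx-*ᶜ x y i = refl

  approx-arg : ∀ r j → approx (fromℤᶜ (+ 2) *ᶜ fromℝ π *ᶜ fromℚᶜ r *ᶜ 𝐢) j ≡ (0ℚ +i (+ 2 / 1) * π-seq j * r)
  approx-arg r j = trans (approx-*ᶜ (fromℤᶜ (+ 2) *ᶜ fromℝ π *ᶜ fromℚᶜ r) 𝐢 j)
    (trans (cong (_*ᵍ (0ℚ +i 1ℚ)) (trans (approx-*ᶜ (fromℤᶜ (+ 2) *ᶜ fromℝ π) (fromℚᶜ r) j)
      (trans (cong (_*ᵍ (r +i 0ℚ)) (trans (approx-*ᶜ (fromℤᶜ (+ 2)) (fromℝ π) j)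
        (real* (+ 2 / 1) (π-seq j)))) (real* ((+ 2 / 1) * π-seq j) r))))
    (times-i ((+ 2 / 1) * π-seq j * r)))
    where
    lem₁ : ∀ x → x * 0ℚ - 0ℚ * 1ℚ ≡ 0ℚ
    lem₁ = solve-∀ ℚ-ring
    lem₂ : ∀ x → x * 1ℚ + 0ℚ * 0ℚ ≡ x
    lem₂ = solve-∀ ℚ-ring
    times-i : ∀ x → (x +i 0ℚ) *ᵍ (0ℚ +i 1ℚ) ≡ (0ℚ +i x)
    times-i x = ᵍ-ext (lem₁ x) (lem₂ x)

  approx-cis : ∀ r j → approx (cis r) j ≡ expᵍ j (0ℚ +i (+ 2 / 1) * π-seq j * r)
  approx-cis r j = trans (cong (λ z → approx z j) (cis≡ r)) (trans (approx-exp (fromℤᶜ (+ 2) *ᶜ fromℝ π *ᶜ fromℚᶜ r *ᶜ 𝐢) j) (cong (expᵍ j) (approx-arg r j)))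
    where
    approx-exp : ∀ z j → approx (exp z) j ≡ expᵍ j (approx z j)
    approx-exp z j = refl

  imag+ : ∀ x y → (0ℚ +i x) +ᵍ (0ℚ +i y) ≡ (0ℚ +i x + y)
  imag+ x y = refl

  arg-+ : ∀ r s → (fromℤᶜ (+ 2) *ᶜ fromℝ π *ᶜ fromℚᶜ (r + s) *ᶜ 𝐢) ≋ (fromℤᶜ (+ 2) *ᶜ fromℝ π *ᶜ fromℚᶜ r *ᶜ 𝐢) ⊕ (fromℤᶜ (+ 2) *ᶜ fromℝ π *ᶜ fromℚᶜ s *ᶜ 𝐢)
  arg-+ r s = ptw (fromℤᶜ (+ 2) *ᶜ fromℝ π *ᶜ fromℚᶜ (r + s) *ᶜ 𝐢) ((fromℤᶜ (+ 2) *ᶜ fromℝ π *ᶜ fromℚᶜ r *ᶜ 𝐢) ⊕ (fromℤᶜ (+ 2) *ᶜ fromℝ π *ᶜ fromℚᶜ s *ᶜ 𝐢)) λ j →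
    trans (approx-arg (r + s) j) (trans (cong (0ℚ +i_) (*-distribˡ-+ ((+ 2 / 1) * π-seq j) r s))
    (trans (sym (imag+ ((+ 2 / 1) * π-seq j * r) ((+ 2 / 1) * π-seq j * s)))
    (sym (trans (approx-+ (fromℤᶜ (+ 2) *ᶜ fromℝ π *ᶜ fromℚᶜ r *ᶜ 𝐢) (fromℤᶜ (+ 2) *ᶜ fromℝ π *ᶜ fromℚᶜ s *ᶜ 𝐢) j) (cong₂ _+ᵍ_ (approx-arg r j) (approx-arg s j))))))

  exp-sum : ∀ z u v → z ≋ u ⊕ v → exp z ≋ exp u ⊗ exp v
  exp-sum z u v h = ≋-trans {exp z} {exp (u ⊕ v)} {exp u ⊗ exp v} (exp-cong {z} {u ⊕ v} h) (exp-+ u v)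

  replace-product : ∀ a a′ b b′ c c′ → a′ ≡ a → b′ ≡ b → c′ ≡ c → a ≋ b ⊗ c → a′ ≋ b′ ⊗ c′
  replace-product a .a b .b c .c refl refl refl h = h

  cis-+ : ∀ r s → cis (r + s) ≋ cis r ⊗ cis s
  cis-+ r s = replace-product (exp (fromℤᶜ (+ 2) *ᶜ fromℝ π *ᶜ fromℚᶜ (r + s) *ᶜ 𝐢)) (cis (r + s)) (exp (fromℤᶜ (+ 2) *ᶜ fromℝ π *ᶜ fromℚᶜ r *ᶜ 𝐢)) (cis r) (exp (fromℤᶜ (+ 2) *ᶜ fromℝ π *ᶜ fromℚᶜ s *ᶜ 𝐢)) (cis s)
    (cis≡ (r + s)) (cis≡ r) (cis≡ s) (exp-sum (fromℤᶜ (+ 2) *ᶜ fromℝ π *ᶜ fromℚᶜ (r + s) *ᶜ 𝐢) (fromℤᶜ (+ 2) *ᶜ fromℝ π *ᶜ fromℚᶜ r *ᶜ 𝐢) (fromℤᶜ (+ 2) *ᶜ fromℝ π *ᶜ fromℚᶜ s *ᶜ 𝐢) (arg-+ r s))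

  eventually : ∀ z w N → (∀ i → N ℕ.≤ i → approx z i ≡ approx w i) → z ≋ w
  eventually z w N h = mk≋ λ ε 0<ε → N , λ i _ p _ →
    ≤-<-trans (≤-reflexive (trans (cong (λ x → ∥ x -ᵍ approx w i ∥) (h i p)) (∥z-z∥ (approx w i)))) 0<ε

  cis-0 : cis 0ℚ ≋ fromℤᶜ 1ℤ
  -- Equality starts at index 1, because the partial sum without terms is 0.
  cis-0 = eventually (cis 0ℚ) (fromℤᶜ 1ℤ) 1 λ { (suc j) _ → trans (approx-cis 0ℚ (suc j))
    (trans (cong (expᵍ (suc j)) (cong (0ℚ +i_) (*-zeroʳ ((+ 2 / 1) * π-seq (suc j))))) (trans (exp0 j) (sym (approx-fromℤᶜ 1ℤ (suc j))))) }

  approx-𝐢 : ∀ i → approx 𝐢 i ≡ iᵍ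
  approx-𝐢 i = refl

  cis-¼ : cis (+ 1 / 4) ≋ 𝐢
  cis-¼ = mk≋ (Small-cong
    (λ j → ≤-reflexive (cong₂ (λ x y → ∥ x -ᵍ y ∥) (trans (approx-cis (+ 1 / 4) j) (cong (expᵍ j) (cong (0ℚ +i_) (lem (π-seq j))))) (approx-𝐢 j)))
    exp-quarter)
    where
    lem : ∀ p → (+ 2 / 1) * p * (+ 1 / 4) ≡ ½ * p
    lem = solve-∀ ℚ-ring

  𝐢² : 𝐢 ⊗ 𝐢 ≋ ⊖ fromℤᶜ 1ℤ
  𝐢² = ptw (𝐢 ⊗ 𝐢) (⊖ fromℤᶜ 1ℤ) λ i → trans (approx-* 𝐢 𝐢 i) (sym (approx-- (fromℤᶜ 1ℤ) i))

  -- Complex numbers bounded away from 0 and small angles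

  Small-quotient : ∀ {f g : ℕ → ℚ} δ C N → 0ℚ < δ → 0ℚ < C → (∀ i → N ℕ.≤ i → δ * f i ≤ C * g i) →
    Small (λ i _ → g i) → Small (λ i _ → f i)
  Small-quotient {f} {g} δ C N 0<δ 0<C h g-small ε 0<ε = N ℕ.⊔ proj₁ S , λ i _ p _ →
    *-cancelˡ-<-nonNeg δ {{nonNegative (<⇒≤ 0<δ)}} (≤-<-trans (h i (ℕ.m⊔n≤o⇒m≤o N (proj₁ S) p))
      (proj₂ S i i (ℕ.m⊔n≤o⇒n≤o N (proj₁ S) p) (ℕ.m⊔n≤o⇒n≤o N (proj₁ S) p)))
    where
    S : ∃ λ N → ∀ i j → N ℕ.≤ i → N ℕ.≤ j → C * g i < δ * ε
    S = Small-* {λ i _ → g i} C 0<C g-small (δ * ε) (*-pos 0<δ 0<ε)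

  square-nonneg : ∀ p → 0ℚ ≤ p * p
  square-nonneg p with ≤-total 0ℚ p
  ... | inj₁ 0≤p = *-nonneg 0≤p 0≤p
  ... | inj₂ p≤0 = ≤-trans (*-nonneg (neg-antimono-≤ p≤0) (neg-antimono-≤ p≤0)) (≤-reflexive (lem p))
    where
    lem : ∀ p → - p * - p ≡ p * p
    lem = solve-∀ ℚ-ring

  norm² : ℚ[i] → ℚ
  norm² a = re a * re a + im a * im a

  -- Multiplying a x by the conjugate of a gives |a|² x, and conjugation preserves the ℓ¹ norm.
  norm²-bound : ∀ a x δ → δ ≤ norm² a → δ * ∥ x ∥ ≤ ∥ a ∥ * ∥ a *ᵍ x ∥
  norm²-bound a x δ δ≤ = begin
    δ * ∥ x ∥                  ≤⟨ *-monoʳ ∥ x ∥ (∥∥-nonneg x) δ≤ ⟩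
    norm² a * ∥ x ∥            ≡⟨ sym (∥∥-· (norm² a) x 0≤norm²) ⟩
    ∥ norm² a ·ᵍ x ∥           ≡⟨ cong ∥_∥ (ᵍ-ext (lem₁ (re a) (im a) (re x) (im x)) (lem₂ (re a) (im a) (re x) (im x))) ⟩
    ∥ ā *ᵍ (a *ᵍ x) ∥          ≤⟨ ∥∥-* ā (a *ᵍ x) ⟩
    ∥ ā ∥ * ∥ a *ᵍ x ∥         ≡⟨ cong (_* ∥ a *ᵍ x ∥) (cong (_+_ ∣ re a ∣) (∣-p∣≡∣p∣ (im a))) ⟩
    ∥ a ∥ * ∥ a *ᵍ x ∥ ∎
    where
    open ≤-Reasoning
    ā = re a +i - im a
    0≤norm² : 0ℚ ≤ norm² a
    0≤norm² = +-nonneg (square-nonneg (re a)) (square-nonneg (im a))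
    lem₁ : ∀ a b x y → (a * a + b * b) * x ≡ a * (a * x - b * y) - - b * (a * y + b * x)
    lem₁ = solve-∀ ℚ-ring
    lem₂ : ∀ a b x y → (a * a + b * b) * y ≡ a * (a * y + b * x) + - b * (a * x - b * y)
    lem₂ = solve-∀ ℚ-ring

  ≋0-small : ∀ z → z ≋ fromℤᶜ 0ℤ → Small (λ i _ → ∥ approx z i ∥)
  ≋0-small z (mk≋ h) = Small-cong (λ i → ≤-reflexive (cong ∥_∥ (sym (trans (cong (approx z i -ᵍ_) (approx-fromℤᶜ 0ℤ i)) (G.+-identityʳ (approx z i)))))) h

  small-≋0 : ∀ z → Small (λ i _ → ∥ approx z i ∥) → z ≋ fromℤᶜ 0ℤ
  small-≋0 z h = mk≋ (Small-cong (λ i → ≤-reflexive (cong ∥_∥ (trans (cong (approx z i -ᵍ_) (approx-fromℤᶜ 0ℤ i)) (G.+-identityʳ (approx z i))))) h)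

  -- A lower bound for |a|² on a tail makes a cancellable without constructing an inverse: x is
  -- small as soon as a x is, up to the factor β a / δ.
  *≋0-cancel : ∀ a δ N → 0ℚ < δ → (∀ i → N ℕ.≤ i → δ ≤ norm² (approx a i)) → ∀ x → a ⊗ x ≋ fromℤᶜ 0ℤ → x ≋ fromℤᶜ 0ℤ
  *≋0-cancel a δ N 0<δ h x ax≋0 = small-≋0 x (Small-quotient {λ i → ∥ approx x i ∥} {λ i → ∥ approx (a ⊗ x) i ∥} δ (β a) N 0<δ (0<β a)
    (λ i p → ≤-trans (norm²-bound (approx a i) (approx x i) δ (h i p))
      (≤-trans (*-monoʳ ∥ approx a i *ᵍ approx x i ∥ (∥∥-nonneg (approx a i *ᵍ approx x i)) (approx≤β a i))
        (≤-reflexive (cong (λ y → β a * ∥ y ∥) (sym (approx-* a x i))))))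
    (≋0-small (a ⊗ x) ax≋0))

  ¼ : ℚ
  ¼ = + 1 / 4

  0<¼ : 0ℚ < ¼
  0<¼ = *<* (ℤ.+<+ (s≤s z≤n))

  ∣-∣-lower : ∀ x a {b} → ∣ x - a ∣ ≤ b → a - b ≤ x
  ∣-∣-lower x a {b} h = ≤-trans (+-monoˡ-≤ (- b) (p≤r+q a x (≤-trans (p≤∣p∣ (a - x))
    (≤-trans (≤-reflexive (trans (cong ∣_∣ (lem₂ a x)) (∣-p∣≡∣p∣ (x - a)))) h)))) (≤-reflexive (lem₃ b x))
    where
    lem₂ : ∀ a x → a - x ≡ - (x - a)
    lem₂ = solve-∀ ℚ-ring
    lem₃ : ∀ b x → (b + x) + - b ≡ x
    lem₃ = solve-∀ ℚ-ring

  module _ (φ : ℚ) (∣φ∣≤1 : ∣ φ ∣ ≤ 1ℚ) (n : ℕ) where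

    private
      z = 0ℚ +i φ
      E = expᵍ (2 ℕ.+ n) z

    ∥iφ∥ : ∥ z ∥ ≡ ∣ φ ∣
    ∥iφ∥ = +-identityˡ ∣ φ ∣

    exp-near : ∥ E -ᵍ (1ᵍ +ᵍ z) ∥ ≤ ¾ * (∣ φ ∣ * ∣ φ ∣)
    exp-near = ≤-trans (second z (≤-trans (≤-reflexive ∥iφ∥) ∣φ∣≤1) n) (≤-reflexive (cong (λ a → ¾ * (a * a)) ∥iφ∥))

    cos-lower : ¼ ≤ re E
    cos-lower = ∣-∣-lower (re E) (1ℚ + 0ℚ) (≤-trans (p≤p+q ∣ re E - (1ℚ + 0ℚ) ∣ (0≤∣p∣ (im E - (0ℚ + φ))))
      (≤-trans exp-near (*-monoˡ ¾ (0≤/ 3 4) (*-mono (0≤∣p∣ φ) (<⇒≤ 0<1) ∣φ∣≤1 ∣φ∣≤1))))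

    -- φ² ≤ φ turns the Taylor error ¾ φ² into ¾ φ, so a quarter of the linear term survives.
    sin-lower : 0ℚ ≤ φ → ¼ * φ ≤ im E
    sin-lower 0≤φ = ≤-trans (≤-reflexive (lem φ)) (∣-∣-lower (im E) (0ℚ + φ)
      (≤-trans (p≤q+p ∣ im E - (0ℚ + φ) ∣ (0≤∣p∣ (re E - (1ℚ + 0ℚ)))) (≤-trans exp-near
        (*-monoˡ ¾ (0≤/ 3 4) (≤-trans (*-mono (0≤∣p∣ φ) (<⇒≤ 0<1) ∣φ∣≤1 (≤-reflexive (0≤p⇒∣p∣≡p 0≤φ))) (≤-reflexive (*-identityˡ φ)))))))
      where
      lem : ∀ φ → ¼ * φ ≡ (0ℚ + φ) - ¾ * φ
      lem = solve-∀ ℚ-ring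

  norm²-re : ∀ a {c} → 0ℚ ≤ c → c ≤ re a → c * c ≤ norm² a
  norm²-re a 0≤c h = ≤-trans (*-mono 0≤c (≤-trans 0≤c h) h h) (p≤p+q (re a * re a) (square-nonneg (im a)))

  norm²-im : ∀ a {c} → 0ℚ ≤ c → c ≤ im a → c * c ≤ norm² a
  norm²-im a 0≤c h = ≤-trans (*-mono 0≤c (≤-trans 0≤c h) h h) (p≤q+p (im a * im a) (square-nonneg (re a)))

  Cancellable : ℂ → Set
  Cancellable a = ∀ x → a ⊗ x ≋ fromℤᶜ 0ℤ → x ≋ fromℤᶜ 0ℤ

  cancel-re : ∀ a c → 0ℚ < c → (∀ n → c ≤ re (approx a (2 ℕ.+ n))) → Cancellable a
  cancel-re a c 0<c h = *≋0-cancel a (c * c) 2 (*-pos 0<c 0<c)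
    λ { (suc (suc n)) (s≤s (s≤s z≤n)) → norm²-re (approx a (2 ℕ.+ n)) (<⇒≤ 0<c) (h n) }

  cancel-im : ∀ a c → 0ℚ < c → (∀ n → c ≤ im (approx a (2 ℕ.+ n))) → Cancellable a
  cancel-im a c 0<c h = *≋0-cancel a (c * c) 2 (*-pos 0<c 0<c)
    λ { (suc (suc n)) (s≤s (s≤s z≤n)) → norm²-im (approx a (2 ℕ.+ n)) (<⇒≤ 0<c) (h n) }

  1/4d-pos : ∀ d → 0ℚ < + 1 / (4 ℕ.* (2 ℕ.+ d))
  1/4d-pos d = positive⁻¹ (+ 1 / (4 ℕ.* (2 ℕ.+ d))) {{normalize-pos 1 (4 ℕ.* (2 ℕ.+ d))}}

  -- With π ≤ 4 this keeps the angle 2πt for t = 1/4d within [0, 1]; the factor 4 and d ≥ 2 are just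
  -- sufficient.
  8/4d≤1 : ∀ d → (+ 1 / (4 ℕ.* (2 ℕ.+ d))) * ι 8 ≤ 1ℚ
  8/4d≤1 d = ≤-trans (*-monoˡ (+ 1 / (4 ℕ.* (2 ℕ.+ d))) (0≤/ 1 (4 ℕ.* (2 ℕ.+ d))) (ι-mono {8} {4 ℕ.* (2 ℕ.+ d)} (ℕ.*-monoʳ-≤ 4 (ℕ.m≤m+n 2 d))))
    (≤-reflexive (1/-ι (4 ℕ.* (2 ℕ.+ d))))

  -- By 2 ≤ π ≤ 4 the angle 2πt lies in (0, 1], where cos θ ≥ 1/4 and sin θ ≥ θ/4.
  module SmallAngle (t : ℚ) (0<t : 0ℚ < t) (8t≤1 : t * ι 8 ≤ 1ℚ) where

    0≤t : 0ℚ ≤ t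
    0≤t = <⇒≤ 0<t

    angle-lower : ∀ j → t * ι 4 ≤ (+ 2 / 1) * π-seq j * t
    angle-lower j = ≤-trans (≤-reflexive (lem t)) (*-monoʳ t 0≤t (*-monoˡ (+ 2 / 1) (0≤/ 2 1) (2≤π j)))
      where
      lem : ∀ t → t * ι 4 ≡ (+ 2 / 1) * ι 2 * t
      lem = solve-∀ ℚ-ring

    angle-nonneg : ∀ j → 0ℚ ≤ (+ 2 / 1) * π-seq j * t
    angle-nonneg j = ≤-trans (*-nonneg {t} {ι 4} 0≤t (ι-nonneg 4)) (angle-lower j)

    angle-upper : ∀ j → (+ 2 / 1) * π-seq j * t ≤ 1ℚ
    angle-upper j = ≤-trans (*-monoʳ t 0≤t (*-monoˡ (+ 2 / 1) (0≤/ 2 1) (π≤4 j))) (≤-trans (≤-reflexive (lem t)) 8t≤1)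
      where
      lem : ∀ t → (+ 2 / 1) * ι 4 * t ≡ t * ι 8
      lem = solve-∀ ℚ-ring

    ∣angle∣≤1 : ∀ j → ∣ (+ 2 / 1) * π-seq j * t ∣ ≤ 1ℚ
    ∣angle∣≤1 j = ≤-trans (≤-reflexive (0≤p⇒∣p∣≡p (angle-nonneg j))) (angle-upper j)

    ∣-angle∣≤1 : ∀ j → ∣ (+ 2 / 1) * π-seq j * - t ∣ ≤ 1ℚ
    ∣-angle∣≤1 j = ≤-trans (≤-reflexive (trans (cong ∣_∣ (lem ((+ 2 / 1) * π-seq j) t)) (∣-p∣≡∣p∣ ((+ 2 / 1) * π-seq j * t)))) (∣angle∣≤1 j)
      where
      lem : ∀ x t → x * - t ≡ - (x * t)
      lem = solve-∀ ℚ-ring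

    re-y : ∀ n → ¼ ≤ re (approx (cis t) (2 ℕ.+ n))
    re-y n = ≤-trans (cos-lower ((+ 2 / 1) * π-seq (2 ℕ.+ n) * t) (∣angle∣≤1 (2 ℕ.+ n)) n) (≤-reflexive (cong re (sym (approx-cis t (2 ℕ.+ n)))))

    re-ȳ : ∀ n → ¼ ≤ re (approx (cis (- t)) (2 ℕ.+ n))
    re-ȳ n = ≤-trans (cos-lower ((+ 2 / 1) * π-seq (2 ℕ.+ n) * - t) (∣-angle∣≤1 (2 ℕ.+ n)) n) (≤-reflexive (cong re (sym (approx-cis (- t) (2 ℕ.+ n)))))

    im-y : ∀ n → t ≤ im (approx (cis t) (2 ℕ.+ n))
    im-y n = ≤-trans (≤-reflexive (lem t)) (≤-trans (*-monoˡ ¼ (<⇒≤ 0<¼) (angle-lower (2 ℕ.+ n)))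
      (≤-trans (sin-lower ((+ 2 / 1) * π-seq (2 ℕ.+ n) * t) (∣angle∣≤1 (2 ℕ.+ n)) n (angle-nonneg (2 ℕ.+ n))) (≤-reflexive (cong im (sym (approx-cis t (2 ℕ.+ n)))))))
      where
      lem : ∀ t → t ≡ ¼ * (t * ι 4)
      lem = solve-∀ ℚ-ring

    cancel-y-1 : Cancellable (cis t ⊕ ⊖ fromℤᶜ 1ℤ)
    cancel-y-1 = cancel-im (cis t ⊕ ⊖ fromℤᶜ 1ℤ) t 0<t λ n → ≤-trans (im-y n) (≤-reflexive (sym
      (trans (cong im (trans (approx-+ (cis t) (⊖ fromℤᶜ 1ℤ) (2 ℕ.+ n)) (cong (approx (cis t) (2 ℕ.+ n) +ᵍ_) (approx-- (fromℤᶜ 1ℤ) (2 ℕ.+ n)))))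
        (+-identityʳ (im (approx (cis t) (2 ℕ.+ n)))))))

    cancel-y+1 : Cancellable (cis t ⊕ fromℤᶜ 1ℤ)
    cancel-y+1 = cancel-re (cis t ⊕ fromℤᶜ 1ℤ) ¼ 0<¼ λ n → ≤-trans (re-y n) (≤-trans (p≤p+q (re (approx (cis t) (2 ℕ.+ n))) (<⇒≤ 0<1))
      (≤-reflexive (cong re (sym (approx-+ (cis t) (fromℤᶜ 1ℤ) (2 ℕ.+ n))))))

    cancel-y+ȳ : Cancellable (cis t ⊕ cis (- t))
    cancel-y+ȳ = cancel-re (cis t ⊕ cis (- t)) ¼ 0<¼ λ n → ≤-trans (re-y n) (≤-trans (p≤p+q (re (approx (cis t) (2 ℕ.+ n))) (≤-trans (<⇒≤ 0<¼) (re-ȳ n)))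
      (≤-reflexive (cong re (sym (approx-+ (cis t) (cis (- t)) (2 ℕ.+ n))))))

  approx-√3 : ∀ i → approx (fromℝ (√ 3)) i ≡ (√-seq 3 i +i 0ℚ)
  approx-√3 i = refl

  √-nonneg : ∀ i → 0ℚ ≤ √-seq 3 i
  √-nonneg i = 0≤/ (isqrt (3 ℕ.* (suc i ℕ.* suc i))) (suc i)

  -- Multiplication by i moves the real part of y = e^{2πi/12} to the imaginary part, which in total
  -- is 2 Re y + √3. Both contributions are nonnegative and Re y ≥ ¼.
  cancel-iy : Cancellable ((fromℤᶜ 1ℤ ⊕ fromℤᶜ 1ℤ) ⊗ (𝐢 ⊗ cis (+ 1 / 12)) ⊕ fromℤᶜ 1ℤ ⊕ 𝐢 ⊗ fromℝ (√ 3))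
  cancel-iy = cancel-im ((fromℤᶜ 1ℤ ⊕ fromℤᶜ 1ℤ) ⊗ (𝐢 ⊗ cis (+ 1 / 12)) ⊕ fromℤᶜ 1ℤ ⊕ 𝐢 ⊗ fromℝ (√ 3)) ¼ 0<¼ λ n →
    ≤-trans (bound (approx (cis (+ 1 / 12)) (2 ℕ.+ n)) (√-seq 3 (2 ℕ.+ n)) (re-y n) (√-nonneg (2 ℕ.+ n)))
      (≤-reflexive (cong im (sym (expand (2 ℕ.+ n)))))
    where
    open SmallAngle (+ 1 / 12) (1/4d-pos 1) (8/4d≤1 1) using (re-y)
    expand : ∀ i → approx ((fromℤᶜ 1ℤ ⊕ fromℤᶜ 1ℤ) ⊗ (𝐢 ⊗ cis (+ 1 / 12)) ⊕ fromℤᶜ 1ℤ ⊕ 𝐢 ⊗ fromℝ (√ 3)) i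
      ≡ ((1ᵍ +ᵍ 1ᵍ) *ᵍ (iᵍ *ᵍ approx (cis (+ 1 / 12)) i) +ᵍ 1ᵍ) +ᵍ iᵍ *ᵍ (√-seq 3 i +i 0ℚ)
    expand i = trans (approx-+ ((fromℤᶜ 1ℤ ⊕ fromℤᶜ 1ℤ) ⊗ (𝐢 ⊗ cis (+ 1 / 12)) ⊕ fromℤᶜ 1ℤ) (𝐢 ⊗ fromℝ (√ 3)) i) (cong₂ _+ᵍ_
      (trans (approx-+ ((fromℤᶜ 1ℤ ⊕ fromℤᶜ 1ℤ) ⊗ (𝐢 ⊗ cis (+ 1 / 12))) (fromℤᶜ 1ℤ) i) (cong₂ _+ᵍ_
        (trans (approx-* (fromℤᶜ 1ℤ ⊕ fromℤᶜ 1ℤ) (𝐢 ⊗ cis (+ 1 / 12)) i) (cong₂ _*ᵍ_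
          (trans (approx-+ (fromℤᶜ 1ℤ) (fromℤᶜ 1ℤ) i) (cong₂ _+ᵍ_ (approx-fromℤᶜ 1ℤ i) (approx-fromℤᶜ 1ℤ i)))
          (trans (approx-* 𝐢 (cis (+ 1 / 12)) i) (cong (_*ᵍ approx (cis (+ 1 / 12)) i) (approx-𝐢 i)))))
        (approx-fromℤᶜ 1ℤ i)))
      (trans (approx-* 𝐢 (fromℝ (√ 3)) i) (cong₂ _*ᵍ_ (approx-𝐢 i) (approx-√3 i))))
    lem : ∀ a b r → ((1ℚ + 1ℚ) * (0ℚ * b + 1ℚ * a) + (0ℚ + 0ℚ) * (0ℚ * a - 1ℚ * b) + 0ℚ) + (0ℚ * 0ℚ + 1ℚ * r) ≡ a + (a + r)
    lem = solve-∀ ℚ-ring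
    bound : ∀ Y r → ¼ ≤ re Y → 0ℚ ≤ r → ¼ ≤ im (((1ᵍ +ᵍ 1ᵍ) *ᵍ (iᵍ *ᵍ Y) +ᵍ 1ᵍ) +ᵍ iᵍ *ᵍ (r +i 0ℚ))
    bound Y r ¼≤ 0≤r = ≤-trans (≤-trans ¼≤ (p≤p+q (re Y) (+-nonneg (≤-trans (<⇒≤ 0<¼) ¼≤) 0≤r))) (≤-reflexive (sym (lem (re Y) (im Y) r)))

  -- The square of √3

  module SquareRoot (a k : ℕ) where

    private
      N = suc k
      s = isqrt (suc a ℕ.* (N ℕ.* N))

    -- The crude bound √a ≤ a, valid for a ≥ 1, which is why the radicand is written `suc a`.
    s≤aN : s ℕ.≤ suc a ℕ.* N
    s≤aN = ²-cancel s (suc a ℕ.* N) (ℕ.≤-trans (isqrt-lower (suc a ℕ.* (N ℕ.* N)))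
      (ℕ.≤-trans (ℕ.m≤n*m (suc a ℕ.* (N ℕ.* N)) (suc a)) (ℕ.≤-reflexive (lem (suc a) N))))
      where
      lem : ∀ a N → a ℕ.* (a ℕ.* (N ℕ.* N)) ≡ (a ℕ.* N) ℕ.* (a ℕ.* N)
      lem = ℕ-Solver.solve-∀

    -- From aN² < (s + 1)² = s² + 2s + 1, where s ≤ aN makes the deficit linear in N and hence
    -- O(1/N) after division by N²; here a stands for `suc a`.
    aN²≤ : suc a ℕ.* (N ℕ.* N) ℕ.≤ s ℕ.* s ℕ.+ (suc a ℕ.+ suc a) ℕ.* N
    aN²≤ = ℕ.≤-pred (ℕ.≤-trans (isqrt-upper (suc a ℕ.* (N ℕ.* N)))
      (ℕ.≤-trans (ℕ.≤-reflexive (lem₁ s)) (ℕ.s≤s (ℕ.+-monoʳ-≤ (s ℕ.* s) (ℕ.≤-trans (ℕ.+-mono-≤ s≤aN s≤aN) (ℕ.≤-reflexive (lem₂ (suc a) N)))))))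
      where
      lem₁ : ∀ s → suc s ℕ.* suc s ≡ suc (s ℕ.* s ℕ.+ (s ℕ.+ s))
      lem₁ = ℕ-Solver.solve-∀
      lem₂ : ∀ a N → a ℕ.* N ℕ.+ a ℕ.* N ≡ (a ℕ.+ a) ℕ.* N
      lem₂ = ℕ-Solver.solve-∀

    √²≡ : √-seq (suc a) k * √-seq (suc a) k ≡ + (s ℕ.* s) / (N ℕ.* N)
    √²≡ = /-* s N s N

    √²≤ : √-seq (suc a) k * √-seq (suc a) k ≤ + suc a / 1
    √²≤ = ≤-trans (≤-reflexive √²≡) (/-≤ (s ℕ.* s) (N ℕ.* N) (suc a) 1
      (ℕ.≤-trans (ℕ.≤-reflexive (ℕ.*-identityʳ (s ℕ.* s))) (isqrt-lower (suc a ℕ.* (N ℕ.* N)))))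

    ≤√² : + suc a / 1 ≤ √-seq (suc a) k * √-seq (suc a) k + + (suc a ℕ.+ suc a) / N
    ≤√² = ≤-trans (/-≤ (suc a) 1 (s ℕ.* s ℕ.* N ℕ.+ (suc a ℕ.+ suc a) ℕ.* (N ℕ.* N)) (N ℕ.* N ℕ.* N)
        (ℕ.≤-trans (ℕ.≤-reflexive (lem₁ (suc a) N)) (ℕ.≤-trans (ℕ.*-monoˡ-≤ N aN²≤) (ℕ.≤-reflexive (lem₂ (s ℕ.* s) (suc a ℕ.+ suc a) N)))))
      (≤-reflexive (trans (sym (/-+ (s ℕ.* s) (N ℕ.* N) (suc a ℕ.+ suc a) N)) (cong (_+ (+ (suc a ℕ.+ suc a) / N)) (sym √²≡))))
      where
      lem₁ : ∀ a N → a ℕ.* (N ℕ.* N ℕ.* N) ≡ a ℕ.* (N ℕ.* N) ℕ.* N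
      lem₁ = ℕ-Solver.solve-∀
      lem₂ : ∀ s b N → (s ℕ.+ b ℕ.* N) ℕ.* N ≡ (s ℕ.* N ℕ.+ b ℕ.* (N ℕ.* N)) ℕ.* 1
      lem₂ = ℕ-Solver.solve-∀

    ∣√²-a∣ : ∣ √-seq (suc a) k * √-seq (suc a) k - + suc a / 1 ∣ ≤ ι (suc a ℕ.+ suc a) * (+ 1 / suc k + + 1 / suc k)
    ∣√²-a∣ = ∣p-q∣≤ x b
      (≤-trans (p-q≤r x b (≤-trans √²≤ (p≤q+p b 0≤e))) ≤-refl)
      (p-q≤r b x (≤-trans ≤√² (≤-trans (≤-reflexive (+-comm x (+ (suc a ℕ.+ suc a) / N))) (+-monoˡ-≤ x e≥))))
      where
      x = √-seq (suc a) k * √-seq (suc a) k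
      b = + suc a / 1
      c = ι (suc a ℕ.+ suc a)
      h = + 1 / suc k
      0≤e : 0ℚ ≤ c * (h + h)
      0≤e = *-nonneg {c} {h + h} (ι-nonneg (suc a ℕ.+ suc a)) (+-nonneg (0≤/ 1 N) (0≤/ 1 N))
      e≥ : + (suc a ℕ.+ suc a) / N ≤ c * (h + h)
      e≥ = ≤-trans (≤-reflexive (sym (trans (cong (_* h) (ι-≡ (suc a ℕ.+ suc a))) (trans (/-* (suc a ℕ.+ suc a) 1 1 N)
          (/-≡ ((suc a ℕ.+ suc a) ℕ.* 1) (1 ℕ.* N) (suc a ℕ.+ suc a) N (lem (suc a ℕ.+ suc a) N))))))
        (*-monoˡ c (ι-nonneg (suc a ℕ.+ suc a)) (p≤p+q h (0≤/ 1 N)))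
        where
        lem : ∀ b N → (b ℕ.* 1) ℕ.* N ≡ b ℕ.* (1 ℕ.* N)
        lem = ℕ-Solver.solve-∀

  √3² : fromℝ (√ 3) ⊗ fromℝ (√ 3) ≋ fromℤᶜ 1ℤ ⊕ (fromℤᶜ 1ℤ ⊕ fromℤᶜ 1ℤ)
  √3² = mk≋ (Small-cong (λ i → ≤-trans (≤-reflexive (eq i)) (SquareRoot.∣√²-a∣ 2 i))
    λ ε 0<ε → proj₁ (S ε 0<ε) , λ i _ p _ → proj₂ (S ε 0<ε) i i p p)
    where
    S : Small (λ i j → ι 6 * (+ 1 / suc i + + 1 / suc j))
    S = Small-* {λ i j → + 1 / suc i + + 1 / suc j} (ι 6) (*<* (ℤ.+<+ (s≤s z≤n))) Small-recip
    approx-3 : ∀ i → approx (fromℤᶜ 1ℤ ⊕ (fromℤᶜ 1ℤ ⊕ fromℤᶜ 1ℤ)) i ≡ (+ 3 / 1 +i 0ℚ)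
    approx-3 i = trans (approx-+ (fromℤᶜ 1ℤ) (fromℤᶜ 1ℤ ⊕ fromℤᶜ 1ℤ) i) (cong (1ᵍ +ᵍ_) (approx-+ (fromℤᶜ 1ℤ) (fromℤᶜ 1ℤ) i))
    eq : ∀ i → ∥ approx ((fromℝ (√ 3)) ⊗ (fromℝ (√ 3))) i -ᵍ approx (fromℤᶜ 1ℤ ⊕ (fromℤᶜ 1ℤ ⊕ fromℤᶜ 1ℤ)) i ∥ ≡ ∣ √-seq 3 i * √-seq 3 i - + 3 / 1 ∣
    eq i = trans (cong₂ (λ x y → ∥ x -ᵍ y ∥) (trans (approx-* (fromℝ (√ 3)) (fromℝ (√ 3)) i) (trans (cong₂ _*ᵍ_ (approx-√3 i) (approx-√3 i)) (real* (√-seq 3 i) (√-seq 3 i)))) (approx-3 i))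
      (+-identityʳ ∣ √-seq 3 i * √-seq 3 i - + 3 / 1 ∣)

-- Instantiation in ℂ and return to the operations of the statement

open import Data.Nat using (NonZero; _*_; _∸_)
open import Data.Nat.Divisibility using (_∣_)
open import Data.Integer using (1ℤ)
open import Data.Integer.GCD using (gcd)
open import Data.Rational using (_/_)
open import Data.Product using (_×_)
open ≡ using (refl; sym; trans; cong; cong₂)
open Analysis
open ℂ-Ring

module ℂ-Evaluation = MainSum.Evaluation ℂ-ring fromℤᶜ fromℤᶜ-+ fromℤᶜ-* (≋-refl {fromℤᶜ 0ℤ}) (≋-refl {fromℤᶜ 1ℤ})
  cis cis-+ cis-0 𝐢 (fromℝ (√ 3)) cis-¼ 𝐢² √3²
  (λ d → SmallAngle.cancel-y-1 (+ 1 / (4 * suc (suc d))) (1/4d-pos d) (8/4d≤1 d))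
  (λ d → SmallAngle.cancel-y+1 (+ 1 / (4 * suc (suc d))) (1/4d-pos d) (8/4d≤1 d))
  (λ d → SmallAngle.cancel-y+ȳ (+ 1 / (4 * suc (suc d))) (1/4d-pos d) (8/4d≤1 d))
  cancel-iy

open FiniteSums ℂ-ring using (Σ<; _^_)

-- The opaque ring operations are propositionally equal to `_+ᶜ_` and `_*ᶜ_`, so powers, polynomial
-- values and sums translate by plain equality, and `≋⇒≃` is needed only for the final comparison.
^ᶜ≡^ : ∀ z k → z ^ᶜ k ≡ z ^ k
^ᶜ≡^ z zero    = refl
^ᶜ≡^ z (suc k) = trans (sym (⊗≡*ᶜ z (z ^ᶜ k))) (cong (z ⊗_) (^ᶜ≡^ z k))

eval≡ : ∀ p z → eval p z ≡ ℂ-Evaluation.Eval.⟦_⟧ z p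
eval≡ []      z = refl
eval≡ (a ∷ p) z = trans (sym (⊕≡+ᶜ (fromℤᶜ a) (z *ᶜ eval p z)))
  (cong (fromℤᶜ a ⊕_) (trans (sym (⊗≡*ᶜ z (eval p z))) (cong (z ⊗_) (eval≡ p z))))

Σ₁≡Σ< : ∀ n (f g : ℕ → ℂ) → (∀ k → f (suc k) ≡ g k) → Σ₁ n f ≡ Σ< n g
Σ₁≡Σ< zero    f g h = refl
Σ₁≡Σ< (suc n) f g h = trans (sym (⊕≡+ᶜ (Σ₁ n f) (f (suc n)))) (cong₂ _⊕_ (Σ₁≡Σ< n f g h) (h n))

module _ (P : ℕ → Poly) (n : ℕ) (q : ℂ) where

  term≡ : ∀ k → q ^ᶜ k *ᶜ eval (P k) q ≡ q ^ k ⊗ ℂ-Evaluation.Eval.⟦_⟧ q (P k)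
  term≡ k = trans (sym (⊗≡*ᶜ (q ^ᶜ k) (eval (P k) q))) (cong₂ _⊗_ (^ᶜ≡^ q k) (eval≡ (P k) q))

  Σ≡ : (Σ[1≤ k ≤ n ] (q ^ᶜ k *ᶜ eval (P k) q)) ≡ Σ< n (λ k → q ^ suc k ⊗ ℂ-Evaluation.Eval.⟦_⟧ q (P (suc k)))
  Σ≡ = Σ₁≡Σ< n (λ k → q ^ᶜ k *ᶜ eval (P k) q) (λ k → q ^ suc k ⊗ ℂ-Evaluation.Eval.⟦_⟧ q (P (suc k))) (λ k → term≡ (suc k))

affine≡ : ∀ a b z w → z ≡ w → a +ᶜ b *ᶜ z ≡ a ⊕ b ⊗ w
affine≡ a b z .z refl = trans (sym (⊕≡+ᶜ a (b *ᶜ z))) (cong (a ⊕_) (sym (⊗≡*ᶜ b z)))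

sum≡ : ∀ n′ q → fromℤᶜ 1ℤ +ᶜ fromℤᶜ (+ 2) *ᶜ (Σ[1≤ k ≤ n′ ] (q ^ᶜ k *ᶜ eval ((2 * k ∸ 1) choose k) q)) ≡ ℂ-Evaluation.sum q n′
sum≡ n′ q = affine≡ (fromℤᶜ 1ℤ) (fromℤᶜ (+ 2))
  (Σ[1≤ k ≤ n′ ] (q ^ᶜ k *ᶜ eval ((2 * k ∸ 1) choose k) q))
  (Σ< n′ (λ k → q ^ suc k ⊗ ℂ-Evaluation.Eval.⟦_⟧ q ((2 * suc k ∸ 1) choose suc k)))
  (Σ≡ (λ k → (2 * k ∸ 1) choose k) n′ q)

product≡ : ∀ a b c → a ⊗ b ⊗ c ≡ a *ᶜ b *ᶜ c
product≡ a b c = times≡ (a ⊗ b) (a *ᶜ b) (⊗≡*ᶜ a b)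
  where
  times≡ : ∀ x y → x ≡ y → x ⊗ c ≡ y *ᶜ c
  times≡ x .x refl = ⊗≡*ᶜ x c

≋-to-≃ : ∀ {z z′ w w′} → z ≡ z′ → w′ ≡ w → z′ ≋ w′ → z ≃ w
≋-to-≃ {z} {.z} {w} {.w} refl refl = ≋⇒≃ {z} {w}

transport : ∀ n′ m q q′ → q ≡ q′ → ℂ-Evaluation.Conclusion n′ m q → ℂ-Evaluation.Conclusion n′ m q′
transport n′ m q .q refl h = h

sum≃ : ∀ n′ q w w′ → w′ ≡ w → ℂ-Evaluation.sum q n′ ≋ w′ →
  fromℤᶜ 1ℤ +ᶜ fromℤᶜ (+ 2) *ᶜ (Σ[1≤ k ≤ n′ ] (q ^ᶜ k *ᶜ eval ((2 * k ∸ 1) choose k) q)) ≃ w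
sum≃ n′ q w w′ e h = ≋-to-≃ {fromℤᶜ 1ℤ +ᶜ fromℤᶜ (+ 2) *ᶜ (Σ[1≤ k ≤ n′ ] (q ^ᶜ k *ᶜ eval ((2 * k ∸ 1) choose k) q))}
  {ℂ-Evaluation.sum q n′} {w} {w′} (sum≡ n′ q) e h

conclusion : ∀ n′ m q → ℂ-Evaluation.Conclusion n′ m q →
  let S = fromℤᶜ 1ℤ +ᶜ fromℤᶜ (+ 2) *ᶜ (Σ[1≤ k ≤ n′ ] (q ^ᶜ k *ᶜ eval ((2 * k ∸ 1) choose k) q))
  in (3 ∣ suc n′ → S ≃ fromℤᶜ (legendre₃ m) *ᶜ 𝐢 *ᶜ fromℝ (√ 3))
   × (¬ (3 ∣ suc n′) → S ≃ fromℤᶜ (legendre₃ (+ suc n′)))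
conclusion n′ m q (f , g) =
    (λ 3∣n → sum≃ n′ q (fromℤᶜ (legendre₃ m) *ᶜ 𝐢 *ᶜ fromℝ (√ 3)) (fromℤᶜ (legendre₃ m) ⊗ 𝐢 ⊗ fromℝ (√ 3))
      (product≡ (fromℤᶜ (legendre₃ m)) 𝐢 (fromℝ (√ 3))) (f 3∣n))
  , (λ 3∤n → sum≃ n′ q (fromℤᶜ (legendre₃ (+ suc n′))) (fromℤᶜ (legendre₃ (+ suc n′))) refl (g 3∤n))

conclusion-exp : ∀ n′ m r → ℂ-Evaluation.Conclusion n′ m (cis r) →
  let q = exp (fromℤᶜ (+ 2) *ᶜ fromℝ π *ᶜ fromℚᶜ r *ᶜ 𝐢)
      S = fromℤᶜ 1ℤ +ᶜ fromℤᶜ (+ 2) *ᶜ (Σ[1≤ k ≤ n′ ] (q ^ᶜ k *ᶜ eval ((2 * k ∸ 1) choose k) q))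
  in (3 ∣ suc n′ → S ≃ fromℤᶜ (legendre₃ m) *ᶜ 𝐢 *ᶜ fromℝ (√ 3))
   × (¬ (3 ∣ suc n′) → S ≃ fromℤᶜ (legendre₃ (+ suc n′)))
conclusion-exp n′ m r h = conclusion n′ m (exp (fromℤᶜ (+ 2) *ᶜ fromℝ π *ᶜ fromℚᶜ r *ᶜ 𝐢))
  (transport n′ m (cis r) (exp (fromℤᶜ (+ 2) *ᶜ fromℝ π *ᶜ fromℚᶜ r *ᶜ 𝐢)) (cis≡ r) h)

theorem5p1 :
    (n : ℕ) .{{_ : NonZero n}} (m : ℤ) → gcd (+ n) m ≡ 1ℤ →
    let q = exp (fromℤᶜ (+ 2) *ᶜ fromℝ π *ᶜ fromℚᶜ (m / n) *ᶜ 𝐢)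
        S = fromℤᶜ 1ℤ +ᶜ fromℤᶜ (+ 2) *ᶜ (Σ[1≤ k ≤ n ∸ 1 ] (q ^ᶜ k *ᶜ eval ((2 * k ∸ 1) choose k) q))
    in (3 ∣ n → S ≃ fromℤᶜ (legendre₃ m) *ᶜ 𝐢 *ᶜ fromℝ (√ 3))
     × (¬ (3 ∣ n) → S ≃ fromℤᶜ (legendre₃ (+ n)))
theorem5p1 (suc n′) {{nz}} m gcd≡1 = conclusion-exp n′ m (_/_ m (suc n′) {{nz}})
  (ℂ-Evaluation.evaluation n′ m (gcd≡1⇒coprime (ℤ.+-injective gcd≡1)))
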